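{- Let $c,d\in\mathbb{Z}$ be such that $g(x)=x^5+cx^4+d\in\mathbb{Z}[x]$ is irreducible over $\mathbb{Q}$, and let $\theta$ be a root of $g$. Suppose that \[\frac{5^5d+2^8c^5}{\gcd(5^5d,\,2^8c^5)}\] is square-free. Then $\mathbb{Z}[\theta]$ is the full ring of integers of $\mathbb{Q}(\theta)$ if and only if $d$ is square-free and, in the case $5\mid c$ and $5\nmid d$, one has $c+d\not\equiv 1,7,18,24\pmod{25}$.
   Context: For a number field $K$ with ring of integers $\mathcal{O}_K$, $\theta$ generates a power integral basis if $\mathcal{O}_K=\mathbb{Z}[\theta]$. -}

module Defs where

open import Data.Nat as ℕ using (ℕ; zero; suc)
open import Data.Nat.Divisibility as ℕD using ()
open import Data.Nat.GCD using (gcd)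
open import Data.Integer as ℤ using (ℤ; +_; ∣_∣)
open import Data.Rational as ℚ using (ℚ; 0ℚ; 1ℚ)
open import Data.Rational.Properties using () renaming (_≟_ to _≟ℚ_)
open import Data.List as List using (List; []; _∷_; _++_; [_]; reverse; length)
open import Data.Vec as Vec using (Vec; []; _∷_)
open import Data.Product using (∃; _×_)
open import Data.Sum using (_⊎_)
open import Relation.Nullary using (yes; no)
open import Relation.Binary.PropositionalEquality using (_≡_)

-- Polynomials over ℚ, as coefficient lists (lowest degree first)

QPoly : Set
QPoly = List ℚ

private
  dropZeros : List ℚ → List ℚ
  dropZeros [] = []
  dropZeros (a ∷ as) with a ≟ℚ 0ℚ
  ... | yes _ = dropZeros as
  ... | no _  = a ∷ as

normalise : QPoly → QPoly
normalise p = reverse (dropZeros (reverse p))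

-- degree (the zero polynomial gets degree 0; irrelevant below)
degree : QPoly → ℕ
degree p = length (normalise p) ℕ.∸ 1

_+ₚ_ : QPoly → QPoly → QPoly
[] +ₚ q = q
(a ∷ p) +ₚ [] = a ∷ p
(a ∷ p) +ₚ (b ∷ q) = (a ℚ.+ b) ∷ (p +ₚ q)

_*ₚ_ : QPoly → QPoly → QPoly
[] *ₚ q = []
(a ∷ p) *ₚ q = List.map (a ℚ.*_) q +ₚ (0ℚ ∷ (p *ₚ q))

_≈ₚ_ : QPoly → QPoly → Set
p ≈ₚ q = normalise p ≡ normalise q

-- Irreducibility over ℚ of a polynomial of positive degree:
-- it is not a unit (degree ≥ 1) and in every factorisation p = a*b
-- one factor is a unit, i.e. a nonzero constant (degree 0).
IrreducibleQ : QPoly → Set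
IrreducibleQ p = (1 ℕ.≤ degree p) ×
  (∀ (a b : QPoly) → (a *ₚ b) ≈ₚ p → (degree a ≡ 0) ⊎ (degree b ≡ 0))

ℤ→ℚ : ℤ → ℚ
ℤ→ℚ z = z ℚ./ 1

gPoly : ℤ → ℤ → QPoly
gPoly c d = ℤ→ℚ d ∷ 0ℚ ∷ 0ℚ ∷ 0ℚ ∷ ℤ→ℚ c ∷ 1ℚ ∷ []

-- The number field K = ℚ(θ) ≅ ℚ[x]/(g), g = x^5 + c x^4 + d.
-- An element is its coordinate vector w.r.t. the ℚ-basis 1,θ,…,θ⁴.

K : Set
K = Vec ℚ 5

0K : K
0K = Vec.replicate 5 0ℚ

1K : K
1K = 1ℚ ∷ 0ℚ ∷ 0ℚ ∷ 0ℚ ∷ 0ℚ ∷ []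

θK : K
θK = 0ℚ ∷ 1ℚ ∷ 0ℚ ∷ 0ℚ ∷ 0ℚ ∷ []

_+K_ : K → K → K
_+K_ = Vec.zipWith ℚ._+_

_•K_ : ℚ → K → K
q •K v = Vec.map (q ℚ.*_) v

module Field (c d : ℤ) where

  -- multiplication by θ, using θ⁵ = -c θ⁴ - d
  mulθ : K → K
  mulθ (a0 ∷ a1 ∷ a2 ∷ a3 ∷ a4 ∷ []) =
    (ℚ.- (a4 ℚ.* ℤ→ℚ d)) ∷ a0 ∷ a1 ∷ a2 ∷ (a3 ℚ.- (a4 ℚ.* ℤ→ℚ c)) ∷ []

  act : List ℚ → K → K
  act [] v = 0K
  act (a ∷ as) v = (a •K v) +K mulθ (act as v)

  _*K_ : K → K → K
  u *K v = act (Vec.toList u) v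

  evalℤ : List ℤ → K → K
  evalℤ [] α = 0K
  evalℤ (a ∷ as) α = (ℤ→ℚ a •K 1K) +K (α *K evalℤ as α)

  IsAlgInt : K → Set
  IsAlgInt α = ∃ λ (cs : List ℤ) → evalℤ (cs ++ [ + 1 ]) α ≡ 0K

  InZθ : K → Set
  InZθ α = ∃ λ (p : List ℤ) → evalℤ p θK ≡ α

  PowerIntegralBasis : Set
  PowerIntegralBasis = ∀ (α : K) → (IsAlgInt α → InZθ α) × (InZθ α → IsAlgInt α)

SquareFree : ℤ → Set
SquareFree n = ∀ (k : ℕ) → (k ℕ.* k) ℕD.∣ ∣ n ∣ → k ≡ 1

{-# OPTIONS --safe #-}
module Submission where

-- Let g = x⁵ + c x⁴ + d and θ a root of it. An algebraic integer α has a denominator N with N αᵏ ∈ ℤ[θ] for all k, so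
-- maximality of ℤ[θ] can be tested one prime at a time: f(θ)/p with bounded denominators must force f ∈ (p, g) in ℤ[x].
-- Write g = (x - r)ᵃ w - p v with p ∤ w(r), p ∤ v(r) and w squarefree modulo p. As ((x - r)ᵃ⁻¹ w)ᵃ ≡ pᵃ⁻¹ vᵃ⁻¹ w,
-- the element (x - r)ᵃ⁻¹ w is not p times an integral element, and f is divisible by (x - r)ᵃ modulo (p, g); being
-- nilpotent it is also divisible by w. The choices are r = 0 when p ∣ d, r = -d when p = 5 ∣ c, and r = 4t with
-- c ≡ -5t (mod p²) when p divides 5⁵ d + 2⁸ c⁵, the discriminant of g up to a power of d; otherwise g is squarefree modulo p.
-- Conversely, if k² ∣ g(r) and k ∣ g'(r), write g = (x - r) A + g(r): then A(θ)/k is an integral element outside ℤ[θ].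
-- Integrality of an element stabilising ℤ[θ] comes from division-free Gaussian elimination, which keeps the diagonal
-- entries monic of larger degree than the others.

-- Integrality involves an unknown monic polynomial, whereas bounded denominators are a condition on
-- polynomials alone. It passes from f to h f, to everything congruent to f modulo (p, g), and to
-- powers. So the local work takes place in ℤ[x], where monic polynomials can be cancelled modulo p;
-- neither factorisation over the field with p elements nor prime ideals of the number field come
-- in. The point 4t is the nonzero root of g' = x³ (5x + 4c), and c = -5t is wanted modulo p²
-- because Dedekind's criterion looks at g(4t) modulo p². The square-free quotient enters at primes
-- p dividing neither 5 nor d: such a p does not divide the gcd, so p² does not divide 5⁵ d + 2⁸ c⁵,
-- which there means that p² does not divide g(4t). At p = 5 with 5 ∣ c and 5 ∤ d the number to
-- watch is g(-d), congruent to c + d - d⁵ modulo 25, and d⁵ takes exactly the values 1, 7, 18, 24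
-- modulo 25.

module Proof where

  open import Algebra.Bundles using (CommutativeRing)
  import Algebra.Solver.Ring
  open import Algebra.Solver.Ring.AlmostCommutativeRing using (fromCommutativeRing; _-Raw-AlmostCommutative⟶_; -raw-almostCommutative⟶)
  open import Algebra.Structures using (IsCommutativeRing)
  open import Data.Integer as ℤ using (ℤ; +_; 0ℤ; 1ℤ)
  open import Data.Integer.Divisibility.Signed using (_∣_; divides; _∣?_; ∣ᵤ⇒∣; ∣⇒∣ᵤ; ∣-trans; ∣m∣n⇒∣m+n; ∣m⇒∣-m; ∣n⇒∣m*n; ∣m⇒∣m*n; ∣m+n∣m⇒∣n; ∣m+n∣n⇒∣m)
  open import Data.Integer.DivMod using (_%ℕ_; _/ℕ_; a≡a%ℕn+[a/ℕn]*n; n%ℕd<d)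
  import Data.Integer.Properties as ℤₚ
  import Data.Integer.Solver
  open import Data.List using (List; []; _∷_; _++_; map; length)
  open import Data.Maybe using (Maybe; just; nothing)
  open import Data.Nat as ℕ using (ℕ; zero; suc; z≤n; s≤s)
  open import Data.Nat.Coprimality using (Coprime; coprime-Bézout)
  import Data.Nat.Divisibility as ℕ∣
  open import Data.Nat.GCD using (gcd; gcd[m,n]∣m; gcd[m,n]∣n; module Bézout)
  open import Data.Nat.Induction using (<-wellFounded)
  open import Data.Nat.Primality using (Prime; prime?; euclidsLemma; prime⇒irreducible; prime⇒nonZero; prime⇒nonTrivial; ¬prime[0]; ¬prime[1])
  import Data.Nat.Properties as ℕₚ
  open import Data.Product using (∃; ∃₂; _×_; _,_; proj₁; proj₂)
  open import Data.Sum using (_⊎_; inj₁; inj₂; [_,_]′)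
  open import Function using (_∘_)
  open import Induction.WellFounded using (Acc; acc)
  open import Relation.Binary.Bundles using (Setoid)
  open import Relation.Binary.PropositionalEquality as ≡ using (_≡_; cong; cong₂; subst; module ≡-Reasoning)
  import Relation.Binary.Reasoning.Setoid as SetoidReasoning
  open import Relation.Nullary using (Dec; ¬_; yes; no; contradiction)
  open import Relation.Nullary.Decidable using (decidable-stable; from-yes; from-no)

  module ℤS = Data.Integer.Solver.+-*-Solver

  -- The ring ℤ[x] of coefficient lists

  ℤ[X] : Set
  ℤ[X] = List ℤ

  coeff : ℤ[X] → ℕ → ℤ
  coeff []      _       = 0ℤ
  coeff (a ∷ f) zero    = a
  coeff (a ∷ f) (suc i) = coeff f i

  infix 4 _≈_
  -- Trailing zeros are allowed in a list, so equality of polynomials is coefficientwise.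
  record _≈_ (f g : ℤ[X]) : Set where
    constructor ext
    field at : ∀ i → coeff f i ≡ coeff g i
  open _≈_ public

  infixl 6 _⊕_
  infixl 7 _⊗_ _·_
  infix  8 ⊝_

  const : ℤ → ℤ[X]
  const a = a ∷ []

  X : ℤ[X]
  X = 0ℤ ∷ 1ℤ ∷ []

  ≈-refl : ∀ {f} → f ≈ f
  ≈-refl = ext λ _ → ≡.refl

  ≈-sym : ∀ {f g} → f ≈ g → g ≈ f
  ≈-sym e = ext λ i → ≡.sym (at e i)

  ≈-trans : ∀ {f g h} → f ≈ g → g ≈ h → f ≈ h
  ≈-trans e e′ = ext λ i → ≡.trans (at e i) (at e′ i)

  _·_ : ℤ → ℤ[X] → ℤ[X]
  a · f = map (a ℤ.*_) f

  opaque
    _⊕_ : ℤ[X] → ℤ[X] → ℤ[X]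
    []      ⊕ g       = g
    (a ∷ f) ⊕ []      = a ∷ f
    (a ∷ f) ⊕ (b ∷ g) = a ℤ.+ b ∷ f ⊕ g

    ⊝_ : ℤ[X] → ℤ[X]
    ⊝ f = map ℤ.-_ f

    _⊗_ : ℤ[X] → ℤ[X] → ℤ[X]
    []      ⊗ g = []
    (a ∷ f) ⊗ g = a · g ⊕ (0ℤ ∷ f ⊗ g)

    coeff-⊕ : ∀ f g i → coeff (f ⊕ g) i ≡ coeff f i ℤ.+ coeff g i
    coeff-⊕ []      g       i       = ≡.sym (ℤₚ.+-identityˡ _)
    coeff-⊕ (a ∷ f) []      i       = ≡.sym (ℤₚ.+-identityʳ _)
    coeff-⊕ (a ∷ f) (b ∷ g) zero    = ≡.refl
    coeff-⊕ (a ∷ f) (b ∷ g) (suc i) = coeff-⊕ f g i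

    coeff-· : ∀ a f i → coeff (a · f) i ≡ a ℤ.* coeff f i
    coeff-· a []      i       = ≡.sym (ℤₚ.*-zeroʳ a)
    coeff-· a (b ∷ f) zero    = ≡.refl
    coeff-· a (b ∷ f) (suc i) = coeff-· a f i

    coeff-⊝ : ∀ f i → coeff (⊝ f) i ≡ ℤ.- coeff f i
    coeff-⊝ []      i       = ≡.refl
    coeff-⊝ (b ∷ f) zero    = ≡.refl
    coeff-⊝ (b ∷ f) (suc i) = coeff-⊝ f i

    ∷-cong : ∀ {a b f g} → a ≡ b → f ≈ g → (a ∷ f) ≈ (b ∷ g)
    ∷-cong e e′ = ext λ { zero → e ; (suc i) → at e′ i }

    0∷[] : 0ℤ ∷ [] ≈ []
    0∷[] = ext λ { zero → ≡.refl ; (suc i) → ≡.refl }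

    ⊕-cong : ∀ {f f′ g g′} → f ≈ f′ → g ≈ g′ → f ⊕ g ≈ f′ ⊕ g′
    ⊕-cong {f} {f′} {g} {g′} e e′ = ext λ i → ≡.trans (coeff-⊕ f g i)
      (≡.trans (cong₂ ℤ._+_ (at e i) (at e′ i)) (≡.sym (coeff-⊕ f′ g′ i)))

    ·-cong : ∀ a {f g} → f ≈ g → a · f ≈ a · g
    ·-cong a {f} {g} e = ext λ i → ≡.trans (coeff-· a f i)
      (≡.trans (cong (a ℤ.*_) (at e i)) (≡.sym (coeff-· a g i)))

    ⊝-cong : ∀ {f g} → f ≈ g → ⊝ f ≈ ⊝ g
    ⊝-cong {f} {g} e = ext λ i → ≡.trans (coeff-⊝ f i)
      (≡.trans (cong ℤ.-_ (at e i)) (≡.sym (coeff-⊝ g i)))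

    ⊕-assoc : ∀ f g h → (f ⊕ g) ⊕ h ≈ f ⊕ (g ⊕ h)
    ⊕-assoc f g h = ext λ i → begin
      coeff ((f ⊕ g) ⊕ h) i                      ≡⟨ coeff-⊕ (f ⊕ g) h i ⟩
      coeff (f ⊕ g) i ℤ.+ coeff h i              ≡⟨ cong (ℤ._+ coeff h i) (coeff-⊕ f g i) ⟩
      coeff f i ℤ.+ coeff g i ℤ.+ coeff h i      ≡⟨ ℤₚ.+-assoc (coeff f i) (coeff g i) (coeff h i) ⟩
      coeff f i ℤ.+ (coeff g i ℤ.+ coeff h i)    ≡⟨ cong (λ z → coeff f i ℤ.+ z) (coeff-⊕ g h i) ⟨
      coeff f i ℤ.+ coeff (g ⊕ h) i              ≡⟨ coeff-⊕ f (g ⊕ h) i ⟨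
      coeff (f ⊕ (g ⊕ h)) i                      ∎
      where open ≡-Reasoning

    ⊕-comm : ∀ f g → f ⊕ g ≈ g ⊕ f
    ⊕-comm f g = ext λ i → ≡.trans (coeff-⊕ f g i)
      (≡.trans (ℤₚ.+-comm (coeff f i) (coeff g i)) (≡.sym (coeff-⊕ g f i)))

    ⊕-identityʳ : ∀ f → f ⊕ [] ≈ f
    ⊕-identityʳ f = ≈-trans (⊕-comm f []) ≈-refl

    ⊝-inverseˡ : ∀ f → ⊝ f ⊕ f ≈ []
    ⊝-inverseˡ f = ext λ i → ≡.trans (coeff-⊕ (⊝ f) f i)
      (≡.trans (cong (ℤ._+ coeff f i) (coeff-⊝ f i)) (ℤₚ.+-inverseˡ (coeff f i)))

    ⊝-inverseʳ : ∀ f → f ⊕ ⊝ f ≈ []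
    ⊝-inverseʳ f = ≈-trans (⊕-comm f (⊝ f)) (⊝-inverseˡ f)

    ⊕-interchange : ∀ f g h k → (f ⊕ g) ⊕ (h ⊕ k) ≈ (f ⊕ h) ⊕ (g ⊕ k)
    ⊕-interchange f g h k = ext λ i → begin
      coeff ((f ⊕ g) ⊕ (h ⊕ k)) i  ≡⟨ expand f g h k i ⟩
      (coeff f i ℤ.+ coeff g i) ℤ.+ (coeff h i ℤ.+ coeff k i)
        ≡⟨ solve 4 (λ a b c d → (a :+ b) :+ (c :+ d) := (a :+ c) :+ (b :+ d)) ≡.refl
             (coeff f i) (coeff g i) (coeff h i) (coeff k i) ⟩
      (coeff f i ℤ.+ coeff h i) ℤ.+ (coeff g i ℤ.+ coeff k i)  ≡⟨ expand f h g k i ⟨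
      coeff ((f ⊕ h) ⊕ (g ⊕ k)) i  ∎
      where
      open ≡-Reasoning
      open ℤS
      expand : ∀ f g h k i → coeff ((f ⊕ g) ⊕ (h ⊕ k)) i ≡
        (coeff f i ℤ.+ coeff g i) ℤ.+ (coeff h i ℤ.+ coeff k i)
      expand f g h k i = ≡.trans (coeff-⊕ (f ⊕ g) (h ⊕ k) i) (cong₂ ℤ._+_ (coeff-⊕ f g i) (coeff-⊕ h k i))

    ·-distribˡ : ∀ a f g → a · (f ⊕ g) ≈ a · f ⊕ a · g
    ·-distribˡ a []      g       = ≈-refl
    ·-distribˡ a (b ∷ f) []      = ≈-refl
    ·-distribˡ a (b ∷ f) (c ∷ g) = ∷-cong (ℤₚ.*-distribˡ-+ a b c) (·-distribˡ a f g)

    ·-assoc : ∀ a b f → (a ℤ.* b) · f ≈ a · (b · f)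
    ·-assoc a b []      = ≈-refl
    ·-assoc a b (c ∷ f) = ∷-cong (ℤₚ.*-assoc a b c) (·-assoc a b f)

    ·-identity : ∀ f → 1ℤ · f ≈ f
    ·-identity []      = ≈-refl
    ·-identity (c ∷ f) = ∷-cong (ℤₚ.*-identityˡ c) (·-identity f)

    ·-zero : ∀ f → 0ℤ · f ≈ []
    ·-zero f = ext λ i → coeff-· 0ℤ f i

    ⊗-zeroʳ : ∀ f → f ⊗ [] ≈ []
    ⊗-zeroʳ []      = ≈-refl
    ⊗-zeroʳ (a ∷ f) = ≈-trans (∷-cong ≡.refl (⊗-zeroʳ f)) 0∷[]

    ⊗-∷ʳ : ∀ f b g → f ⊗ (b ∷ g) ≈ b · f ⊕ (0ℤ ∷ f ⊗ g)
    ⊗-∷ʳ []      b g = ≈-sym 0∷[]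
    ⊗-∷ʳ (a ∷ f) b g = ∷-cong (cong (ℤ._+ 0ℤ) (ℤₚ.*-comm a b))
      (≈-trans (⊕-cong (≈-refl {a · g}) (⊗-∷ʳ f b g))
      (≈-trans (≈-sym (⊕-assoc (a · g) (b · f) _))
      (≈-trans (⊕-cong (⊕-comm (a · g) (b · f)) ≈-refl)
      (⊕-assoc (b · f) (a · g) _))))

    ⊗-comm : ∀ f g → f ⊗ g ≈ g ⊗ f
    ⊗-comm []      g = ≈-sym (⊗-zeroʳ g)
    ⊗-comm (a ∷ f) g = ≈-trans (⊕-cong (≈-refl {a · g}) (∷-cong ≡.refl (⊗-comm f g))) (≈-sym (⊗-∷ʳ g a f))

    ⊗-congʳ : ∀ f {g h} → g ≈ h → f ⊗ g ≈ f ⊗ h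
    ⊗-congʳ []      e = ≈-refl
    ⊗-congʳ (a ∷ f) e = ⊕-cong (·-cong a e) (∷-cong ≡.refl (⊗-congʳ f e))

    ⊗-cong : ∀ {f f′ g g′} → f ≈ f′ → g ≈ g′ → f ⊗ g ≈ f′ ⊗ g′
    ⊗-cong {f} {f′} {g} {g′} e e′ = ≈-trans (⊗-congʳ f e′)
      (≈-trans (⊗-comm f g′) (≈-trans (⊗-congʳ g′ e) (⊗-comm g′ f′)))

    ⊗-distribˡ : ∀ f g h → f ⊗ (g ⊕ h) ≈ f ⊗ g ⊕ f ⊗ h
    ⊗-distribˡ []      g h = ≈-refl
    ⊗-distribˡ (a ∷ f) g h = ≈-trans (⊕-cong (·-distribˡ a g h) (∷-cong ≡.refl (⊗-distribˡ f g h)))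
      (⊕-interchange (a · g) (a · h) (0ℤ ∷ f ⊗ g) (0ℤ ∷ f ⊗ h))

    ⊗-distribʳ : ∀ f g h → (g ⊕ h) ⊗ f ≈ g ⊗ f ⊕ h ⊗ f
    ⊗-distribʳ f g h = ≈-trans (⊗-comm (g ⊕ h) f)
      (≈-trans (⊗-distribˡ f g h) (⊕-cong (⊗-comm f g) (⊗-comm f h)))

    ·-⊗ : ∀ a f g → (a · f) ⊗ g ≈ a · (f ⊗ g)
    ·-⊗ a []      g = ≈-refl
    ·-⊗ a (b ∷ f) g = ≈-trans
      (⊕-cong (·-assoc a b g) (∷-cong (≡.sym (ℤₚ.*-zeroʳ a)) (·-⊗ a f g)))
      (≈-sym (·-distribˡ a (b · g) (0ℤ ∷ f ⊗ g)))

    shift-⊗ : ∀ f g → (0ℤ ∷ f) ⊗ g ≈ 0ℤ ∷ f ⊗ g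
    shift-⊗ f g = ⊕-cong (·-zero g) ≈-refl

    ⊗-assoc : ∀ f g h → (f ⊗ g) ⊗ h ≈ f ⊗ (g ⊗ h)
    ⊗-assoc []      g h = ≈-refl
    ⊗-assoc (a ∷ f) g h = ≈-trans (⊗-distribʳ h (a · g) (0ℤ ∷ f ⊗ g))
      (⊕-cong (·-⊗ a g h) (≈-trans (shift-⊗ (f ⊗ g) h) (∷-cong ≡.refl (⊗-assoc f g h))))

    const-⊗ : ∀ a f → const a ⊗ f ≈ a · f
    const-⊗ a f = ≈-trans (⊕-cong (≈-refl {a · f}) 0∷[]) (⊕-identityʳ (a · f))

    ⊗-identityˡ : ∀ f → const 1ℤ ⊗ f ≈ f
    ⊗-identityˡ f = ≈-trans (const-⊗ 1ℤ f) (·-identity f)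

    const-* : ∀ a b → const (a ℤ.* b) ≈ const a ⊗ const b
    const-* a b = ∷-cong (≡.sym (ℤₚ.+-identityʳ _)) ≈-refl

    const-+ : ∀ a b → const (a ℤ.+ b) ≈ const a ⊕ const b
    const-+ a b = ≈-refl

    const-neg : ∀ a → const (ℤ.- a) ≈ ⊝ const a
    const-neg a = ≈-refl

    ∷-⊕-∷ : ∀ a b f g → (a ∷ f) ⊕ (b ∷ g) ≈ (a ℤ.+ b) ∷ (f ⊕ g)
    ∷-⊕-∷ a b f g = ≈-refl

    ∷-⊗ : ∀ a f g → (a ∷ f) ⊗ g ≈ a · g ⊕ (0ℤ ∷ f ⊗ g)
    ∷-⊗ a f g = ≈-refl

    []⊗ : ∀ g → [] ⊗ g ≈ []
    []⊗ g = ≈-refl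

    ⊕-identityˡ : ∀ f → [] ⊕ f ≈ f
    ⊕-identityˡ f = ≈-refl

  ℤ[X]-isCommutativeRing : IsCommutativeRing _≈_ _⊕_ _⊗_ ⊝_ [] (const 1ℤ)
  ℤ[X]-isCommutativeRing = record
    { isRing = record
      { +-isAbelianGroup = record
        { isGroup = record
          { isMonoid = record
            { isSemigroup = record
              { isMagma = record
                { isEquivalence = record { refl = ≈-refl ; sym = ≈-sym ; trans = ≈-trans }
                ; ∙-cong = ⊕-cong }
              ; assoc = ⊕-assoc }
            ; identity = ⊕-identityˡ , ⊕-identityʳ }
          ; inverse = ⊝-inverseˡ , ⊝-inverseʳ
          ; ⁻¹-cong = ⊝-cong }
        ; comm = ⊕-comm }
      ; *-cong = ⊗-cong
      ; *-assoc = ⊗-assoc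
      ; *-identity = ⊗-identityˡ , λ f → ≈-trans (⊗-comm f (const 1ℤ)) (⊗-identityˡ f)
      ; distrib = ⊗-distribˡ , ⊗-distribʳ }
    ; *-comm = ⊗-comm }

  ℤ[X]-ring : CommutativeRing _ _
  ℤ[X]-ring = record { isCommutativeRing = ℤ[X]-isCommutativeRing }

  const-≟ : ∀ a b → Maybe (const a ≈ const b)
  const-≟ a b with a ℤ.≟ b
  ... | yes ≡.refl = just ≈-refl
  ... | no _       = nothing

  const-morphism : ℤ.+-*-rawRing -Raw-AlmostCommutative⟶ fromCommutativeRing ℤ[X]-ring
  const-morphism = record
    { ⟦_⟧ = const
    ; +-homo = const-+
    ; *-homo = const-*
    ; -‿homo = const-neg
    ; 0-homo = 0∷[]
    ; 1-homo = ≈-refl }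

  -- With integers as coefficients the solver evaluates numerals; symbolic constants such as
  -- `const c` enter as variables.
  module ZXSolver = Algebra.Solver.Ring ℤ.+-*-rawRing (fromCommutativeRing ℤ[X]-ring) const-morphism const-≟

  open import Algebra.Properties.Semiring.Exp (CommutativeRing.semiring ℤ[X]-ring) using (_^_; ^-congˡ; ^-congʳ; ^-homo-*; ^-assocʳ)
  open import Algebra.Properties.CommutativeSemiring.Exp (CommutativeRing.commutativeSemiring ℤ[X]-ring) using (^-distrib-*)
  open import Algebra.Properties.Semiring.Exp (CommutativeRing.semiring ℤₚ.+-*-commutativeRing) using () renaming (_^_ to _^ℤ_)

  module ≈-Reasoning = SetoidReasoning (CommutativeRing.setoid ℤ[X]-ring)

  -- Degrees, monic polynomials and division with remainder

  DegLt : ℕ → ℤ[X] → Set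
  DegLt n f = ∀ i → n ℕ.≤ i → coeff f i ≡ 0ℤ

  -- Degrees are expressed by vanishing coefficients, so no leading coefficient ever has to be
  -- tested for zero.
  Monic : ℕ → ℤ[X] → Set
  Monic n f = coeff f n ≡ 1ℤ × DegLt (suc n) f

  shift≈X⊗ : ∀ f → 0ℤ ∷ f ≈ X ⊗ f
  shift≈X⊗ f = ≈-sym (≈-trans (shift-⊗ (const 1ℤ) f) (∷-cong ≡.refl (⊗-identityˡ f)))

  ∷≈const⊕X⊗ : ∀ a f → a ∷ f ≈ const a ⊕ X ⊗ f
  ∷≈const⊕X⊗ a f = ≈-trans (∷-cong (≡.sym (ℤₚ.+-identityʳ a)) (≈-sym (⊕-identityˡ f)))
    (≈-trans (≈-sym (∷-⊕-∷ a 0ℤ [] f)) (⊕-cong (≈-refl {const a}) (shift≈X⊗ f)))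

  DegLt-0 : ∀ f → DegLt 0 f → f ≈ []
  DegLt-0 f d = ext λ i → d i z≤n

  DegLt-weaken : ∀ {m n f} → m ℕ.≤ n → DegLt m f → DegLt n f
  DegLt-weaken m≤n d i n≤i = d i (ℕₚ.≤-trans m≤n n≤i)

  DegLt-cong : ∀ {n f g} → f ≈ g → DegLt n f → DegLt n g
  DegLt-cong e d i n≤i = ≡.trans (≡.sym (at e i)) (d i n≤i)

  DegLt-tail : ∀ {n a f} → DegLt (suc n) (a ∷ f) → DegLt n f
  DegLt-tail d i n≤i = d (suc i) (s≤s n≤i)

  DegLt-⊕ : ∀ {n} f g → DegLt n f → DegLt n g → DegLt n (f ⊕ g)
  DegLt-⊕ f g d d′ i n≤i = ≡.trans (coeff-⊕ f g i) (cong₂ ℤ._+_ (d i n≤i) (d′ i n≤i))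

  DegLt-⊝ : ∀ {n} f → DegLt n f → DegLt n (⊝ f)
  DegLt-⊝ f d i n≤i = ≡.trans (coeff-⊝ f i) (cong ℤ.-_ (d i n≤i))

  DegLt-length : ∀ f → DegLt (length f) f
  DegLt-length []      i       _         = ≡.refl
  DegLt-length (a ∷ f) (suc i) (s≤s n≤i) = DegLt-length f i n≤i

  DegLt-const : ∀ a → DegLt 1 (const a)
  DegLt-const a (suc i) _ = ≡.refl

  -- Degree at most a times degree below b: the asymmetric form avoids a predecessor in the bound.
  DegLt-⊗ : ∀ {a b} f g → DegLt (suc a) f → DegLt b g → DegLt (a ℕ.+ b) (f ⊗ g)
  DegLt-⊗ []      g df dg i i≥ = at ([]⊗ g) i
  DegLt-⊗ {a} {b} (u ∷ f) g df dg i i≥ = ≡.trans (≡.trans (at (∷-⊗ u f g) i) (coeff-⊕ (u · g) (0ℤ ∷ f ⊗ g) i))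
    (cong₂ ℤ._+_ head≡0 (tail≡0 a (DegLt-tail df) i i≥))
    where
    head≡0 : coeff (u · g) i ≡ 0ℤ
    head≡0 = ≡.trans (coeff-· u g i)
      (≡.trans (cong (u ℤ.*_) (dg i (ℕₚ.≤-trans (ℕₚ.m≤n+m b a) i≥))) (ℤₚ.*-zeroʳ u))
    tail≡0 : ∀ a → DegLt a f → ∀ i → a ℕ.+ b ℕ.≤ i → coeff (0ℤ ∷ f ⊗ g) i ≡ 0ℤ
    tail≡0 _       d zero    _         = ≡.refl
    tail≡0 zero    d (suc i) _         = at (≈-trans (⊗-cong (DegLt-0 f d) (≈-refl {g})) ([]⊗ g)) i
    tail≡0 (suc a) d (suc i) (s≤s i≥) = DegLt-⊗ f g d dg i i≥

  coeff-⊗-top : ∀ {a b} f g → DegLt (suc a) f → DegLt (suc b) g →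
    coeff (f ⊗ g) (a ℕ.+ b) ≡ coeff f a ℤ.* coeff g b
  coeff-⊗-top {a} {b} [] g df dg = at ([]⊗ g) (a ℕ.+ b)
  coeff-⊗-top {zero} {b} (u ∷ f) g df dg = ≡.trans (≡.trans (at (∷-⊗ u f g) b) (coeff-⊕ (u · g) (0ℤ ∷ f ⊗ g) b))
    (≡.trans (cong₂ ℤ._+_ (coeff-· u g b) (tail≡0 b)) (ℤₚ.+-identityʳ _))
    where
    tail≡0 : ∀ i → coeff (0ℤ ∷ f ⊗ g) i ≡ 0ℤ
    tail≡0 zero    = ≡.refl
    tail≡0 (suc i) = at (≈-trans (⊗-cong (DegLt-0 f (DegLt-tail {a = u} {f} df)) (≈-refl {g})) ([]⊗ g)) i
  coeff-⊗-top {suc a} {b} (u ∷ f) g df dg = ≡.trans (≡.trans (at (∷-⊗ u f g) (suc a ℕ.+ b)) (coeff-⊕ (u · g) (0ℤ ∷ f ⊗ g) (suc a ℕ.+ b)))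
    (≡.trans (cong₂ ℤ._+_ head≡0 (coeff-⊗-top f g (DegLt-tail df) dg)) (ℤₚ.+-identityˡ _))
    where
    head≡0 : coeff (u · g) (suc a ℕ.+ b) ≡ 0ℤ
    head≡0 = ≡.trans (coeff-· u g _)
      (≡.trans (cong (u ℤ.*_) (dg _ (s≤s (ℕₚ.m≤n+m b a)))) (ℤₚ.*-zeroʳ u))

  Monic-1 : Monic 0 (const 1ℤ)
  Monic-1 = ≡.refl , DegLt-const 1ℤ

  Monic-⊗ : ∀ {a b} f g → Monic a f → Monic b g → Monic (a ℕ.+ b) (f ⊗ g)
  Monic-⊗ {a} {b} f g (tf , df) (tg , dg) =
    ≡.trans (coeff-⊗-top f g df dg) (cong₂ ℤ._*_ tf tg) ,
    subst (λ n → DegLt n (f ⊗ g)) (ℕₚ.+-suc a b) (DegLt-⊗ f g df dg)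

  Monic-⊕ : ∀ {n} f g → Monic n f → DegLt n g → Monic n (f ⊕ g)
  Monic-⊕ {n} f g (tf , df) dg =
    ≡.trans (coeff-⊕ f g n) (cong₂ ℤ._+_ tf (dg n ℕₚ.≤-refl)) ,
    DegLt-⊕ f g df (DegLt-weaken {f = g} (ℕₚ.n≤1+n n) dg)

  Monic-^ : ∀ {m} f → Monic m f → ∀ n → Monic (n ℕ.* m) (f ^ n)
  Monic-^ f mf zero    = Monic-1
  Monic-^ f mf (suc n) = Monic-⊗ f (f ^ n) mf (Monic-^ f mf n)

  DegLt-^ : ∀ {m} f → DegLt m f → ∀ n → DegLt (suc n ℕ.* m) (f ^ suc n)
  DegLt-^ {m} f df zero = DegLt-cong (≈-sym (CommutativeRing.*-identityʳ ℤ[X]-ring f))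
    (subst (λ k → DegLt k f) (≡.sym (ℕₚ.+-identityʳ m)) df)
  DegLt-^ f df (suc n) = DegLt-⊗ f (f ^ suc n) (DegLt-weaken {f = f} (ℕₚ.n≤1+n _) df) (DegLt-^ f df n)

  opaque
    -- From f = s q + r one gets a + x f = s (x q) + (a + x r). The new remainder has degree at most
    -- m, and subtracting its coefficient of xᵐ times s brings it below m.
    monic-divMod-step : ∀ {m} s → Monic m s → ∀ a f q r → f ≈ s ⊗ q ⊕ r → DegLt m r →
      let r′ = (a ∷ r) ⊕ ⊝ (coeff (a ∷ r) m · s) in a ∷ f ≈ s ⊗ (coeff (a ∷ r) m ∷ q) ⊕ r′ × DegLt m r′
    monic-divMod-step {m} s (top , deg) a f q r e dr = e′ , dr′
      where
      t : ℤ
      t = coeff (a ∷ r) m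
      r′ : ℤ[X]
      r′ = (a ∷ r) ⊕ ⊝ (t · s)
      e′ : a ∷ f ≈ s ⊗ (t ∷ q) ⊕ r′
      e′ = begin
        a ∷ f                                            ≈⟨ ∷-cong (≡.sym (ℤₚ.+-identityˡ a)) e ⟩
        (0ℤ ℤ.+ a) ∷ s ⊗ q ⊕ r                           ≈⟨ ∷-⊕-∷ 0ℤ a (s ⊗ q) r ⟨
        (0ℤ ∷ s ⊗ q) ⊕ (a ∷ r) ≈⟨ solve 3 (λ u v w → v :+ w := (u :+ v) :+ (w :- u)) ≈-refl (t · s) (0ℤ ∷ s ⊗ q) (a ∷ r) ⟩
        (t · s ⊕ (0ℤ ∷ s ⊗ q)) ⊕ ((a ∷ r) ⊕ ⊝ (t · s))   ≈⟨ ⊕-cong (≈-sym (⊗-∷ʳ s t q)) (≈-refl {r′}) ⟩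
        s ⊗ (t ∷ q) ⊕ r′                                 ∎
        where
        open ≈-Reasoning
        open ZXSolver
      coeff-r′ : ∀ i → coeff r′ i ≡ coeff (a ∷ r) i ℤ.- t ℤ.* coeff s i
      coeff-r′ i = ≡.trans (coeff-⊕ (a ∷ r) (⊝ (t · s)) i)
        (cong (λ z → coeff (a ∷ r) i ℤ.+ z) (≡.trans (coeff-⊝ (t · s) i) (cong ℤ.-_ (coeff-· t s i))))
      dr-∷ : ∀ i → suc m ℕ.≤ i → coeff (a ∷ r) i ≡ 0ℤ
      dr-∷ (suc i) (s≤s m≤i) = dr i m≤i
      dr′ : DegLt m r′
      dr′ i m≤i with ℕₚ.m≤n⇒m<n∨m≡n m≤i
      ... | inj₂ ≡.refl = ≡.trans (coeff-r′ m) (≡.trans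
              (cong (λ z → t ℤ.- z) (≡.trans (cong (t ℤ.*_) top) (ℤₚ.*-identityʳ t))) (ℤₚ.+-inverseʳ t))
      ... | inj₁ m<i = ≡.trans (coeff-r′ i)
              (≡.trans (cong₂ (λ y z → y ℤ.- t ℤ.* z) (dr-∷ i m<i) (deg i m<i))
                       (cong (λ z → 0ℤ ℤ.- z) (ℤₚ.*-zeroʳ t)))

  monic-divMod : ∀ {m} s → Monic m s → ∀ f → ∃₂ λ q r → f ≈ s ⊗ q ⊕ r × DegLt m r
  monic-divMod s ms [] = [] , [] , ≈-sym (≈-trans (⊕-identityʳ (s ⊗ [])) (⊗-zeroʳ s)) , λ _ _ → ≡.refl
  monic-divMod s ms (a ∷ f) = let (q , r , e , dr) = monic-divMod s ms f in
    _ , _ , monic-divMod-step s ms a f q r e dr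

  opaque
    ∣-coeffs⇒const⊗ : ∀ n f → (∀ i → n ∣ coeff f i) → ∃ λ a → f ≈ const n ⊗ a
    ∣-coeffs⇒const⊗ n [] d = [] , ≈-sym (⊗-zeroʳ (const n))
    ∣-coeffs⇒const⊗ n (b ∷ f) d with d 0 | ∣-coeffs⇒const⊗ n f (λ i → d (suc i))
    ... | divides q eq | a , e = q ∷ a , ≈-trans (∷-cong (≡.trans eq (ℤₚ.*-comm q n)) (≈-trans e (const-⊗ n a)))
                                                 (≈-sym (const-⊗ n (q ∷ a)))

  opaque
    const⊗⇒∣-coeffs : ∀ n f a → f ≈ const n ⊗ a → ∀ i → n ∣ coeff f i
    const⊗⇒∣-coeffs n f a e i = divides (coeff a i)
      (≡.trans (at e i) (≡.trans (at (const-⊗ n a) i) (≡.trans (coeff-· n a i) (ℤₚ.*-comm n _))))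

  ∣-coeffs-⊗ : ∀ n s k → (∀ i → n ∣ coeff k i) → ∀ i → n ∣ coeff (s ⊗ k) i
  ∣-coeffs-⊗ n s k d with ∣-coeffs⇒const⊗ n k d
  ... | a , e = const⊗⇒∣-coeffs n (s ⊗ k) (s ⊗ a) (≈-trans (⊗-congʳ s e)
    (solve 3 (λ s n a → s :* (n :* a) := n :* (s :* a)) ≈-refl s (const n) a))
    where open ZXSolver

  opaque
    -- The coefficients of s k from degree m on already determine k modulo n. For a + x k, the
    -- product a s does not reach beyond degree m, so the higher coefficients are those of s k and
    -- induction applies to k; then the coefficient at m, where s has a 1, isolates a.
    ∣-coeffs-monic⊗ : ∀ {m} n s k → Monic m s → (∀ j → m ℕ.≤ j → n ∣ coeff (s ⊗ k) j) → ∀ i → n ∣ coeff k i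
    ∣-coeffs-monic⊗ n s [] ms d i = divides 0ℤ ≡.refl
    ∣-coeffs-monic⊗ {m} n s (a ∷ k) ms@(top , deg) d = λ { zero → n∣a ; (suc i) → n∣k i }
      where
      split : ∀ j → coeff (s ⊗ (a ∷ k)) j ≡ a ℤ.* coeff s j ℤ.+ coeff (0ℤ ∷ s ⊗ k) j
      split j = ≡.trans (at (⊗-∷ʳ s a k) j)
        (≡.trans (coeff-⊕ (a · s) _ j) (cong (ℤ._+ _) (coeff-· a s j)))
      n∣k : ∀ i → n ∣ coeff k i
      n∣k = ∣-coeffs-monic⊗ n s k ms λ j m≤j → subst (n ∣_)
        (≡.trans (split (suc j)) (≡.trans
          (cong (ℤ._+ _) (≡.trans (cong (a ℤ.*_) (deg (suc j) (s≤s m≤j))) (ℤₚ.*-zeroʳ a)))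
          (ℤₚ.+-identityˡ _)))
        (d (suc j) (ℕₚ.m≤n⇒m≤1+n m≤j))
      n∣0∷sk : ∀ j → n ∣ coeff (0ℤ ∷ s ⊗ k) j
      n∣0∷sk zero    = divides 0ℤ ≡.refl
      n∣0∷sk (suc j) = ∣-coeffs-⊗ n s k n∣k j
      n∣a : n ∣ a
      n∣a = ∣m+n∣m⇒∣n (subst (n ∣_) (≡.trans (split m)
        (≡.trans (cong (λ z → a ℤ.* z ℤ.+ coeff (0ℤ ∷ s ⊗ k) m) top)
        (≡.trans (cong (ℤ._+ _) (ℤₚ.*-identityʳ a)) (ℤₚ.+-comm a _)))) (d m ℕₚ.≤-refl)) (n∣0∷sk m)

  opaque
    -- Multiplication by a monic polynomial is injective modulo every integer. This stands in for
    -- arguments over a field.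
    monic-cancel : ∀ {m} n s k a → Monic m s → s ⊗ k ≈ const n ⊗ a → ∃ λ b → k ≈ const n ⊗ b
    monic-cancel n s k a ms e = ∣-coeffs⇒const⊗ n k
      (∣-coeffs-monic⊗ n s k ms λ j _ → const⊗⇒∣-coeffs n (s ⊗ k) a e j)

  -- The formal derivative

  ∂ : ℤ[X] → ℤ[X]
  ∂ []      = []
  ∂ (a ∷ f) = f ⊕ (0ℤ ∷ ∂ f)

  coeff-∂ : ∀ f i → coeff (∂ f) i ≡ + suc i ℤ.* coeff f (suc i)
  coeff-∂ []      i = ≡.sym (ℤₚ.*-zeroʳ (+ suc i))
  coeff-∂ (a ∷ f) zero = ≡.trans (coeff-⊕ f (0ℤ ∷ ∂ f) 0)
    (≡.trans (ℤₚ.+-identityʳ _) (≡.sym (ℤₚ.*-identityˡ _)))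
  coeff-∂ (a ∷ f) (suc i) = ≡.trans (coeff-⊕ f (0ℤ ∷ ∂ f) (suc i))
    (≡.trans (cong (λ z → coeff f (suc i) ℤ.+ z) (coeff-∂ f i))
    (≡.sym (ℤₚ.suc-* (+ suc i) (coeff f (suc i)))))

  ∂-cong : ∀ {f g} → f ≈ g → ∂ f ≈ ∂ g
  ∂-cong {f} {g} e = ext λ i → ≡.trans (coeff-∂ f i)
    (≡.trans (cong (+ suc i ℤ.*_) (at e (suc i))) (≡.sym (coeff-∂ g i)))

  ∂-⊕ : ∀ f g → ∂ (f ⊕ g) ≈ ∂ f ⊕ ∂ g
  ∂-⊕ f g = ext λ i → begin
    coeff (∂ (f ⊕ g)) i                                            ≡⟨ coeff-∂ (f ⊕ g) i ⟩
    + suc i ℤ.* coeff (f ⊕ g) (suc i)                              ≡⟨ cong (+ suc i ℤ.*_) (coeff-⊕ f g (suc i)) ⟩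
    + suc i ℤ.* (coeff f (suc i) ℤ.+ coeff g (suc i)) ≡⟨ ℤₚ.*-distribˡ-+ (+ suc i) (coeff f (suc i)) (coeff g (suc i)) ⟩
    + suc i ℤ.* coeff f (suc i) ℤ.+ + suc i ℤ.* coeff g (suc i)    ≡⟨ cong₂ ℤ._+_ (coeff-∂ f i) (coeff-∂ g i) ⟨
    coeff (∂ f) i ℤ.+ coeff (∂ g) i                                ≡⟨ coeff-⊕ (∂ f) (∂ g) i ⟨
    coeff (∂ f ⊕ ∂ g) i                                            ∎
    where open ≡-Reasoning

  ∂-· : ∀ a f → ∂ (a · f) ≈ a · ∂ f
  ∂-· a []      = ≈-refl
  ∂-· a (b ∷ f) = ≈-trans
    (⊕-cong (≈-refl {a · f}) (∷-cong (≡.sym (ℤₚ.*-zeroʳ a)) (∂-· a f)))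
    (≈-sym (·-distribˡ a f (0ℤ ∷ ∂ f)))

  ∂-⊗ : ∀ f g → ∂ (f ⊗ g) ≈ ∂ f ⊗ g ⊕ f ⊗ ∂ g
  ∂-⊗ []      g = ≈-trans (∂-cong ([]⊗ g)) (≈-trans (≈-sym (≈-trans (⊕-cong ([]⊗ g) ([]⊗ (∂ g))) (⊕-identityˡ []))) ≈-refl)
  ∂-⊗ (a ∷ f) g = begin
    ∂ ((a ∷ f) ⊗ g)                                   ≈⟨ ∂-cong (∷-⊗ a f g) ⟩
    ∂ (a · g ⊕ (0ℤ ∷ f ⊗ g))                          ≈⟨ ∂-⊕ (a · g) (0ℤ ∷ f ⊗ g) ⟩
    ∂ (a · g) ⊕ (f ⊗ g ⊕ (0ℤ ∷ ∂ (f ⊗ g))) ≈⟨ ⊕-cong (≈-trans (∂-· a g) (≈-sym (const-⊗ a (∂ g)))) (⊕-cong ≈-refl (≈-trans (shift≈X⊗ _) (⊗-congʳ X (∂-⊗ f g)))) ⟩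
    const a ⊗ ∂ g ⊕ (f ⊗ g ⊕ X ⊗ (∂ f ⊗ g ⊕ f ⊗ ∂ g)) ≈⟨ solve 6 (λ a x f g f′ g′ → a :* g′ :+ (f :* g :+ x :* (f′ :* g :+ f :* g′)) := (f :+ x :* f′) :* g :+ (a :+ x :* f) :* g′) ≈-refl (const a) X f g (∂ f) (∂ g) ⟩
    (f ⊕ X ⊗ ∂ f) ⊗ g ⊕ (const a ⊕ X ⊗ f) ⊗ ∂ g ≈⟨ ⊕-cong (⊗-cong (⊕-cong (≈-refl {f}) (≈-sym (shift≈X⊗ (∂ f)))) (≈-refl {g})) (⊗-cong (≈-sym (∷≈const⊕X⊗ a f)) (≈-refl {∂ g})) ⟩
    ∂ (a ∷ f) ⊗ g ⊕ (a ∷ f) ⊗ ∂ g                     ∎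
    where
    open ≈-Reasoning
    open ZXSolver

  ∂-const⊗ : ∀ a f → ∂ (const a ⊗ f) ≈ const a ⊗ ∂ f
  ∂-const⊗ a f = ≈-trans (∂-cong (const-⊗ a f)) (≈-trans (∂-· a f) (≈-sym (const-⊗ a (∂ f))))

  ∂-^ : ∀ f n → ∂ (f ^ suc n) ≈ const (+ suc n) ⊗ (f ^ n ⊗ ∂ f)
  ∂-^ f zero = ≈-trans (∂-cong (⊗-comm f (const 1ℤ))) (≈-trans (∂-const⊗ 1ℤ f)
    (solve 1 (λ a → con 1ℤ :* a := con 1ℤ :* (con 1ℤ :* a)) ≈-refl (∂ f)))
    where open ZXSolver
  ∂-^ f (suc n) = begin
    ∂ (f ⊗ f ^ suc n)                                               ≈⟨ ∂-⊗ f (f ^ suc n) ⟩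
    ∂ f ⊗ f ^ suc n ⊕ f ⊗ ∂ (f ^ suc n)                             ≈⟨ ⊕-cong ≈-refl (⊗-congʳ f (∂-^ f n)) ⟩
    ∂ f ⊗ (f ⊗ f ^ n) ⊕ f ⊗ (const (+ suc n) ⊗ (f ^ n ⊗ ∂ f)) ≈⟨ solve 4 (λ f′ f fn c → f′ :* (f :* fn) :+ f :* (c :* (fn :* f′)) := (con 1ℤ :+ c) :* (f :* fn :* f′)) ≈-refl (∂ f) f (f ^ n) (const (+ suc n)) ⟩
    (const 1ℤ ⊕ const (+ suc n)) ⊗ (f ^ suc n ⊗ ∂ f)                ≈⟨ ⊗-cong (≈-sym (const-+ 1ℤ (+ suc n))) ≈-refl ⟩
    const (+ suc (suc n)) ⊗ (f ^ suc n ⊗ ∂ f)                       ∎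
    where
    open ≈-Reasoning
    open ZXSolver

  -- Evaluation of integer polynomials in a commutative ring

  module Evaluation {ℓ₁ ℓ₂} (R : CommutativeRing ℓ₁ ℓ₂)
    (ι : ℤ.+-*-rawRing -Raw-AlmostCommutative⟶ fromCommutativeRing R)
    (α : CommutativeRing.Carrier R) where

    open CommutativeRing R renaming (_≈_ to _≋_)
    open _-Raw-AlmostCommutative⟶_ ι
    open import Algebra.Properties.Semiring.Exp semiring using () renaming (_^_ to _^ᴿ_)
    open import Algebra.Properties.CommutativeSemigroup +-commutativeSemigroup using () renaming (interchange to +-interchange)
    open import Algebra.Properties.CommutativeSemigroup *-commutativeSemigroup using () renaming (x∙yz≈y∙xz to *-swap)
    open import Relation.Binary.Reasoning.Setoid setoid

    ev : ℤ[X] → Carrier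
    ev []      = 0#
    ev (a ∷ f) = ⟦ a ⟧ + α * ev f

    ev-0∷ : ∀ f → ev (0ℤ ∷ f) ≋ α * ev f
    ev-0∷ f = trans (+-congʳ 0-homo) (+-identityˡ _)

    private
      ev-≈[] : ∀ f → f ≈ [] → ev f ≋ 0#
      ev-≈[] []      e = refl
      ev-≈[] (a ∷ f) e with at e 0
      ... | ≡.refl = trans (ev-0∷ f) (trans (*-congˡ (ev-≈[] f (ext λ i → at e (suc i)))) (zeroʳ α))

    ev-cong : ∀ {f g} → f ≈ g → ev f ≋ ev g
    ev-cong {[]}    {g}     e = sym (ev-≈[] g (≈-sym e))
    ev-cong {a ∷ f} {[]}    e = ev-≈[] (a ∷ f) e
    ev-cong {a ∷ f} {b ∷ g} e with at e 0
    ... | ≡.refl = +-congˡ (*-congˡ (ev-cong {f} {g} (ext λ i → at e (suc i))))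

    opaque
      unfolding _⊗_

      ev-⊕ : ∀ f g → ev (f ⊕ g) ≋ ev f + ev g
      ev-⊕ []      g       = sym (+-identityˡ _)
      ev-⊕ (a ∷ f) []      = sym (+-identityʳ _)
      ev-⊕ (a ∷ f) (b ∷ g) = begin
        ⟦ a ℤ.+ b ⟧ + α * ev (f ⊕ g)              ≈⟨ +-cong (+-homo a b) (trans (*-congˡ (ev-⊕ f g)) (distribˡ α _ _)) ⟩
        (⟦ a ⟧ + ⟦ b ⟧) + (α * ev f + α * ev g)   ≈⟨ +-interchange _ _ _ _ ⟩
        (⟦ a ⟧ + α * ev f) + (⟦ b ⟧ + α * ev g)   ∎

      ev-· : ∀ a f → ev (a · f) ≋ ⟦ a ⟧ * ev f
      ev-· a []      = sym (zeroʳ _)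
      ev-· a (b ∷ f) = begin
        ⟦ a ℤ.* b ⟧ + α * ev (a · f)            ≈⟨ +-cong (*-homo a b) (trans (*-congˡ (ev-· a f)) (*-swap _ _ _)) ⟩
        ⟦ a ⟧ * ⟦ b ⟧ + ⟦ a ⟧ * (α * ev f)      ≈⟨ distribˡ _ _ _ ⟨
        ⟦ a ⟧ * (⟦ b ⟧ + α * ev f)              ∎

      ev-⊗ : ∀ f g → ev (f ⊗ g) ≋ ev f * ev g
      ev-⊗ []      g = sym (zeroˡ _)
      ev-⊗ (a ∷ f) g = begin
        ev (a · g ⊕ (0ℤ ∷ f ⊗ g))               ≈⟨ ev-⊕ (a · g) (0ℤ ∷ f ⊗ g) ⟩
        ev (a · g) + ev (0ℤ ∷ f ⊗ g)            ≈⟨ +-cong (ev-· a g) (trans (ev-0∷ (f ⊗ g)) (*-congˡ (ev-⊗ f g))) ⟩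
        ⟦ a ⟧ * ev g + α * (ev f * ev g)        ≈⟨ +-congˡ (*-assoc _ _ _) ⟨
        ⟦ a ⟧ * ev g + (α * ev f) * ev g        ≈⟨ distribʳ _ _ _ ⟨
        (⟦ a ⟧ + α * ev f) * ev g               ∎

      ev-⊝ : ∀ f → ev (⊝ f) ≋ - ev f
      ev-⊝ f = inverseˡ-unique _ _ (trans (sym (ev-⊕ (⊝ f) f)) (ev-cong {⊝ f ⊕ f} {[]} (⊝-inverseˡ f)))
        where open import Algebra.Properties.AbelianGroup +-abelianGroup using (inverseˡ-unique)

    ev-const : ∀ a → ev (const a) ≋ ⟦ a ⟧
    ev-const a = trans (+-congˡ (zeroʳ α)) (+-identityʳ _)

    ev-1 : ev (const 1ℤ) ≋ 1#
    ev-1 = trans (ev-const 1ℤ) 1-homo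

    ev-X : ev X ≋ α
    ev-X = trans (ev-0∷ (const 1ℤ)) (trans (*-congˡ ev-1) (*-identityʳ α))

    ev-^ : ∀ f n → ev (f ^ n) ≋ ev f ^ᴿ n
    ev-^ f zero    = ev-1
    ev-^ f (suc n) = trans (ev-⊗ f (f ^ n)) (*-congˡ (ev-^ f n))

  -- Evaluation at an integer

  ℤ-morphism : ℤ.+-*-rawRing -Raw-AlmostCommutative⟶ fromCommutativeRing ℤₚ.+-*-commutativeRing
  ℤ-morphism = -raw-almostCommutative⟶ (fromCommutativeRing ℤₚ.+-*-commutativeRing)

  module Evalℤ = Evaluation ℤₚ.+-*-commutativeRing ℤ-morphism

  infix 9 _⟪_⟫
  _⟪_⟫ : ℤ[X] → ℤ → ℤ
  f ⟪ r ⟫ = Evalℤ.ev r f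

  X-_ : ℤ → ℤ[X]
  X- r = X ⊕ ⊝ const r

  X-⟪⟫ : ∀ r → (X- r) ⟪ r ⟫ ≡ 0ℤ
  X-⟪⟫ r = begin
    (X ⊕ ⊝ const r) ⟪ r ⟫            ≡⟨ ev-⊕ X (⊝ const r) ⟩
    X ⟪ r ⟫ ℤ.+ (⊝ const r) ⟪ r ⟫    ≡⟨ cong₂ ℤ._+_ ev-X (≡.trans (ev-⊝ (const r)) (cong ℤ.-_ (ev-const r))) ⟩
    r ℤ.- r                          ≡⟨ ℤₚ.+-inverseʳ r ⟩
    0ℤ                               ∎
    where
    open ≡-Reasoning
    open Evalℤ r

  opaque
    -- Synthetic division: one Horner step yields the value at r and the quotient by x - r together.
    factor-step : ∀ r a f c q → f ≈ const c ⊕ (X- r) ⊗ q →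
      a ∷ f ≈ const (a ℤ.+ r ℤ.* c) ⊕ (X- r) ⊗ (const c ⊕ X ⊗ q)
    factor-step r a f c q e = begin
      a ∷ f                                                          ≈⟨ ∷≈const⊕X⊗ a f ⟩
      const a ⊕ X ⊗ f                                                ≈⟨ ⊕-cong (≈-refl {const a}) (⊗-congʳ X e) ⟩
      const a ⊕ X ⊗ (const c ⊕ (X- r) ⊗ q) ≈⟨ solve 5 (λ a x c r q → a :+ x :* (c :+ (x :- r) :* q) := (a :+ r :* c) :+ (x :- r) :* (c :+ x :* q)) ≈-refl (const a) X (const c) (const r) q ⟩
      (const a ⊕ const r ⊗ const c) ⊕ (X- r) ⊗ (const c ⊕ X ⊗ q) ≈⟨ ⊕-cong (≈-trans (⊕-cong (≈-refl {const a}) (≈-sym (const-* r c))) (≈-sym (const-+ a (r ℤ.* c)))) (≈-refl {(X- r) ⊗ (const c ⊕ X ⊗ q)}) ⟩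
      const (a ℤ.+ r ℤ.* c) ⊕ (X- r) ⊗ (const c ⊕ X ⊗ q)             ∎
      where
      open ≈-Reasoning
      open ZXSolver

  factor : ∀ r f → ∃ λ q → f ≈ const (f ⟪ r ⟫) ⊕ (X- r) ⊗ q
  factor r [] = [] , ≈-sym (≈-trans (⊕-cong 0∷[] (⊗-zeroʳ (X- r))) (⊕-identityˡ []))
  factor r (a ∷ f) = let (q , e) = factor r f in _ , factor-step r a f (f ⟪ r ⟫) q e

  -- Congruences

  infix 4 _∼_mod⟨_,_⟩
  -- Congruence modulo the ideal (x, y). Two generators cover every ideal that occurs: (p, g), (pᵏ,
  -- g), (p, sⁱ), and, with `[]` as one of them, (g) and (p).
  record _∼_mod⟨_,_⟩ (f g x y : ℤ[X]) : Set where
    constructor cong-by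
    field
      a b : ℤ[X]
      eq  : f ≈ g ⊕ (x ⊗ a ⊕ y ⊗ b)

  module _ {x y : ℤ[X]} where
    open ZXSolver

    opaque
      ≈⇒∼ : ∀ {f g} → f ≈ g → f ∼ g mod⟨ x , y ⟩
      ≈⇒∼ {f} {g} e = cong-by (const 0ℤ) (const 0ℤ) (≈-trans e (solve 3 (λ g x y → g := g :+ (x :* con 0ℤ :+ y :* con 0ℤ)) ≈-refl g x y))

      ∼0-by : ∀ {f} a b → f ≈ x ⊗ a ⊕ y ⊗ b → f ∼ [] mod⟨ x , y ⟩
      ∼0-by a b e = cong-by a b (≈-trans e (≈-sym (⊕-identityˡ _)))

      ∼0-elim : ∀ {f} → f ∼ [] mod⟨ x , y ⟩ → ∃₂ λ a b → f ≈ x ⊗ a ⊕ y ⊗ b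
      ∼0-elim (cong-by a b e) = a , b , ≈-trans e (⊕-identityˡ _)

      ∼-refl : ∀ {f} → f ∼ f mod⟨ x , y ⟩
      ∼-refl = ≈⇒∼ ≈-refl

      ∼-sym : ∀ {f g} → f ∼ g mod⟨ x , y ⟩ → g ∼ f mod⟨ x , y ⟩
      ∼-sym {f} {g} (cong-by a b e) = cong-by (⊝ a) (⊝ b) (≈-trans
        (solve 5 (λ g x y a b → g := (g :+ (x :* a :+ y :* b)) :+ (x :* (:- a) :+ y :* (:- b))) ≈-refl g x y a b)
        (⊕-cong (≈-sym e) ≈-refl))

      ∼-trans : ∀ {f g h} → f ∼ g mod⟨ x , y ⟩ → g ∼ h mod⟨ x , y ⟩ → f ∼ h mod⟨ x , y ⟩
      ∼-trans {h = h} (cong-by a b e) (cong-by a′ b′ e′) = cong-by (a ⊕ a′) (b ⊕ b′) (≈-trans e (≈-trans (⊕-cong e′ ≈-refl)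
        (solve 7 (λ h x y a b a′ b′ → (h :+ (x :* a′ :+ y :* b′)) :+ (x :* a :+ y :* b) := h :+ (x :* (a :+ a′) :+ y :* (b :+ b′))) ≈-refl h x y a b a′ b′)))

      ∼-⊕ : ∀ {f g h k} → f ∼ g mod⟨ x , y ⟩ → h ∼ k mod⟨ x , y ⟩ → f ⊕ h ∼ g ⊕ k mod⟨ x , y ⟩
      ∼-⊕ {g = g} {k = k} (cong-by a b e) (cong-by a′ b′ e′) = cong-by (a ⊕ a′) (b ⊕ b′) (≈-trans (⊕-cong e e′)
        (solve 8 (λ g k x y a b a′ b′ → (g :+ (x :* a :+ y :* b)) :+ (k :+ (x :* a′ :+ y :* b′)) := (g :+ k) :+ (x :* (a :+ a′) :+ y :* (b :+ b′))) ≈-refl g k x y a b a′ b′))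

      ∼-⊗ : ∀ {f g h k} → f ∼ g mod⟨ x , y ⟩ → h ∼ k mod⟨ x , y ⟩ → f ⊗ h ∼ g ⊗ k mod⟨ x , y ⟩
      ∼-⊗ {f} {g} {h} {k} (cong-by a b e) (cong-by a′ b′ e′) = cong-by (a ⊗ h ⊕ g ⊗ a′) (b ⊗ h ⊕ g ⊗ b′) (begin
        f ⊗ h                                                     ≈⟨ ⊗-cong e (≈-refl {h}) ⟩
        (g ⊕ (x ⊗ a ⊕ y ⊗ b)) ⊗ h ≈⟨ solve 6 (λ g h x y a b → (g :+ (x :* a :+ y :* b)) :* h := g :* h :+ (x :* (a :* h) :+ y :* (b :* h))) ≈-refl g h x y a b ⟩
        g ⊗ h ⊕ (x ⊗ (a ⊗ h) ⊕ y ⊗ (b ⊗ h))                       ≈⟨ ⊕-cong (⊗-congʳ g e′) ≈-refl ⟩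
        g ⊗ (k ⊕ (x ⊗ a′ ⊕ y ⊗ b′)) ⊕ (x ⊗ (a ⊗ h) ⊕ y ⊗ (b ⊗ h)) ≈⟨ solve 9 (λ g h k x y a b a′ b′ → g :* (k :+ (x :* a′ :+ y :* b′)) :+ (x :* (a :* h) :+ y :* (b :* h)) := g :* k :+ (x :* (a :* h :+ g :* a′) :+ y :* (b :* h :+ g :* b′))) ≈-refl g h k x y a b a′ b′ ⟩
        g ⊗ k ⊕ (x ⊗ (a ⊗ h ⊕ g ⊗ a′) ⊕ y ⊗ (b ⊗ h ⊕ g ⊗ b′))     ∎)
        where open ≈-Reasoning

      ∼-^ : ∀ {f g} → f ∼ g mod⟨ x , y ⟩ → ∀ n → f ^ n ∼ g ^ n mod⟨ x , y ⟩
      ∼-^ e zero    = ∼-refl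
      ∼-^ e (suc n) = ∼-⊗ e (∼-^ e n)

      ∼0-⊗ˡ : ∀ {f} h → f ∼ [] mod⟨ x , y ⟩ → h ⊗ f ∼ [] mod⟨ x , y ⟩
      ∼0-⊗ˡ h e = ∼-trans (∼-⊗ (∼-refl {h}) e) (≈⇒∼ (⊗-zeroʳ h))

      ∼0-⊗ʳ : ∀ {f} h → f ∼ [] mod⟨ x , y ⟩ → f ⊗ h ∼ [] mod⟨ x , y ⟩
      ∼0-⊗ʳ h e = ∼-trans (∼-⊗ e (∼-refl {h})) (≈⇒∼ ([]⊗ h))

      ∼0ˡ : ∀ a → x ⊗ a ∼ [] mod⟨ x , y ⟩
      ∼0ˡ a = ∼0-by a (const 0ℤ) (solve 3 (λ x y a → x :* a := x :* a :+ y :* con 0ℤ) ≈-refl x y a)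

      ∼0ʳ : ∀ b → y ⊗ b ∼ [] mod⟨ x , y ⟩
      ∼0ʳ b = ∼0-by (const 0ℤ) b (solve 3 (λ x y a → y :* a := x :* con 0ℤ :+ y :* a) ≈-refl x y b)

  ∼-setoid : ℤ[X] → ℤ[X] → Setoid _ _
  ∼-setoid x y = record
    { Carrier = ℤ[X] ; _≈_ = λ f g → f ∼ g mod⟨ x , y ⟩
    ; isEquivalence = record { refl = ∼-refl ; sym = ∼-sym ; trans = ∼-trans } }

  opaque
    mod-mono : ∀ {f g x y z} → x ∼ [] mod⟨ x , z ⟩ → y ∼ [] mod⟨ x , z ⟩ → f ∼ g mod⟨ x , y ⟩ → f ∼ g mod⟨ x , z ⟩
    mod-mono {f} {g} x∼0 y∼0 (cong-by a b e) = ∼-trans (≈⇒∼ e)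
      (∼-trans (∼-⊕ (∼-refl {f = g}) (∼-⊕ (∼0-⊗ʳ a x∼0) (∼0-⊗ʳ b y∼0))) (≈⇒∼ (≈-trans (⊕-cong (≈-refl {g}) (⊕-identityˡ [])) (⊕-identityʳ g))))

  const-cancel : ∀ n {f g} → .{{ℤ.NonZero n}} → const n ⊗ f ≈ const n ⊗ g → f ≈ g
  const-cancel n {f} {g} e = ext λ i → ℤₚ.*-cancelˡ-≡ n _ _ (begin
    n ℤ.* coeff f i       ≡⟨ coeff-· n f i ⟨
    coeff (n · f) i       ≡⟨ at (const-⊗ n f) i ⟨
    coeff (const n ⊗ f) i ≡⟨ at e i ⟩
    coeff (const n ⊗ g) i ≡⟨ at (const-⊗ n g) i ⟩
    coeff (n · g) i       ≡⟨ coeff-· n g i ⟩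
    n ℤ.* coeff g i       ∎)
    where open ≡-Reasoning

  opaque
    ∼-by : ∀ {f h g} b → f ≈ h ⊕ g ⊗ b → f ∼ h mod⟨ [] , g ⟩
    ∼-by {h = h} {g} b e = cong-by [] b (≈-trans e (⊕-cong (≈-refl {h}) (≈-sym (≈-trans (⊕-cong ([]⊗ []) ≈-refl) (⊕-identityˡ (g ⊗ b))))))

  opaque
    ∼-elim : ∀ {f h g} → f ∼ h mod⟨ [] , g ⟩ → ∃ λ b → f ≈ h ⊕ g ⊗ b
    ∼-elim {h = h} {g} (cong-by a b e) = b , ≈-trans e (⊕-cong (≈-refl {h}) (≈-trans (⊕-cong ([]⊗ a) ≈-refl) (⊕-identityˡ (g ⊗ b))))

  opaque
    -- The quotient ℤ[x]/(g) has no torsion: n (f - h) = g b forces n to divide b, as g is monic.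
    ∼-const-cancel : ∀ {m} n g → .{{ℤ.NonZero n}} → Monic m g → ∀ {f h} →
      const n ⊗ f ∼ const n ⊗ h mod⟨ [] , g ⟩ → f ∼ h mod⟨ [] , g ⟩
    ∼-const-cancel n g mg {f} {h} e = ∼-by b′ (const-cancel n (begin
      const n ⊗ f                        ≈⟨ proj₂ (∼-elim e) ⟩
      const n ⊗ h ⊕ g ⊗ b                ≈⟨ ⊕-cong (≈-refl {const n ⊗ h}) (⊗-congʳ g (proj₂ quotient)) ⟩
      const n ⊗ h ⊕ g ⊗ (const n ⊗ b′) ≈⟨ solve 4 (λ n h g b → n :* h :+ g :* (n :* b) := n :* (h :+ g :* b)) ≈-refl (const n) h g b′ ⟩
      const n ⊗ (h ⊕ g ⊗ b′)             ∎))
      where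
      open ≈-Reasoning
      open ZXSolver
      b : ℤ[X]
      b = proj₁ (∼-elim e)
      quotient : ∃ λ b′ → b ≈ const n ⊗ b′
      quotient = monic-cancel n g b (f ⊕ ⊝ h) mg (begin
        g ⊗ b                                      ≈⟨ solve 2 (λ u v → v := u :+ v :- u) ≈-refl (const n ⊗ h) (g ⊗ b) ⟩
        const n ⊗ h ⊕ g ⊗ b ⊕ ⊝ (const n ⊗ h)      ≈⟨ ⊕-cong (≈-sym (proj₂ (∼-elim e))) ≈-refl ⟩
        const n ⊗ f ⊕ ⊝ (const n ⊗ h) ≈⟨ solve 3 (λ n f h → n :* f :- n :* h := n :* (f :- h)) ≈-refl (const n) f h ⟩
        const n ⊗ (f ⊕ ⊝ h)                        ∎)
      b′ : ℤ[X]
      b′ = proj₁ quotient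

  opaque
    -- Membership in (x, y) as a multiple of x modulo y alone, the form in which powers of p can be
    -- cancelled.
    ∼0⇒∼ : ∀ {f x y} → f ∼ [] mod⟨ x , y ⟩ → ∃ λ a → f ∼ x ⊗ a mod⟨ [] , y ⟩
    ∼0⇒∼ e with ∼0-elim e
    ... | a , b , e′ = a , ∼-by b e′

  opaque
    ∼⇒∼0 : ∀ {f x y} a → f ∼ x ⊗ a mod⟨ [] , y ⟩ → f ∼ [] mod⟨ x , y ⟩
    ∼⇒∼0 a e with ∼-elim e
    ... | b , e′ = ∼0-by a b e′

  -- Primes

  module PrimeModulus {p : ℕ} (p-prime : Prime p) where

    instance
      p-nonZero : ℕ.NonZero p
      p-nonZero = prime⇒nonZero p-prime
      +p-nonZero : ℤ.NonZero (+ p)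
      +p-nonZero = p-nonZero

    P : ℤ[X]
    P = const (+ p)

    euclid : ∀ a b → + p ∣ a ℤ.* b → + p ∣ a ⊎ + p ∣ b
    euclid a b d with euclidsLemma ℤ.∣ a ∣ ℤ.∣ b ∣ p-prime (subst (p ℕ∣.∣_) (ℤₚ.abs-* a b) (∣⇒∣ᵤ d))
    ... | inj₁ e = inj₁ (∣ᵤ⇒∣ e)
    ... | inj₂ e = inj₂ (∣ᵤ⇒∣ e)

    ∤1 : ¬ + p ∣ 1ℤ
    ∤1 d = ¬prime[1] (subst Prime (ℕ∣.∣1⇒≡1 (∣⇒∣ᵤ d)) p-prime)

    ∣^⇒∣ : ∀ a n → + p ∣ a ^ℤ n → + p ∣ a
    ∣^⇒∣ a zero    d = contradiction d ∤1
    ∣^⇒∣ a (suc n) d with euclid a (a ^ℤ n) d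
    ... | inj₁ e = e
    ... | inj₂ e = ∣^⇒∣ a n e

    opaque
      inverse : ∀ u → ¬ + p ∣ u → ∃₂ λ s t → s ℤ.* u ℤ.+ t ℤ.* + p ≡ 1ℤ
      inverse u p∤u with coprime-Bézout {p} {ℤ.∣ u ∣} coprime
        where
        coprime : Coprime p ℤ.∣ u ∣
        coprime (d∣p , d∣u) with prime⇒irreducible p-prime d∣p
        ... | inj₁ d≡1   = d≡1
        ... | inj₂ ≡.refl = contradiction (∣ᵤ⇒∣ d∣u) p∤u
      ... | b = signed u b
        where
        cast : ∀ x y d m n → d ℕ.+ y ℕ.* n ≡ x ℕ.* m → + d ℤ.+ + y ℤ.* + n ≡ + x ℤ.* + m
        cast x y d m n e = ≡.trans (cong (λ z → + d ℤ.+ z) (≡.sym (ℤₚ.pos-* y n)))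
          (≡.trans (cong +_ e) (ℤₚ.pos-* x m))
        abs : ∀ n → Bézout.Identity 1 p n → ∃₂ λ s t → s ℤ.* + n ℤ.+ t ℤ.* + p ≡ 1ℤ
        abs n (Bézout.+- x y e) = ℤ.- (+ y) , + x , ≡.trans
          (cong (λ z → ℤ.- (+ y) ℤ.* + n ℤ.+ z) (≡.sym (cast x y 1 p n e)))
          (solve 2 (λ y n → :- y :* n :+ (con 1ℤ :+ y :* n) := con 1ℤ) ≡.refl (+ y) (+ n))
          where open ℤS
        abs n (Bézout.-+ x y e) = + y , ℤ.- (+ x) , ≡.trans
          (cong (λ z → z ℤ.+ ℤ.- (+ x) ℤ.* + p) (≡.sym (cast y x 1 n p e)))
          (solve 2 (λ y n → (con 1ℤ :+ y :* n) :+ :- y :* n := con 1ℤ) ≡.refl (+ x) (+ p))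
          where open ℤS
        signed : ∀ u → Bézout.Identity 1 p ℤ.∣ u ∣ → ∃₂ λ s t → s ℤ.* u ℤ.+ t ℤ.* + p ≡ 1ℤ
        signed (+ n) b = abs n b
        signed ℤ.-[1+ n ] b with abs (suc n) b
        ... | s , t , e = ℤ.- s , t , ≡.trans
          (cong (ℤ._+ t ℤ.* + p) (solve 2 (λ s n → (:- s) :* (:- n) := s :* n) ≡.refl s (+ suc n))) e
          where open ℤS

    opaque
      const∼0 : ∀ {y} a → + p ∣ a → const a ∼ [] mod⟨ P , y ⟩
      const∼0 a (divides q e) = ∼-trans (≈⇒∼ (≈-trans (∷-cong (≡.trans e (ℤₚ.*-comm q (+ p))) ≈-refl) (const-* (+ p) q))) (∼0ˡ (const q))

    opaque
      const-inverse : ∀ {y} u → ¬ + p ∣ u → ∃ λ s → const s ⊗ const u ∼ const 1ℤ mod⟨ P , y ⟩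
      const-inverse {y} u p∤u with inverse u p∤u
      ... | s , t , e = s , ∼-sym (∼-trans (≈⇒∼ (≈-trans (∷-cong (≡.sym e) ≈-refl)
          (≈-trans (const-+ _ _) (⊕-cong (const-* s u) (const-* t (+ p))))))
          (∼-trans (∼-⊕ (∼-refl {f = const s ⊗ const u}) (∼-trans (≈⇒∼ (⊗-comm (const t) P)) (∼0ˡ (const t)))) (≈⇒∼ (⊕-identityʳ _))))

    opaque
      unit-cancel : ∀ {y} u {f} → ¬ + p ∣ u → const u ⊗ f ∼ [] mod⟨ P , y ⟩ → f ∼ [] mod⟨ P , y ⟩
      unit-cancel {y} u {f} p∤u d = ∼-trans (≈⇒∼ (≈-sym (⊗-identityˡ f)))
        (∼-trans (∼-⊗ {f = const 1ℤ} {const s ⊗ const u} {f} {f} (∼-sym (proj₂ (const-inverse u p∤u))) ∼-refl)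
        (∼-trans (≈⇒∼ (⊗-assoc (const s) (const u) f)) (∼0-⊗ˡ (const s) d)))
        where
        s : ℤ
        s = proj₁ (const-inverse {y} u p∤u)

    opaque
      -- When p ∣ y(r), evaluation at r is a homomorphism from ℤ[x]/(p, y) to ℤ/p.
      ∼0⇒∣⟪⟫ : ∀ {y f} r → + p ∣ y ⟪ r ⟫ → f ∼ [] mod⟨ P , y ⟩ → + p ∣ f ⟪ r ⟫
      ∼0⇒∣⟪⟫ {y} {f} r py f∼0 = let (a , b , e) = ∼0-elim f∼0 in subst (+ p ∣_) (≡.sym (≡.trans (ev-cong e) (ev-⊕ (P ⊗ a) (y ⊗ b))))
        (∣m∣n⇒∣m+n
          (subst (+ p ∣_) (≡.sym (≡.trans (ev-⊗ P a) (cong (ℤ._* ev a) (ev-const (+ p))))) (∣m⇒∣m*n (ev a) (divides 1ℤ (≡.sym (ℤₚ.*-identityˡ (+ p))))))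
          (subst (+ p ∣_) (≡.sym (ev-⊗ y b)) (∣m⇒∣m*n (ev b) py)))
        where open Evalℤ r

    -- The quotient ℤ[x]/(p, w) has no nilpotents. For monic w this is squarefreeness modulo p,
    -- stated without factoring w.
    Reduced : ℤ[X] → Set
    Reduced w = ∀ f n → f ^ n ∼ [] mod⟨ P , w ⟩ → f ∼ [] mod⟨ P , w ⟩

    opaque
      ^∼0-head : ∀ u f n → (u ∷ f) ^ n ∼ [] mod⟨ P , [] ⟩ → u ∷ f ∼ X ⊗ f mod⟨ P , [] ⟩
      ^∼0-head u f n e = ∼-trans (≈⇒∼ (∷≈const⊕X⊗ u f)) (∼-trans (∼-⊕ (const∼0 u p∣u) (∼-refl {f = X ⊗ f})) (≈⇒∼ (⊕-identityˡ (X ⊗ f))))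
        where
        open Evalℤ 0ℤ
        p∣u : + p ∣ u
        p∣u = ∣^⇒∣ u n (subst (+ p ∣_) (≡.trans (ev-^ (u ∷ f) n) (cong (_^ℤ n) (ℤₚ.+-identityʳ u)))
          (∼0⇒∣⟪⟫ {f = (u ∷ f) ^ n} 0ℤ (divides 0ℤ ≡.refl) e))

      ^∼0-tail : ∀ u f n → (u ∷ f) ^ n ∼ [] mod⟨ P , [] ⟩ → f ^ n ∼ [] mod⟨ P , [] ⟩
      ^∼0-tail u f n e = ∼-trans (≈⇒∼ (proj₂ quotient)) (∼0ˡ (proj₁ quotient))
        where
        X-monic : Monic 1 X
        X-monic = ≡.refl , DegLt-length X
        X^n⊗f^n∼0 : X ^ n ⊗ f ^ n ∼ [] mod⟨ P , [] ⟩
        X^n⊗f^n∼0 = ∼-trans (≈⇒∼ (≈-sym (^-distrib-* X f n))) (∼-trans (∼-sym (∼-^ (^∼0-head u f n e) n)) e)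
        quotient : ∃ λ c → f ^ n ≈ P ⊗ c
        quotient = let (a , b , e′) = ∼0-elim X^n⊗f^n∼0 in
          monic-cancel (+ p) (X ^ n) (f ^ n) a (Monic-^ X X-monic n) (≈-trans e′ (≈-trans (⊕-cong (≈-refl {P ⊗ a}) ([]⊗ b)) (⊕-identityʳ _)))

    -- Polynomials over the field with p elements have no nilpotents: evaluation at 0 kills the
    -- constant term, and cancelling the monic xⁿ passes the hypothesis on to the rest of the list.
    ^∼0⇒∼0 : ∀ f n → f ^ n ∼ [] mod⟨ P , [] ⟩ → f ∼ [] mod⟨ P , [] ⟩
    ^∼0⇒∼0 []      n e = ∼-refl
    ^∼0⇒∼0 (u ∷ f) n e = ∼-trans (^∼0-head u f n e) (∼0-⊗ˡ X (^∼0⇒∼0 f n (^∼0-tail u f n e)))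

    opaque
      -- Used at n = p, where it says that the derivative of a p-th power vanishes modulo p.
      ∂-^-multiple : ∀ f n → ∃ λ h → ∂ (f ^ n) ≈ const (+ n) ⊗ h
      ∂-^-multiple f zero    = [] , ≈-trans (ext λ { i → ≡.trans (coeff-∂ (const 1ℤ) i) (ℤₚ.*-zeroʳ (+ suc i)) }) (≈-sym (⊗-zeroʳ (const 0ℤ)))
      ∂-^-multiple f (suc n) = f ^ n ⊗ ∂ f , ∂-^ f n

    -- The relation v s' ≡ e, with e a unit modulo p, replaces coprimality of s and s'. Because p-th
    -- powers have derivative 0, membership of fᵖ in (p, s) climbs step by step to membership in (p,
    -- sᵖ); for f of degree below m a comparison of degrees then leaves only fᵖ ≡ 0.
    module Separable {m} (s : ℤ[X]) (s-monic : Monic m s)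
      (v : ℤ[X]) (e : ℤ) (p∤e : ¬ + p ∣ e) (separable : v ⊗ ∂ s ∼ const e mod⟨ P , s ⟩) where

      -- Differentiating f ^ p ≡ s ^ (i + 1) b modulo p shows that s divides b.
      opaque
        raise : ∀ f i → suc i ℕ.< p → f ^ p ∼ [] mod⟨ P , s ^ suc i ⟩ → f ^ p ∼ [] mod⟨ P , s ^ suc (suc i) ⟩
        raise f i i<p f^p∼0 = with-b (unit-cancel (+ suc i) p∤suc-i (unit-cancel e p∤e
            (∼-trans (≈⇒∼ (⊗-congʳ (const e) (⊗-comm (const j) b))) e⊗b⊗j∼0)))
          where
          open ZXSolver
          j : ℤ
          j = + suc i
          a b : ℤ[X]
          a = proj₁ (∼0-elim f^p∼0)
          b = proj₁ (proj₂ (∼0-elim f^p∼0))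
          eq : f ^ p ≈ P ⊗ a ⊕ s ^ suc i ⊗ b
          eq = proj₂ (proj₂ (∼0-elim f^p∼0))
          p∤suc-i : ¬ + p ∣ + suc i
          p∤suc-i d = ℕₚ.<⇒≱ i<p (ℕ∣.∣⇒≤ (∣⇒∣ᵤ d))
          h : ℤ[X]
          h = proj₁ (∂-^-multiple f p)
          derivative : P ⊗ h ≈ P ⊗ ∂ a ⊕ ((const j ⊗ (s ^ i ⊗ ∂ s)) ⊗ b ⊕ s ^ suc i ⊗ ∂ b)
          derivative = ≈-trans (≈-sym (proj₂ (∂-^-multiple f p))) (≈-trans (∂-cong eq)
            (≈-trans (∂-⊕ (P ⊗ a) (s ^ suc i ⊗ b)) (⊕-cong (∂-const⊗ (+ p) a)
            (≈-trans (∂-⊗ (s ^ suc i) b) (⊕-cong (⊗-cong (∂-^ s i) (≈-refl {b})) ≈-refl)))))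
          -- Dividing the derivative by sⁱ leaves (i + 1) s' b + s b' ≡ 0 modulo p. Multiplied by v
          -- this becomes (i + 1) e b ≡ 0 modulo (p, s), where i + 1 < p is a unit.
          cancelled : ∃ λ c → const j ⊗ (∂ s ⊗ b) ⊕ s ⊗ ∂ b ≈ P ⊗ c
          cancelled = monic-cancel (+ p) (s ^ i) (const j ⊗ (∂ s ⊗ b) ⊕ s ⊗ ∂ b) (h ⊕ ⊝ ∂ a) (Monic-^ s s-monic i)
            (≈-trans (solve 8 (λ P a′ j si s′ b s b′ → si :* (j :* (s′ :* b) :+ s :* b′)
                 := (P :* a′ :+ ((j :* (si :* s′)) :* b :+ (s :* si) :* b′)) :- P :* a′) ≈-refl P (∂ a) (const j) (s ^ i) (∂ s) b s (∂ b))
            (≈-trans (⊕-cong (≈-sym derivative) ≈-refl)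
              (solve 3 (λ P h a′ → P :* h :- P :* a′ := P :* (h :- a′)) ≈-refl P h (∂ a))))
          e⊗b⊗j∼0 : const e ⊗ (b ⊗ const j) ∼ [] mod⟨ P , s ⟩
          e⊗b⊗j∼0 = begin
            const e ⊗ (b ⊗ const j)                        ≈⟨ ∼-⊗ (∼-sym separable) (∼-refl {f = b ⊗ const j}) ⟩
            v ⊗ ∂ s ⊗ (b ⊗ const j) ≈⟨ ≈⇒∼ (solve 6 (λ v s′ b j s b′ → v :* s′ :* (b :* j) := v :* (j :* (s′ :* b) :+ s :* b′) :+ s :* (:- (v :* b′))) ≈-refl v (∂ s) b (const j) s (∂ b)) ⟩
            v ⊗ (const j ⊗ (∂ s ⊗ b) ⊕ s ⊗ ∂ b) ⊕ s ⊗ (⊝ (v ⊗ ∂ b)) ≈⟨ ∼-⊕ (∼0-⊗ˡ v (∼-trans (≈⇒∼ (proj₂ cancelled)) (∼0ˡ _))) (∼0ʳ _) ⟩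
            [] ⊕ [] ≈⟨ ≈⇒∼ (⊕-identityˡ []) ⟩
            []                                             ∎
            where open SetoidReasoning (∼-setoid P s)
          with-b : b ∼ [] mod⟨ P , s ⟩ → f ^ p ∼ [] mod⟨ P , s ^ suc (suc i) ⟩
          with-b b∼0 = let (a′ , b′ , eq′) = ∼0-elim b∼0 in ∼0-by (a ⊕ s ^ suc i ⊗ a′) b′ (≈-trans eq (≈-trans (⊕-cong (≈-refl {P ⊗ a}) (⊗-congʳ (s ^ suc i) eq′))
            (solve 6 (λ P a si a′ s b′ → P :* a :+ si :* (P :* a′ :+ s :* b′) := P :* (a :+ si :* a′) :+ s :* si :* b′) ≈-refl P a (s ^ suc i) a′ s b′)))

      opaque
        raise-base : ∀ f → f ^ p ∼ [] mod⟨ P , s ⟩ → f ^ p ∼ [] mod⟨ P , s ^ 1 ⟩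
        raise-base f f^p∼0 = let (a , b , eq) = ∼0-elim f^p∼0 in
          ∼0-by a b (≈-trans eq (⊕-cong (≈-refl {P ⊗ a}) (⊗-cong (≈-sym (CommutativeRing.*-identityʳ ℤ[X]-ring s)) (≈-refl {b}))))

      raise-to : ∀ f → f ^ p ∼ [] mod⟨ P , s ⟩ → ∀ i → i ℕ.< p → f ^ p ∼ [] mod⟨ P , s ^ suc i ⟩
      raise-to f e zero    i<p = raise-base f e
      raise-to f e (suc i) i<p = raise f i i<p (raise-to f e i (ℕₚ.<-trans (ℕₚ.n<1+n i) i<p))

      opaque
        small-∼0 : ∀ f → DegLt m f → f ^ p ∼ [] mod⟨ P , s ⟩ → f ∼ [] mod⟨ P , [] ⟩
        small-∼0 f df f^p∼0 = ^∼0⇒∼0 f p (with-p p ≡.refl)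
          where
          with-p : ∀ q → p ≡ q → f ^ p ∼ [] mod⟨ P , [] ⟩
          with-p zero    p≡0 = contradiction (subst Prime p≡0 p-prime) ¬prime[0]
          with-p (suc q) p≡q = ∼-trans (≈⇒∼ eq) (∼-trans (∼-⊕ (∼0ˡ a) (∼-trans (≈⇒∼ (⊗-congʳ (s ^ suc q) (proj₂ quotient))) (∼0-⊗ˡ (s ^ suc q) (∼0ˡ (proj₁ quotient))))) (≈⇒∼ (⊕-identityˡ [])))
            where
            witness : ∃₂ λ a b → f ^ p ≈ P ⊗ a ⊕ s ^ suc q ⊗ b
            witness = ∼0-elim (raise-to f f^p∼0 q (ℕₚ.≤-reflexive (≡.sym p≡q)))
            a b : ℤ[X]
            a = proj₁ witness
            b = proj₁ (proj₂ witness)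
            eq : f ^ p ≈ P ⊗ a ⊕ s ^ suc q ⊗ b
            eq = proj₂ (proj₂ witness)
            -- Here fᵖ has degree below p m, the degree of sᵖ, so from there on the coefficients of
            -- sᵖ b are those of -p a.
            p∣top : ∀ j → suc q ℕ.* m ℕ.≤ j → + p ∣ coeff (s ^ suc q ⊗ b) j
            p∣top j j≥ = ∣m+n∣m⇒∣n (subst (+ p ∣_) (≡.trans (≡.sym (subst (λ n → coeff (f ^ n) j ≡ 0ℤ) (≡.sym p≡q) (DegLt-^ f df q j j≥))) (≡.trans (at eq j) (coeff-⊕ (P ⊗ a) (s ^ suc q ⊗ b) j))) (divides 0ℤ ≡.refl))
              (const⊗⇒∣-coeffs (+ p) (P ⊗ a) a ≈-refl j)
            quotient : ∃ λ c → b ≈ P ⊗ c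
            quotient = ∣-coeffs⇒const⊗ (+ p) b (∣-coeffs-monic⊗ (+ p) (s ^ suc q) b (Monic-^ s s-monic (suc q)) p∣top)

        p-th-root : ∀ f → f ^ p ∼ [] mod⟨ P , s ⟩ → f ∼ [] mod⟨ P , s ⟩
        p-th-root f f^p∼0 = ∼-trans f∼r (mod-mono (∼-trans (≈⇒∼ (≈-sym (CommutativeRing.*-identityʳ ℤ[X]-ring P))) (∼0ˡ (const 1ℤ))) (∼-refl {f = []})
                (small-∼0 r (proj₂ (proj₂ (proj₂ division))) (∼-trans (∼-sym (∼-^ f∼r p)) f^p∼0)))
          where
          division : ∃₂ λ q r → f ≈ s ⊗ q ⊕ r × DegLt m r
          division = monic-divMod s s-monic f
          r : ℤ[X]
          r = proj₁ (proj₂ division)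
          f∼r : f ∼ r mod⟨ P , s ⟩
          f∼r = ∼-trans (≈⇒∼ (proj₁ (proj₂ (proj₂ division)))) (∼-trans (∼-⊕ (∼0ʳ _) (∼-refl {f = r})) (≈⇒∼ (⊕-identityˡ r)))

        -- Since (n + 1) p ≥ n + 2, the p-th power of fⁿ⁺¹ is a multiple of fⁿ⁺², and a p-th root
        -- can be taken.
        reduce-exponent : ∀ f n → f ^ suc (suc n) ∼ [] mod⟨ P , s ⟩ → f ^ suc n ∼ [] mod⟨ P , s ⟩
        reduce-exponent f n e = p-th-root (f ^ suc n)
          (∼-trans (≈⇒∼ (≈-trans (^-assocʳ f (suc n) p) (≈-trans (^-congʳ f (≡.sym (ℕₚ.m+[n∸m]≡n {suc (suc n)} bound))) (^-homo-* f (suc (suc n)) _))))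
            (∼0-⊗ʳ _ e))
          where
          bound : suc (suc n) ℕ.≤ suc n ℕ.* p
          bound = ℕₚ.m<m*n (suc n) p (ℕ.nonTrivial⇒n>1 p {{prime⇒nonTrivial p-prime}})

      separable⇒reduced : Reduced s
      separable⇒reduced f zero e = ∼-trans (≈⇒∼ (≈-sym (⊗-identityˡ f))) (∼0-⊗ʳ f e)
      separable⇒reduced f (suc zero) e = ∼-trans (≈⇒∼ (≈-sym (CommutativeRing.*-identityʳ ℤ[X]-ring f))) e
      separable⇒reduced f (suc (suc n)) e = separable⇒reduced f (suc n) (reduce-exponent f n e)

  -- Almost integral elements and maximality at p

  module Maximality {p : ℕ} (p-prime : Prime p) {m : ℕ} (g : ℤ[X]) (g-monic : Monic m g) where
    open PrimeModulus p-prime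
    open CommutativeRing ℤ[X]-ring using () renaming (*-identityʳ to ⊗-identityʳ)

    -- f(θ)/p is almost integral over ℤ[θ], for a root θ of g: some non-zero N satisfies N (f(θ)/p)ᵏ ∈ ℤ[θ] for all k.
    AlmostIntegral : ℤ[X] → Set
    AlmostIntegral f = ∃ λ N → ℕ.NonZero N × (∀ k → const (+ N) ⊗ f ^ k ∼ [] mod⟨ P ^ k , g ⟩)

    opaque
      AI-⊗ : ∀ h {f} → AlmostIntegral f → AlmostIntegral (h ⊗ f)
      AI-⊗ h {f} (N , N≢0 , d) = N , N≢0 , λ k → ∼-trans
        (≈⇒∼ (≈-trans (⊗-congʳ (const (+ N)) (^-distrib-* h f k))
          (solve 3 (λ n a b → n :* (a :* b) := a :* (n :* b)) ≈-refl (const (+ N)) (h ^ k) (f ^ k))))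
        (∼0-⊗ˡ (h ^ k) (d k))
        where open ZXSolver

      times-P : ∀ {x f h} → h ∼ [] mod⟨ P , g ⟩ → f ∼ [] mod⟨ x , g ⟩ → h ⊗ f ∼ [] mod⟨ P ⊗ x , g ⟩
      times-P {x} {f} {h} h∼0 f∼0 = let (a , b , e) = ∼0-elim h∼0 ; (a′ , b′ , e′) = ∼0-elim f∼0 in
        ∼0-by (a ⊗ a′) (b ⊗ f ⊕ P ⊗ a ⊗ b′) (≈-trans (⊗-cong e (≈-refl {f})) (≈-trans (expand a b)
          (≈-trans (⊕-cong (⊗-congʳ (P ⊗ a) e′) (≈-refl {g ⊗ (b ⊗ f)})) (collect a b a′ b′))))
        where
        open ZXSolver
        expand : ∀ a b → (P ⊗ a ⊕ g ⊗ b) ⊗ f ≈ P ⊗ a ⊗ f ⊕ g ⊗ (b ⊗ f)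
        expand a b = solve 4 (λ u g b f → (u :+ g :* b) :* f := u :* f :+ g :* (b :* f)) ≈-refl (P ⊗ a) g b f
        collect : ∀ a b a′ b′ → P ⊗ a ⊗ (x ⊗ a′ ⊕ g ⊗ b′) ⊕ g ⊗ (b ⊗ f) ≈ P ⊗ x ⊗ (a ⊗ a′) ⊕ g ⊗ (b ⊗ f ⊕ P ⊗ a ⊗ b′)
        collect a b a′ b′ = solve 7 (λ P a x a′ g b′ u → P :* a :* (x :* a′ :+ g :* b′) :+ g :* u := P :* x :* (a :* a′) :+ g :* (u :+ P :* a :* b′))
          ≈-refl P a x a′ g b′ (b ⊗ f)

      -- Mixed powers fʲ hᵏ make the induction work: one factor h is written as f + (h - f), and h -
      -- f, lying in (p, g), supplies the factor p that f would have contributed.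
      AI-mixed : ∀ {f h} N → h ∼ f mod⟨ P , g ⟩ → (∀ k → const (+ N) ⊗ f ^ k ∼ [] mod⟨ P ^ k , g ⟩) →
        ∀ k j → const (+ N) ⊗ (f ^ j ⊗ h ^ k) ∼ [] mod⟨ P ^ (j ℕ.+ k) , g ⟩
      AI-mixed {f} N h∼f d zero j = subst (λ n → const (+ N) ⊗ (f ^ j ⊗ const 1ℤ) ∼ [] mod⟨ P ^ n , g ⟩) (≡.sym (ℕₚ.+-identityʳ j))
        (∼-trans (≈⇒∼ (⊗-congʳ (const (+ N)) (⊗-identityʳ (f ^ j)))) (d j))
      AI-mixed {f} {h} N h∼f d (suc k) j = subst (λ n → const (+ N) ⊗ (f ^ j ⊗ (h ⊗ h ^ k)) ∼ [] mod⟨ P ^ n , g ⟩) (≡.sym (ℕₚ.+-suc j k))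
        (∼-trans (≈⇒∼ split) (∼-trans (∼-⊕ (AI-mixed N h∼f d k (suc j)) (times-P h-f∼0 (AI-mixed N h∼f d k j))) (≈⇒∼ (⊕-identityˡ []))))
        where
        open ZXSolver
        h-f∼0 : h ⊕ ⊝ f ∼ [] mod⟨ P , g ⟩
        h-f∼0 = ∼-trans (∼-⊕ h∼f (∼-refl {f = ⊝ f})) (≈⇒∼ (⊝-inverseʳ f))
        split : const (+ N) ⊗ (f ^ j ⊗ (h ⊗ h ^ k)) ≈ const (+ N) ⊗ (f ⊗ f ^ j ⊗ h ^ k) ⊕ (h ⊕ ⊝ f) ⊗ (const (+ N) ⊗ (f ^ j ⊗ h ^ k))
        split = solve 5 (λ n fj h hk f → n :* (fj :* (h :* hk)) := n :* (f :* fj :* hk) :+ (h :- f) :* (n :* (fj :* hk))) ≈-refl (const (+ N)) (f ^ j) h (h ^ k) f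

      AI-resp : ∀ {f h} → h ∼ f mod⟨ P , g ⟩ → AlmostIntegral f → AlmostIntegral h
      AI-resp {f} {h} h∼f (N , N≢0 , d) = N , N≢0 , λ k →
        ∼-trans (≈⇒∼ (⊗-congʳ (const (+ N)) (≈-sym (⊗-identityˡ (h ^ k))))) (AI-mixed N h∼f d k 0)

      AI-unit : ∀ u {f} → ¬ + p ∣ u → AlmostIntegral (const u ⊗ f) → AlmostIntegral f
      AI-unit u {f} p∤u i = AI-resp (∼-trans (≈⇒∼ (≈-sym (⊗-identityˡ f)))
        (∼-trans (∼-⊗ {f = const 1ℤ} {const s ⊗ const u} {f} {f} (∼-sym (proj₂ (const-inverse u p∤u))) ∼-refl)
          (≈⇒∼ (⊗-assoc (const s) (const u) f)))) (AI-⊗ (const s) i)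
        where
        s : ℤ
        s = proj₁ (const-inverse {g} u p∤u)

      P^-cancel : ∀ n {f h} → P ^ n ⊗ f ∼ P ^ n ⊗ h mod⟨ [] , g ⟩ → f ∼ h mod⟨ [] , g ⟩
      P^-cancel zero {f} {h} e = ∼-trans (≈⇒∼ (≈-sym (⊗-identityˡ f))) (∼-trans e (≈⇒∼ (⊗-identityˡ h)))
      P^-cancel (suc n) {f} {h} e = P^-cancel n (∼-const-cancel (+ p) g g-monic
        (∼-trans (≈⇒∼ (≈-sym (⊗-assoc P (P ^ n) f))) (∼-trans e (≈⇒∼ (⊗-assoc P (P ^ n) h)))))

      -- (f/p)ⁿ⁺¹ = h/p
      AI-power : ∀ n {f h} → f ^ suc n ∼ P ^ n ⊗ h mod⟨ [] , g ⟩ → AlmostIntegral f → AlmostIntegral h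
      AI-power n {f} {h} e (N , N≢0 , d) = N , N≢0 , λ k → ∼⇒∼0 (proj₁ (witness k)) (P^-cancel (n ℕ.* k) (cancellable k))
        where
        open ZXSolver
        witness : ∀ k → ∃ λ a → const (+ N) ⊗ f ^ (suc n ℕ.* k) ∼ P ^ (suc n ℕ.* k) ⊗ a mod⟨ [] , g ⟩
        witness k = ∼0⇒∼ (d (suc n ℕ.* k))
        cancellable : ∀ k → P ^ (n ℕ.* k) ⊗ (const (+ N) ⊗ h ^ k) ∼ P ^ (n ℕ.* k) ⊗ (P ^ k ⊗ proj₁ (witness k)) mod⟨ [] , g ⟩
        cancellable k = begin
          P ^ (n ℕ.* k) ⊗ (const (+ N) ⊗ h ^ k) ≈⟨ ≈⇒∼ (⊗-cong (≈-sym (^-assocʳ P n k)) (≈-refl {const (+ N) ⊗ h ^ k})) ⟩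
          (P ^ n) ^ k ⊗ (const (+ N) ⊗ h ^ k) ≈⟨ ≈⇒∼ (solve 3 (λ a b c → a :* (b :* c) := b :* (a :* c)) ≈-refl ((P ^ n) ^ k) (const (+ N)) (h ^ k)) ⟩
          const (+ N) ⊗ ((P ^ n) ^ k ⊗ h ^ k)      ≈⟨ ≈⇒∼ (⊗-congʳ (const (+ N)) (≈-sym (^-distrib-* (P ^ n) h k))) ⟩
          const (+ N) ⊗ (P ^ n ⊗ h) ^ k            ≈⟨ ∼-⊗ (∼-refl {f = const (+ N)}) (∼-sym (∼-^ e k)) ⟩
          const (+ N) ⊗ (f ^ suc n) ^ k            ≈⟨ ≈⇒∼ (⊗-congʳ (const (+ N)) (^-assocʳ f (suc n) k)) ⟩
          const (+ N) ⊗ f ^ (suc n ℕ.* k)          ≈⟨ proj₂ (witness k) ⟩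
          P ^ (k ℕ.+ n ℕ.* k) ⊗ proj₁ (witness k)  ≈⟨ ≈⇒∼ (⊗-cong (^-homo-* P k (n ℕ.* k)) (≈-refl {proj₁ (witness k)})) ⟩
          (P ^ k ⊗ P ^ (n ℕ.* k)) ⊗ proj₁ (witness k) ≈⟨ ≈⇒∼ (solve 3 (λ a b c → a :* b :* c := b :* (a :* c)) ≈-refl (P ^ k) (P ^ (n ℕ.* k)) (proj₁ (witness k))) ⟩
          P ^ (n ℕ.* k) ⊗ (P ^ k ⊗ proj₁ (witness k)) ∎
          where open SetoidReasoning (∼-setoid [] g)

      -- If p ∤ N, the condition at k = 1 gives the claim. If N = p N₁, the condition at k + 1 can
      -- be divided by p, which trades the factor p of N for one more factor f; e counts these
      -- trades.
      AI⇒nilpotent′ : ∀ N → Acc ℕ._<_ N → .{{ℕ.NonZero N}} → ∀ e {f} → (∀ k → const (+ N) ⊗ f ^ (e ℕ.+ k) ∼ [] mod⟨ P ^ k , g ⟩) →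
        ∃ λ n → f ^ n ∼ [] mod⟨ P , g ⟩
      AI⇒nilpotent′ N (acc rec) e {f} d with + p ∣? + N
      ... | no p∤N = e ℕ.+ 1 , unit-cancel (+ N) p∤N
            (strip (d 1))
        where
        strip : ∀ {h} → h ∼ [] mod⟨ P ^ 1 , g ⟩ → h ∼ [] mod⟨ P , g ⟩
        strip h∼0 = let (a , b , eq) = ∼0-elim h∼0 in ∼0-by a b (≈-trans eq (⊕-cong (⊗-cong (⊗-identityʳ P) (≈-refl {a})) (≈-refl {g ⊗ b})))
      ... | yes p∣N with ∣⇒∣ᵤ p∣N
      ...   | ℕ∣.divides N₁ N≡ = AI⇒nilpotent′ N₁ (rec N₁<N) {{N₁≢0}} (suc e) λ k → divided k
        where
        N₁≢0 : ℕ.NonZero N₁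
        N₁≢0 = ℕₚ.m*n≢0⇒m≢0 N₁ {{subst ℕ.NonZero N≡ (ℕ.≢-nonZero (ℕ.≢-nonZero⁻¹ N))}}
        N₁<N : N₁ ℕ.< N
        N₁<N = subst (N₁ ℕ.<_) (≡.sym N≡) (ℕₚ.m<m*n N₁ p {{N₁≢0}} (ℕ.nonTrivial⇒n>1 p {{prime⇒nonTrivial p-prime}}))
        const-N : const (+ N) ≈ P ⊗ const (+ N₁)
        const-N = ≈-trans (∷-cong (≡.trans (cong +_ (≡.trans N≡ (ℕₚ.*-comm N₁ p))) (ℤₚ.pos-* p N₁)) ≈-refl) (const-* (+ p) (+ N₁))
        divided : ∀ k → const (+ N₁) ⊗ f ^ (suc e ℕ.+ k) ∼ [] mod⟨ P ^ k , g ⟩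
        divided k = ∼⇒∼0 a (∼-const-cancel (+ p) g g-monic (∼-trans (≈⇒∼ (≈-trans (≈-sym (⊗-assoc P (const (+ N₁)) _)) (⊗-cong (≈-sym const-N) ≈-refl)))
            (∼-trans (subst (λ n → const (+ N) ⊗ f ^ n ∼ P ^ suc k ⊗ a mod⟨ [] , g ⟩) (ℕₚ.+-suc e k) (proj₂ witness)) (≈⇒∼ (⊗-assoc P (P ^ k) a)))))
          where
          witness : ∃ λ a → const (+ N) ⊗ f ^ (e ℕ.+ suc k) ∼ P ^ suc k ⊗ a mod⟨ [] , g ⟩
          witness = ∼0⇒∼ (d (suc k))
          a : ℤ[X]
          a = proj₁ witness

      AI⇒nilpotent : ∀ {f} → AlmostIntegral f → ∃ λ n → f ^ n ∼ [] mod⟨ P , g ⟩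
      AI⇒nilpotent (N , N≢0 , d) = AI⇒nilpotent′ N (<-wellFounded N) {{N≢0}} 0 d

      AI⇒∣⟪⟫ : ∀ {f} r → + p ∣ g ⟪ r ⟫ → AlmostIntegral f → + p ∣ f ⟪ r ⟫
      AI⇒∣⟪⟫ {f} r p∣gr i = let (n , e) = AI⇒nilpotent i in
        ∣^⇒∣ (f ⟪ r ⟫) n (subst (+ p ∣_) (Evalℤ.ev-^ r f n) (∼0⇒∣⟪⟫ r p∣gr e))

    reduced⇒maximal : Reduced g → ∀ {f} → AlmostIntegral f → f ∼ [] mod⟨ P , g ⟩
    reduced⇒maximal reduced {f} i = let (n , e) = AI⇒nilpotent i in reduced f n e

    -- Dedekind's criterion when at most one root r of g modulo p is multiple.
    module Ramified (a : ℕ) (r : ℤ) (w v : ℤ[X])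
      (g≈ : g ≈ (X- r) ^ suc a ⊗ w ⊕ ⊝ (P ⊗ v))
      (p∤w : ¬ + p ∣ w ⟪ r ⟫) (p∤v : ¬ + p ∣ v ⟪ r ⟫) (w-reduced : Reduced w) where

      open ZXSolver

      π : ℤ[X]
      π = X- r

      opaque
        π^w≈ : π ^ suc a ⊗ w ≈ g ⊕ P ⊗ v
        π^w≈ = ≈-trans (solve 2 (λ u v → u := u :- v :+ v) ≈-refl (π ^ suc a ⊗ w) (P ⊗ v)) (⊕-cong (≈-sym g≈) (≈-refl {P ⊗ v}))

        π^w∼0 : π ^ suc a ⊗ w ∼ [] mod⟨ P , g ⟩
        π^w∼0 = ∼-trans (≈⇒∼ π^w≈) (∼0-by v (const 1ℤ) (solve 3 (λ g P v → g :+ P :* v := P :* v :+ g :* con 1ℤ) ≈-refl g P v))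

        p∣g⟪r⟫ : + p ∣ g ⟪ r ⟫
        p∣g⟪r⟫ = divides (ℤ.- ev v) (≡.trans (ev-cong g≈) (≡.trans (ev-⊕ (π ^ suc a ⊗ w) (⊝ (P ⊗ v)))
          (≡.trans (cong₂ ℤ._+_ vanishes (≡.trans (ev-⊝ (P ⊗ v)) (cong ℤ.-_ (≡.trans (ev-⊗ P v) (cong (ℤ._* ev v) (ev-const (+ p)))))))
          (≡.trans (ℤₚ.+-identityˡ _) (ℤS.solve 2 (λ p v → ℤS.:- (p ℤS.:* v) ℤS.:= ℤS.:- v ℤS.:* p) ≡.refl (+ p) (ev v))))))
          where
          open Evalℤ r
          vanishes : ev (π ⊗ π ^ a ⊗ w) ≡ 0ℤ
          vanishes = ≡.trans (ev-cong (⊗-assoc π (π ^ a) w)) (≡.trans (ev-⊗ π (π ^ a ⊗ w)) (cong (ℤ._* ev (π ^ a ⊗ w)) (X-⟪⟫ r)))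

        -- The root r has multiplicity a + 1. Of the a + 1 copies of πᵃ w, one gives up its πᵃ, a
        -- single π to each of the others; these become πᵃ⁺¹ w ≡ p v.
        top-power : (π ^ a ⊗ w) ^ suc a ∼ P ^ a ⊗ (v ^ a ⊗ w) mod⟨ [] , g ⟩
        top-power = begin
          (π ^ a ⊗ w) ⊗ (π ^ a ⊗ w) ^ a ≈⟨ ≈⇒∼ (solve 3 (λ u w x → u :* w :* x := u :* x :* w) ≈-refl (π ^ a) w ((π ^ a ⊗ w) ^ a)) ⟩
          π ^ a ⊗ (π ^ a ⊗ w) ^ a ⊗ w ≈⟨ ≈⇒∼ (⊗-cong (≈-trans (≈-sym (^-distrib-* π (π ^ a ⊗ w) a)) (^-congˡ a (≈-trans (≈-sym (⊗-assoc π (π ^ a) w)) π^w≈))) (≈-refl {w})) ⟩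
          (g ⊕ P ⊗ v) ^ a ⊗ w ≈⟨ ∼-⊗ (∼-^ (∼-by (const 1ℤ) (solve 3 (λ g P v → g :+ P :* v := P :* v :+ g :* con 1ℤ) ≈-refl g P v)) a) (∼-refl {f = w}) ⟩
          (P ⊗ v) ^ a ⊗ w ≈⟨ ≈⇒∼ (≈-trans (⊗-cong (^-distrib-* P v a) (≈-refl {w})) (⊗-assoc (P ^ a) (v ^ a) w)) ⟩
          P ^ a ⊗ (v ^ a ⊗ w)             ∎
          where open SetoidReasoning (∼-setoid [] g)

        -- Otherwise `AI-power` makes vᵃ w almost integral, so its value at the root r of g modulo p
        -- is divisible by p, which neither v(r) nor w(r) is.
        ¬AI-top : ¬ AlmostIntegral (π ^ a ⊗ w)
        ¬AI-top i = [ (λ d → p∤v (∣^⇒∣ (v ⟪ r ⟫) a (subst (+ p ∣_) (Evalℤ.ev-^ r v a) d))) , p∤w ]′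
          (euclid ((v ^ a) ⟪ r ⟫) (w ⟪ r ⟫) (subst (+ p ∣_) (Evalℤ.ev-⊗ r (v ^ a) w) (AI⇒∣⟪⟫ r p∣g⟪r⟫ (AI-power a top-power i))))

        -- As πᵃ⁺¹ w lies in (p, g), multiplying πᵃ w by h amounts to multiplying it by the constant
        -- h(r). A unit h(r) could be removed, contradicting `¬AI-top`.
        AI-top⇒∣⟪⟫ : ∀ h → AlmostIntegral (π ^ a ⊗ w ⊗ h) → + p ∣ h ⟪ r ⟫
        AI-top⇒∣⟪⟫ h i = decidable-stable (+ p ∣? h ⟪ r ⟫) λ p∤h → ¬AI-top (AI-unit (h ⟪ r ⟫) p∤h (AI-resp (∼-sym h∼) i))
          where
          q : ℤ[X]
          q = proj₁ (factor r h)
          h∼ : π ^ a ⊗ w ⊗ h ∼ const (h ⟪ r ⟫) ⊗ (π ^ a ⊗ w) mod⟨ P , g ⟩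
          h∼ = begin
            π ^ a ⊗ w ⊗ h ≈⟨ ≈⇒∼ (⊗-congʳ (π ^ a ⊗ w) (proj₂ (factor r h))) ⟩
            π ^ a ⊗ w ⊗ (const (h ⟪ r ⟫) ⊕ π ⊗ q) ≈⟨ ≈⇒∼ (solve 5 (λ u w c π q → u :* w :* (c :+ π :* q) := c :* (u :* w) :+ π :* u :* w :* q) ≈-refl (π ^ a) w (const (h ⟪ r ⟫)) π q) ⟩
            const (h ⟪ r ⟫) ⊗ (π ^ a ⊗ w) ⊕ π ^ suc a ⊗ w ⊗ q ≈⟨ ∼-⊕ (∼-refl {f = const (h ⟪ r ⟫) ⊗ (π ^ a ⊗ w)}) (∼0-⊗ʳ q π^w∼0) ⟩
            const (h ⟪ r ⟫) ⊗ (π ^ a ⊗ w) ⊕ []                           ≈⟨ ≈⇒∼ (⊕-identityʳ _) ⟩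
            const (h ⟪ r ⟫) ⊗ (π ^ a ⊗ w)                                ∎
            where open SetoidReasoning (∼-setoid P g)

        -- Multiplying f ≡ πⁱ h by πᵃ⁻ⁱ w gives πᵃ w h, still almost integral. Hence p ∣ h(r), and h
        -- contributes another factor π modulo p.
        π-factor-step : ∀ {f} i h → i ℕ.≤ a → AlmostIntegral f → f ∼ π ^ i ⊗ h mod⟨ P , g ⟩ →
          ∃ λ h′ → f ∼ π ^ suc i ⊗ h′ mod⟨ P , g ⟩
        π-factor-step {f} i h i≤a ai f∼ = q , (begin
            f                                        ≈⟨ f∼ ⟩
            π ^ i ⊗ h                                ≈⟨ ≈⇒∼ (⊗-congʳ (π ^ i) (proj₂ (factor r h))) ⟩
            π ^ i ⊗ (const (h ⟪ r ⟫) ⊕ π ⊗ q) ≈⟨ ∼-⊗ (∼-refl {f = π ^ i}) (∼-⊕ (const∼0 (h ⟪ r ⟫) p∣h) (∼-refl {f = π ⊗ q})) ⟩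
            π ^ i ⊗ ([] ⊕ π ⊗ q)                     ≈⟨ ≈⇒∼ (⊗-congʳ (π ^ i) (⊕-identityˡ (π ⊗ q))) ⟩
            π ^ i ⊗ (π ⊗ q) ≈⟨ ≈⇒∼ (solve 3 (λ u π q → u :* (π :* q) := π :* u :* q) ≈-refl (π ^ i) π q) ⟩
            π ⊗ π ^ i ⊗ q                            ∎)
          where
          open SetoidReasoning (∼-setoid P g)
          q : ℤ[X]
          q = proj₁ (factor r h)
          regroup : π ^ a ⊗ w ⊗ h ≈ π ^ (a ℕ.∸ i) ⊗ w ⊗ (π ^ i ⊗ h)
          regroup = ≈-trans (⊗-cong (⊗-cong (≈-trans (^-congʳ π (≡.sym (ℕₚ.m∸n+n≡m i≤a))) (^-homo-* π (a ℕ.∸ i) i)) (≈-refl {w})) (≈-refl {h}))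
            (solve 4 (λ x y w h → x :* y :* w :* h := x :* w :* (y :* h)) ≈-refl (π ^ (a ℕ.∸ i)) (π ^ i) w h)
          p∣h : + p ∣ h ⟪ r ⟫
          p∣h = AI-top⇒∣⟪⟫ h (AI-resp (≈⇒∼ regroup) (AI-⊗ (π ^ (a ℕ.∸ i) ⊗ w) (AI-resp (∼-sym f∼) ai)))

      π-factor : ∀ {f} → AlmostIntegral f → ∀ i → i ℕ.≤ suc a → ∃ λ h → f ∼ π ^ i ⊗ h mod⟨ P , g ⟩
      π-factor {f} ai zero    _         = f , ≈⇒∼ (≈-sym (⊗-identityˡ f))
      π-factor {f} ai (suc i) (s≤s i≤a) = let (h , e) = π-factor ai i (ℕₚ.m≤n⇒m≤1+n i≤a) in π-factor-step i h i≤a ai e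

      opaque
        mod-w : ∀ {f h} → f ∼ h mod⟨ P , g ⟩ → f ∼ h mod⟨ P , w ⟩
        mod-w = mod-mono (∼-trans (≈⇒∼ (≈-sym (⊗-identityʳ P))) (∼0ˡ (const 1ℤ)))
          (∼-trans (≈⇒∼ g≈) (∼0-by (⊝ v) (π ^ suc a) (solve 4 (λ u w P v → u :* w :- P :* v := P :* (:- v) :+ w :* u) ≈-refl (π ^ suc a) w P v)))

        -- Modulo w one has w(r) ≡ -(x - r) q, and w(r) is a unit modulo p.
        π-inverse : ∃ λ τ → τ ⊗ π ∼ const 1ℤ mod⟨ P , w ⟩
        π-inverse = τ , (begin
            τ ⊗ π ≈⟨ ≈⇒∼ (solve 4 (λ s q π c → (:- (s :* q)) :* π := s :* c :+ (c :+ π :* q) :* (:- s)) ≈-refl (const s) q π (const (w ⟪ r ⟫))) ⟩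
            const s ⊗ const (w ⟪ r ⟫) ⊕ (const (w ⟪ r ⟫) ⊕ π ⊗ q) ⊗ (⊝ const s) ≈⟨ ∼-⊕ (proj₂ (const-inverse (w ⟪ r ⟫) p∤w)) (∼-trans (≈⇒∼ (⊗-cong (≈-sym (proj₂ (factor r w))) ≈-refl)) (∼0ʳ _)) ⟩
            const 1ℤ ⊕ []                               ≈⟨ ≈⇒∼ (⊕-identityʳ _) ⟩
            const 1ℤ                                    ∎)
          where
          open SetoidReasoning (∼-setoid P w)
          q : ℤ[X]
          q = proj₁ (factor r w)
          s : ℤ
          s = proj₁ (const-inverse {w} (w ⟪ r ⟫) p∤w)
          τ : ℤ[X]
          τ = ⊝ (const s ⊗ q)

        π^-cancel : ∀ b {f} → π ^ b ⊗ f ∼ [] mod⟨ P , w ⟩ → f ∼ [] mod⟨ P , w ⟩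
        π^-cancel b {f} e = begin
          f                             ≈⟨ ≈⇒∼ (≈-sym (⊗-identityˡ f)) ⟩
          const 1ℤ ⊗ f                  ≈⟨ ∼-⊗ {f = const 1ℤ} {const 1ℤ ^ b} {f} {f} (≈⇒∼ (1^ b)) ∼-refl ⟩
          const 1ℤ ^ b ⊗ f ≈⟨ ∼-⊗ {f = const 1ℤ ^ b} {(τ ⊗ π) ^ b} {f} {f} (∼-^ (∼-sym (proj₂ π-inverse)) b) ∼-refl ⟩
          (τ ⊗ π) ^ b ⊗ f ≈⟨ ≈⇒∼ (≈-trans (⊗-cong (^-distrib-* τ π b) (≈-refl {f})) (⊗-assoc (τ ^ b) (π ^ b) f)) ⟩
          τ ^ b ⊗ (π ^ b ⊗ f)           ≈⟨ ∼0-⊗ˡ (τ ^ b) e ⟩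
          []                            ∎
          where
          open SetoidReasoning (∼-setoid P w)
          τ : ℤ[X]
          τ = proj₁ π-inverse
          1^ : ∀ b → const 1ℤ ≈ const 1ℤ ^ b
          1^ zero    = ≈-refl
          1^ (suc b) = ≈-trans (1^ b) (≈-sym (⊗-identityˡ (const 1ℤ ^ b)))

        -- Write f ≡ πᵃ⁺¹ h. Some power of f lies in (p, g), hence in (p, w), where π is invertible;
        -- so h is nilpotent there and lies in (p, w). Then f lies in the ideal generated by p and
        -- πᵃ⁺¹ w, which is (p, g).
        ramified⇒maximal : ∀ {f} → AlmostIntegral f → f ∼ [] mod⟨ P , g ⟩
        ramified⇒maximal {f} ai = ∼-trans f∼π^h (from-h (w-reduced h n (π^-cancel (suc a ℕ.* n)
            (∼-trans (≈⇒∼ (≈-sym (≈-trans (^-distrib-* (π ^ suc a) h n) (⊗-cong (^-assocʳ π (suc a) n) (≈-refl {h ^ n})))))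
            (mod-w (∼-trans (∼-^ (∼-sym f∼π^h) n) (proj₂ nilpotent)))))))
          where
          decomposition : ∃ λ h → f ∼ π ^ suc a ⊗ h mod⟨ P , g ⟩
          decomposition = π-factor ai (suc a) ℕₚ.≤-refl
          h : ℤ[X]
          h = proj₁ decomposition
          f∼π^h : f ∼ π ^ suc a ⊗ h mod⟨ P , g ⟩
          f∼π^h = proj₂ decomposition
          nilpotent : ∃ λ n → f ^ n ∼ [] mod⟨ P , g ⟩
          nilpotent = AI⇒nilpotent ai
          n : ℕ
          n = proj₁ nilpotent
          from-h : h ∼ [] mod⟨ P , w ⟩ → π ^ suc a ⊗ h ∼ [] mod⟨ P , g ⟩
          from-h h∼0 = let (x , y , e) = ∼0-elim h∼0 in ∼-trans (≈⇒∼ (≈-trans (⊗-congʳ (π ^ suc a) e)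
            (solve 5 (λ u P x w y → u :* (P :* x :+ w :* y) := P :* (u :* x) :+ u :* w :* y) ≈-refl (π ^ suc a) P x w y)))
            (∼-trans (∼-⊕ (∼0ˡ (π ^ suc a ⊗ x)) (∼0-⊗ʳ y π^w∼0)) (≈⇒∼ (⊕-identityˡ [])))

  -- Local maximality

  -- Turns an explicit coefficient list into an expression in `X`, the form that the ring solver
  -- accepts.
  horner : ℤ[X] → ℤ[X]
  horner []          = []
  horner (a ∷ [])    = const a
  horner (a ∷ b ∷ f) = const a ⊕ X ⊗ horner (b ∷ f)

  opaque
    ≈horner : ∀ f → f ≈ horner f
    ≈horner []          = ≈-refl
    ≈horner (a ∷ [])    = ≈-refl
    ≈horner (a ∷ b ∷ f) = ≈-trans (∷≈const⊕X⊗ a (b ∷ f)) (⊕-cong (≈-refl {const a}) (⊗-congʳ X (≈horner (b ∷ f))))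

    const-+≈ : ∀ {a b f g} → const a ≈ f → const b ≈ g → const (a ℤ.+ b) ≈ f ⊕ g
    const-+≈ {a} {b} e e′ = ≈-trans (const-+ a b) (⊕-cong e e′)

    const-*≈ : ∀ {a b f g} → const a ≈ f → const b ≈ g → const (a ℤ.* b) ≈ f ⊗ g
    const-*≈ {a} {b} e e′ = ≈-trans (const-* a b) (⊗-cong e e′)

    const-neg≈ : ∀ {a f} → const a ≈ f → const (ℤ.- a) ≈ ⊝ f
    const-neg≈ {a} e = ≈-trans (const-neg a) (⊝-cong e)

    const-≡ : ∀ {a b} → a ≡ b → const a ≈ const b
    const-≡ ≡.refl = ≈-refl

  quintic : ℤ → ℤ → ℤ[X]
  quintic c d = d ∷ 0ℤ ∷ 0ℤ ∷ 0ℤ ∷ c ∷ 1ℤ ∷ []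

  quintic-monic : ∀ c d → Monic 5 (quintic c d)
  quintic-monic c d = ≡.refl , DegLt-length (quintic c d)

  disc : ℤ → ℤ → ℤ
  disc c d = + 3125 ℤ.* d ℤ.+ + 256 ℤ.* (c ℤ.* (c ℤ.* (c ℤ.* (c ℤ.* c))))

  opaque
    quintic≈ : ∀ c d {C D} → const c ≈ C → const d ≈ D → quintic c d ≈ X ⊗ X ⊗ X ⊗ X ⊗ X ⊕ C ⊗ X ⊗ X ⊗ X ⊗ X ⊕ D
    quintic≈ c d {C} {D} ec ed = ≈-trans (≈horner (quintic c d))
      (≈-trans (solve 3 (λ x c d → d :+ x :* (con 0ℤ :+ x :* (con 0ℤ :+ x :* (con 0ℤ :+ x :* (c :+ x :* con 1ℤ)))) := x :* x :* x :* x :* x :+ c :* x :* x :* x :* x :+ d) ≈-refl X (const c) (const d))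
        (⊕-cong (⊕-cong (≈-refl {X ⊗ X ⊗ X ⊗ X ⊗ X}) (t (t (t (t ec))))) ed))
      where
      open ZXSolver
      t : ∀ {f g} → f ≈ g → f ⊗ X ≈ g ⊗ X
      t e = ⊗-cong e (≈-refl {X})

    ∂-quintic : ∀ c d → ∂ (quintic c d) ≈ 0ℤ ∷ 0ℤ ∷ 0ℤ ∷ + 4 ℤ.* c ∷ + 5 ∷ []
    ∂-quintic c d = ext λ
      { 0 → coeff-∂ (quintic c d) 0 ; 1 → coeff-∂ (quintic c d) 1 ; 2 → coeff-∂ (quintic c d) 2
      ; 3 → coeff-∂ (quintic c d) 3 ; 4 → coeff-∂ (quintic c d) 4
      ; (suc (suc (suc (suc (suc i))))) → ≡.trans (coeff-∂ (quintic c d) (5 ℕ.+ i)) (ℤₚ.*-zeroʳ (+ (6 ℕ.+ i))) }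

  module Cases {p : ℕ} (p-prime : Prime p) (c d : ℤ) where
    open PrimeModulus p-prime
    private g = quintic c d
    open Maximality p-prime g (quintic-monic c d)

    PMaximal : Set
    PMaximal = ∀ {f} → AlmostIntegral f → f ∼ [] mod⟨ P , g ⟩

    1-reduced : Reduced (const 1ℤ)
    1-reduced f n _ = ∼-trans (≈⇒∼ (≈-sym (⊗-identityˡ f))) (∼0ʳ f)

    opaque
      ∤neg : ∀ a → ¬ + p ∣ a → ¬ + p ∣ ℤ.- a
      ∤neg a p∤a d = p∤a (subst (+ p ∣_) (ℤₚ.neg-involutive a) (∣m⇒∣-m d))

      ∤* : ∀ a b → ¬ + p ∣ a → ¬ + p ∣ b → ¬ + p ∣ a ℤ.* b
      ∤* a b p∤a p∤b = [ p∤a , p∤b ]′ ∘ euclid a b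

      -- The Eisenstein case: g ≡ x⁵ modulo p, and v(0) = -d/p is prime to p.
      case-p∣c : + p ∣ d → ¬ + p ℤ.* + p ∣ d → + p ∣ c → PMaximal
      case-p∣c (divides d′ ed) p²∤d (divides c′ ec) = Ramified.ramified⇒maximal 4 0ℤ (const 1ℤ) v g≈ ∤1 p∤v 1-reduced
        where
        open ZXSolver
        v : ℤ[X]
        v = ℤ.- d′ ∷ 0ℤ ∷ 0ℤ ∷ 0ℤ ∷ ℤ.- c′ ∷ []
        v≈ : v ≈ ⊝ const d′ ⊕ X ⊗ (const 0ℤ ⊕ X ⊗ (const 0ℤ ⊕ X ⊗ (const 0ℤ ⊕ X ⊗ ⊝ const c′)))
        v≈ = ≈-trans (≈horner v) (⊕-cong (const-neg d′) (⊗-congʳ X (⊕-cong ≈-refl (⊗-congʳ X (⊕-cong ≈-refl (⊗-congʳ X (⊕-cong ≈-refl (⊗-congʳ X (const-neg c′)))))))))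
        g≈ : g ≈ (X- 0ℤ) ^ 5 ⊗ const 1ℤ ⊕ ⊝ (P ⊗ v)
        g≈ = ≈-trans (quintic≈ c d (≈-trans (const-≡ ec) (const-* c′ (+ p))) (≈-trans (const-≡ ed) (const-* d′ (+ p))))
          (≈-trans (solve 4 (λ x P c d → x :* x :* x :* x :* x :+ c :* P :* x :* x :* x :* x :+ d :* P
              := (x :- con 0ℤ) :^ 5 :* con 1ℤ :- P :* (:- d :+ x :* (con 0ℤ :+ x :* (con 0ℤ :+ x :* (con 0ℤ :+ x :* (:- c)))))) ≈-refl X P (const c′) (const d′))
            (⊕-cong ≈-refl (⊝-cong (⊗-congʳ P (≈-sym v≈)))))
        p∤v : ¬ + p ∣ v ⟪ 0ℤ ⟫
        p∤v = ∤neg d′ (λ { (divides q e) → p²∤d (divides q (≡.trans ed (≡.trans (cong (ℤ._* + p) e) (ℤₚ.*-assoc q (+ p) (+ p))))) }) ∘ subst (+ p ∣_) (ℤₚ.+-identityʳ (ℤ.- d′))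

      -- Here g ≡ x⁴ (x + c) modulo p, with the simple root -c different from 0.
      case-p∤c : + p ∣ d → ¬ + p ℤ.* + p ∣ d → ¬ + p ∣ c → PMaximal
      case-p∤c (divides d′ ed) p²∤d p∤c = Ramified.ramified⇒maximal 3 0ℤ w v g≈
          (p∤c ∘ subst (+ p ∣_) (ℤₚ.+-identityʳ c))
          (∤neg d′ p∤d′ ∘ subst (+ p ∣_) (ℤₚ.+-identityʳ (ℤ.- d′)))
          (Separable.separable⇒reduced w w-monic (const 1ℤ) 1ℤ ∤1 (≈⇒∼ (≈-trans (⊗-identityˡ (∂ w)) ∂w≈)))
        where
        open ZXSolver
        w v : ℤ[X]
        w = c ∷ 1ℤ ∷ []
        v = const (ℤ.- d′)
        p∤d′ : ¬ + p ∣ d′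
        p∤d′ (divides q e) = p²∤d (divides q (≡.trans ed (≡.trans (cong (ℤ._* + p) e) (ℤₚ.*-assoc q (+ p) (+ p)))))
        w-monic : Monic 1 w
        w-monic = ≡.refl , DegLt-length w
        ∂w≈ : ∂ w ≈ const 1ℤ
        ∂w≈ = ext λ { zero → coeff-∂ w 0 ; (suc i) → ≡.trans (coeff-∂ w (suc i)) (ℤₚ.*-zeroʳ (+ (2 ℕ.+ i))) }
        g≈ : g ≈ (X- 0ℤ) ^ 4 ⊗ w ⊕ ⊝ (P ⊗ v)
        g≈ = ≈-trans (quintic≈ c d ≈-refl (≈-trans (const-≡ ed) (const-* d′ (+ p))))
          (≈-trans (solve 4 (λ x P c d → x :* x :* x :* x :* x :+ c :* x :* x :* x :* x :+ d :* P
              := (x :- con 0ℤ) :^ 4 :* (c :+ x :* con 1ℤ) :- P :* (:- d)) ≈-refl X P (const c) (const d′))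
            (⊕-cong (⊗-congʳ ((X- 0ℤ) ^ 4) (≈-sym (≈horner w))) (⊝-cong (⊗-congʳ P (≈-sym (const-neg d′))))))

      -- g' = x³(5x + 4c), while x · x³(x + c) ≡ -d and (5x + 4c) q ≡ -disc modulo g.
      case-separable : ¬ + p ∣ d → ¬ + p ∣ disc c d → PMaximal
      case-separable p∤d p∤disc = reduced⇒maximal (Separable.separable⇒reduced g (quintic-monic c d) (q ⊗ (y ⊗ y ⊗ y)) e
          (∤* (disc c d) (d ℤ.* (d ℤ.* d)) p∤disc (∤* d (d ℤ.* d) p∤d (∤* d d p∤d p∤d))) separable)
        where
        open ZXSolver
        C D q y l : ℤ[X]
        C = const c
        D = const d
        -- The quotient of 5⁵ g by l = 5x + 4c; the remainder 5⁵ g(-4c/5) is `disc c d`. Below, x y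
        -- = g - d.
        q = const (+ 625) ⊗ X ⊗ X ⊗ X ⊗ X ⊕ const (+ 125) ⊗ C ⊗ X ⊗ X ⊗ X ⊕ ⊝ (const (+ 100) ⊗ C ⊗ C ⊗ X ⊗ X) ⊕ const (+ 80) ⊗ C ⊗ C ⊗ C ⊗ X ⊕ ⊝ (const (+ 64) ⊗ C ⊗ C ⊗ C ⊗ C)
        y = X ⊗ X ⊗ X ⊗ (X ⊕ C)
        l = const (+ 5) ⊗ X ⊕ const (+ 4) ⊗ C
        Δ : ℤ[X]
        Δ = const (+ 3125) ⊗ D ⊕ const (+ 256) ⊗ (C ⊗ (C ⊗ (C ⊗ (C ⊗ C))))
        e : ℤ
        e = disc c d ℤ.* (d ℤ.* (d ℤ.* d))
        const-e : const e ≈ Δ ⊗ (D ⊗ (D ⊗ D))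
        const-e = const-*≈ (const-+≈ (const-* (+ 3125) d) (const-*≈ ≈-refl (const-*≈ ≈-refl (const-*≈ ≈-refl (const-*≈ ≈-refl (const-* c c))))))
          (const-*≈ ≈-refl (const-* d d))
        ∂g≈ : ∂ g ≈ X ⊗ X ⊗ X ⊗ l
        ∂g≈ = ≈-trans (∂-quintic c d) (≈-trans (≈horner _)
          (≈-trans (⊕-cong ≈-refl (⊗-congʳ X (⊕-cong ≈-refl (⊗-congʳ X (⊕-cong ≈-refl (⊗-congʳ X (⊕-cong (const-* (+ 4) c) ≈-refl)))))))
          (solve 2 (λ x c → con 0ℤ :+ x :* (con 0ℤ :+ x :* (con 0ℤ :+ x :* (con (+ 4) :* c :+ x :* con (+ 5)))) := x :* x :* x :* (con (+ 5) :* x :+ con (+ 4) :* c)) ≈-refl X C)))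
        lq∼ : l ⊗ q ∼ ⊝ Δ mod⟨ P , g ⟩
        lq∼ = ∼-trans (≈⇒∼ (≈-trans
          (solve 3 (λ x c d → (con (+ 5) :* x :+ con (+ 4) :* c) :* (con (+ 625) :* x :* x :* x :* x :+ con (+ 125) :* c :* x :* x :* x :- con (+ 100) :* c :* c :* x :* x :+ con (+ 80) :* c :* c :* c :* x :- con (+ 64) :* c :* c :* c :* c)
              := (x :* x :* x :* x :* x :+ c :* x :* x :* x :* x :+ d) :* con (+ 3125) :- (con (+ 3125) :* d :+ con (+ 256) :* (c :* (c :* (c :* (c :* c)))))) ≈-refl X C D)
          (⊕-cong (⊗-cong (≈-sym (quintic≈ c d ≈-refl ≈-refl)) ≈-refl) ≈-refl)))
          (∼-trans (∼-⊕ (∼0ʳ (const (+ 3125))) (∼-refl {f = ⊝ Δ})) (≈⇒∼ (⊕-identityˡ _)))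
        xy∼ : X ⊗ y ∼ ⊝ D mod⟨ P , g ⟩
        xy∼ = ∼-trans (≈⇒∼ (≈-trans
          (solve 3 (λ x c d → x :* (x :* x :* x :* (x :+ c)) := (x :* x :* x :* x :* x :+ c :* x :* x :* x :* x :+ d) :* con 1ℤ :- d) ≈-refl X C D)
          (⊕-cong (⊗-cong (≈-sym (quintic≈ c d ≈-refl ≈-refl)) ≈-refl) ≈-refl)))
          (∼-trans (∼-⊕ (∼0ʳ (const 1ℤ)) (∼-refl {f = ⊝ D})) (≈⇒∼ (⊕-identityˡ _)))
        separable : q ⊗ (y ⊗ y ⊗ y) ⊗ ∂ g ∼ const e mod⟨ P , g ⟩
        separable = begin
          q ⊗ (y ⊗ y ⊗ y) ⊗ ∂ g                         ≈⟨ ≈⇒∼ (⊗-congʳ (q ⊗ (y ⊗ y ⊗ y)) ∂g≈) ⟩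
          q ⊗ (y ⊗ y ⊗ y) ⊗ (X ⊗ X ⊗ X ⊗ l) ≈⟨ ≈⇒∼ (solve 4 (λ q y x l → q :* (y :* y :* y) :* (x :* x :* x :* l) := l :* q :* (x :* y :* (x :* y :* (x :* y)))) ≈-refl q y X l) ⟩
          l ⊗ q ⊗ (X ⊗ y ⊗ (X ⊗ y ⊗ (X ⊗ y)))           ≈⟨ ∼-⊗ lq∼ (∼-⊗ xy∼ (∼-⊗ xy∼ xy∼)) ⟩
          ⊝ Δ ⊗ (⊝ D ⊗ (⊝ D ⊗ ⊝ D)) ≈⟨ ≈⇒∼ (solve 2 (λ a b → :- a :* (:- b :* (:- b :* :- b)) := a :* (b :* (b :* b))) ≈-refl Δ D) ⟩
          Δ ⊗ (D ⊗ (D ⊗ D))                             ≈⟨ ≈⇒∼ (≈-sym const-e) ⟩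
          const e                                       ∎
          where open SetoidReasoning (∼-setoid P g)

  5-prime : Prime 5
  5-prime = from-yes (prime? 5)

  module TotallyRamifiedAt5 (c d : ℤ) where

    open PrimeModulus 5-prime
    private g = quintic c d
    open Maximality 5-prime g (quintic-monic c d)
    open Cases 5-prime c d using (PMaximal; 1-reduced)

    opaque
      -- By Fermat, g ≡ x⁵ + d ≡ (x + d)⁵ modulo 5. With r = -d and w = 1 the value v(r) is
      -- -g(-d)/5, so the last hypothesis on e and c′ says that 25 does not divide g(-d).
      case-5 : ∀ c′ e → c ≡ c′ ℤ.* + 5 → d ℤ.* (d ℤ.* (d ℤ.* (d ℤ.* d))) ℤ.- d ≡ e ℤ.* + 5 →
        ¬ + 5 ∣ e ℤ.- c′ ℤ.* (d ℤ.* (d ℤ.* (d ℤ.* d))) → PMaximal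
      case-5 c′ e ec ee 5∤ = Ramified.ramified⇒maximal 4 (ℤ.- d) (const 1ℤ) v g≈ (∤1 ∘ subst (+ 5 ∣_) (Evalℤ.ev-const (ℤ.- d) 1ℤ)) (5∤ ∘ subst (+ 5 ∣_) v⟪⟫) 1-reduced
        where
        d⁴ : ℤ
        d⁴ = d ℤ.* (d ℤ.* (d ℤ.* d))
        C D E : ℤ[X]
        C = const c′
        D = const d
        E = const e
        v : ℤ[X]
        -- The coefficients of ((x + d)⁵ - g)/5; e comes from (d⁵ - d)/5.
        v = e ∷ d⁴ ∷ + 2 ℤ.* (d ℤ.* (d ℤ.* d)) ∷ + 2 ℤ.* (d ℤ.* d) ∷ d ℤ.- c′ ∷ []
        v≈ : v ≈ E ⊕ X ⊗ (D ⊗ (D ⊗ (D ⊗ D)) ⊕ X ⊗ (const (+ 2) ⊗ (D ⊗ (D ⊗ D)) ⊕ X ⊗ (const (+ 2) ⊗ (D ⊗ D) ⊕ X ⊗ (D ⊕ ⊝ C))))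
        v≈ = ≈-trans (≈horner v) (⊕-cong ≈-refl (⊗-congʳ X (⊕-cong (const-*≈ ≈-refl (const-*≈ ≈-refl (const-* d d)))
          (⊗-congʳ X (⊕-cong (const-*≈ ≈-refl (const-*≈ ≈-refl (const-* d d)))
          (⊗-congʳ X (⊕-cong (const-*≈ ≈-refl (const-* d d)) (⊗-congʳ X (const-+≈ ≈-refl (const-neg c′))))))))))
        const-e : D ⊗ (D ⊗ (D ⊗ (D ⊗ D))) ⊕ ⊝ D ≈ E ⊗ P
        const-e = ≈-trans (≈-sym (const-+≈ (const-*≈ ≈-refl (const-*≈ ≈-refl (const-*≈ ≈-refl (const-* d d)))) (const-neg d)))
          (≈-trans (const-≡ ee) (const-* e (+ 5)))
        open ZXSolver
        -- Ed stands for e p, which equals d⁵ - d.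
        expansion : ∀ Ed → X ⊗ X ⊗ X ⊗ X ⊗ X ⊕ C ⊗ const (+ 5) ⊗ X ⊗ X ⊗ X ⊗ X ⊕ D ≈
          (X ⊕ ⊝ (⊝ D)) ^ 5 ⊗ const 1ℤ ⊕ ⊝ (Ed ⊕ const (+ 5) ⊗ (X ⊗ (D ⊗ (D ⊗ (D ⊗ D)) ⊕ X ⊗ (const (+ 2) ⊗ (D ⊗ (D ⊗ D)) ⊕ X ⊗ (const (+ 2) ⊗ (D ⊗ D) ⊕ X ⊗ (D ⊕ ⊝ C))))))
            ⊕ (Ed ⊕ ⊝ (D ⊗ (D ⊗ (D ⊗ (D ⊗ D))) ⊕ ⊝ D))
        expansion Ed = solve 4 (λ x c d u → x :* x :* x :* x :* x :+ c :* con (+ 5) :* x :* x :* x :* x :+ d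
            := (x :- (:- d)) :^ 5 :* con 1ℤ :- (u :+ con (+ 5) :* (x :* (d :* (d :* (d :* d)) :+ x :* (con (+ 2) :* (d :* (d :* d)) :+ x :* (con (+ 2) :* (d :* d) :+ x :* (d :- c))))))
               :+ (u :- (d :* (d :* (d :* (d :* d))) :- d))) ≈-refl X C D Ed
        g≈ : g ≈ (X- (ℤ.- d)) ^ 5 ⊗ const 1ℤ ⊕ ⊝ (P ⊗ v)
        g≈ = begin
          g  ≈⟨ quintic≈ c d (≈-trans (const-≡ ec) (const-* c′ (+ 5))) ≈-refl ⟩
          X ⊗ X ⊗ X ⊗ X ⊗ X ⊕ C ⊗ P ⊗ X ⊗ X ⊗ X ⊗ X ⊕ D ≈⟨ expansion (P ⊗ E) ⟩
          (X ⊕ ⊝ (⊝ D)) ^ 5 ⊗ const 1ℤ ⊕ ⊝ (P ⊗ E ⊕ P ⊗ (X ⊗ h)) ⊕ (P ⊗ E ⊕ ⊝ (D ⊗ (D ⊗ (D ⊗ (D ⊗ D))) ⊕ ⊝ D))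
            ≈⟨ ⊕-cong (⊕-cong (⊗-cong (^-congˡ 5 (⊕-cong (≈-refl {X}) (⊝-cong (≈-sym (const-neg d))))) (≈-refl {const 1ℤ}))
                 (⊝-cong (≈-trans (≈-sym (⊗-distribˡ P E (X ⊗ h))) (⊗-congʳ P (≈-sym v≈)))))
                 (≈-trans (⊕-cong (⊗-comm P E) (⊝-cong const-e)) (⊝-inverseʳ (E ⊗ P))) ⟩
          (X- (ℤ.- d)) ^ 5 ⊗ const 1ℤ ⊕ ⊝ (P ⊗ v) ⊕ []  ≈⟨ ⊕-identityʳ _ ⟩
          (X- (ℤ.- d)) ^ 5 ⊗ const 1ℤ ⊕ ⊝ (P ⊗ v) ∎
          where
          open ≈-Reasoning
          h : ℤ[X]
          h = D ⊗ (D ⊗ (D ⊗ D)) ⊕ X ⊗ (const (+ 2) ⊗ (D ⊗ (D ⊗ D)) ⊕ X ⊗ (const (+ 2) ⊗ (D ⊗ D) ⊕ X ⊗ (D ⊕ ⊝ C)))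
        v⟪⟫ : v ⟪ ℤ.- d ⟫ ≡ e ℤ.- c′ ℤ.* d⁴
        v⟪⟫ = ℤS.solve 3 (λ e c d → let d⁴ = d ℤS.:* (d ℤS.:* (d ℤS.:* d)) in
          e ℤS.:+ (ℤS.:- d) ℤS.:* (d⁴ ℤS.:+ (ℤS.:- d) ℤS.:* (ℤS.con (+ 2) ℤS.:* (d ℤS.:* (d ℤS.:* d)) ℤS.:+ (ℤS.:- d) ℤS.:* (ℤS.con (+ 2) ℤS.:* (d ℤS.:* d) ℤS.:+ (ℤS.:- d) ℤS.:* ((d ℤS.:- c) ℤS.:+ (ℤS.:- d) ℤS.:* ℤS.con 0ℤ))))
          ℤS.:= e ℤS.:- c ℤS.:* d⁴) ≡.refl e c′ d

  module DoubleRoot {p : ℕ} (p-prime : Prime p) (c d : ℤ) where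
    open PrimeModulus p-prime
    private g = quintic c d
    open Maximality p-prime g (quintic-monic c d)
    open Cases p-prime c d using (PMaximal; ∤*; ∤neg)

    opaque
      -- With c = -5t modulo p², the double root of g modulo p is 4t.
      case-double : ∀ t k n → c ≡ ℤ.- (+ 5 ℤ.* t) ℤ.+ + p ℤ.* (+ p ℤ.* k) →
        d ≡ + 256 ℤ.* (t ℤ.* (t ℤ.* (t ℤ.* (t ℤ.* t)))) ℤ.+ + p ℤ.* n →
        ¬ + p ∣ n → ¬ + p ∣ t → ¬ + p ∣ + 2 → ¬ + p ∣ + 5 → PMaximal
      case-double t k n ec ed p∤n p∤t p∤2 p∤5 = Ramified.ramified⇒maximal 1 r w v g≈ p∤w p∤v
          (Separable.separable⇒reduced w w-monic V (+ 320 ℤ.* t⁴) (∤* (+ 320) t⁴ (∤* (+ 64) (+ 5) p∤64 p∤5) p∤t⁴) separable)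
        where
        r t³ t⁴ : ℤ
        r = + 4 ℤ.* t
        t³ = t ℤ.* (t ℤ.* t)
        t⁴ = t ℤ.* (t ℤ.* (t ℤ.* t))
        w v V T K N : ℤ[X]
        -- The quotient of x⁵ - 5t x⁴ + 256 t⁵ by (x - 4t)².
        w = + 16 ℤ.* t³ ∷ + 8 ℤ.* (t ℤ.* t) ∷ + 3 ℤ.* t ∷ 1ℤ ∷ []
        v = ℤ.- n ∷ 0ℤ ∷ 0ℤ ∷ 0ℤ ∷ ℤ.- (+ p ℤ.* k) ∷ []
        -- Bezout cofactor: V w' = 9 (x - 2t) w + 320 t⁴, a unit modulo w as long as p divides none
        -- of 2, 5 and t.
        V = const (+ 4) ⊗ T ⊗ T ⊕ ⊝ (const (+ 3) ⊗ T ⊗ X) ⊕ const (+ 3) ⊗ X ⊗ X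
        T = const t
        K = const k
        N = const n
        p∤t³ : ¬ + p ∣ t³
        p∤t³ = ∤* t (t ℤ.* t) p∤t (∤* t t p∤t p∤t)
        p∤t⁴ : ¬ + p ∣ t⁴
        p∤t⁴ = ∤* t t³ p∤t p∤t³
        p∤32 : ¬ + p ∣ + 32
        p∤32 = ∤* (+ 2) (+ 16) p∤2 (∤* (+ 2) (+ 8) p∤2 (∤* (+ 2) (+ 4) p∤2 (∤* (+ 2) (+ 2) p∤2 p∤2)))
        p∤64 : ¬ + p ∣ + 64
        p∤64 = ∤* (+ 2) (+ 32) p∤2 p∤32
        w≈ : w ≈ const (+ 16) ⊗ (T ⊗ (T ⊗ T)) ⊕ X ⊗ (const (+ 8) ⊗ (T ⊗ T) ⊕ X ⊗ (const (+ 3) ⊗ T ⊕ X ⊗ const 1ℤ))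
        w≈ = ≈-trans (≈horner w) (⊕-cong (const-*≈ ≈-refl (const-*≈ ≈-refl (const-* t t))) (⊗-congʳ X
          (⊕-cong (const-*≈ ≈-refl (const-* t t)) (⊗-congʳ X (⊕-cong (const-* (+ 3) t) ≈-refl)))))
        w-monic : Monic 3 w
        w-monic = ≡.refl , DegLt-length w
        v≈ : v ≈ ⊝ N ⊕ X ⊗ (const 0ℤ ⊕ X ⊗ (const 0ℤ ⊕ X ⊗ (const 0ℤ ⊕ X ⊗ ⊝ (P ⊗ K))))
        v≈ = ≈-trans (≈horner v) (⊕-cong (const-neg n) (⊗-congʳ X (⊕-cong ≈-refl (⊗-congʳ X (⊕-cong ≈-refl (⊗-congʳ X (⊕-cong ≈-refl (⊗-congʳ X (const-neg≈ (const-* (+ p) k))))))))))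
        g≈ : g ≈ (X- r) ^ 2 ⊗ w ⊕ ⊝ (P ⊗ v)
        g≈ = begin
          g ≈⟨ quintic≈ c d (≈-trans (const-≡ ec) (const-+≈ (const-neg≈ (const-* (+ 5) t)) (const-*≈ ≈-refl (const-* (+ p) k))))
                 (≈-trans (const-≡ ed) (const-+≈ (const-*≈ ≈-refl (const-*≈ ≈-refl (const-*≈ ≈-refl (const-*≈ ≈-refl (const-* t t))))) (const-* (+ p) n))) ⟩
          _ ≈⟨ solve 5 (λ x t P k n → x :* x :* x :* x :* x :+ (:- (con (+ 5) :* t) :+ P :* (P :* k)) :* x :* x :* x :* x :+ (con (+ 256) :* (t :* (t :* (t :* (t :* t)))) :+ P :* n)
                 := (x :- con (+ 4) :* t) :^ 2 :* (con (+ 16) :* (t :* (t :* t)) :+ x :* (con (+ 8) :* (t :* t) :+ x :* (con (+ 3) :* t :+ x :* con 1ℤ)))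
                    :- P :* (:- n :+ x :* (con 0ℤ :+ x :* (con 0ℤ :+ x :* (con 0ℤ :+ x :* (:- (P :* k))))))) ≈-refl X T P K N ⟩
          _ ≈⟨ ⊕-cong (⊗-cong (^-congˡ 2 (⊕-cong (≈-refl {X}) (⊝-cong (≈-sym (const-* (+ 4) t))))) (≈-sym w≈)) (⊝-cong (⊗-congʳ P (≈-sym v≈))) ⟩
          (X- r) ^ 2 ⊗ w ⊕ ⊝ (P ⊗ v) ∎
          where
          open ≈-Reasoning
          open ZXSolver
        p∤w : ¬ + p ∣ w ⟪ r ⟫
        p∤w = ∤* (+ 160) t³ (∤* (+ 32) (+ 5) p∤32 p∤5) p∤t³ ∘ subst (+ p ∣_) (solve 1 (λ t → con (+ 16) :* (t :* (t :* t)) :+ con (+ 4) :* t :* (con (+ 8) :* (t :* t) :+ con (+ 4) :* t :* (con (+ 3) :* t :+ con (+ 4) :* t :* (con 1ℤ :+ con (+ 4) :* t :* con 0ℤ)))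
            := con (+ 160) :* (t :* (t :* t))) ≡.refl t)
          where open ℤS
        -- The part p² k x⁴ of g puts only a multiple of p into v, so v(r) ≡ -n modulo p. This is
        -- what knowing c modulo p² achieves.
        p∤v : ¬ + p ∣ v ⟪ r ⟫
        p∤v h = ∤neg n p∤n (∣m+n∣n⇒∣m (subst (+ p ∣_) (solve 4 (λ n r p k → :- n :+ r :* (con 0ℤ :+ r :* (con 0ℤ :+ r :* (con 0ℤ :+ r :* (:- (p :* k) :+ r :* con 0ℤ))))
            := :- n :+ :- (r :* (r :* (r :* (r :* k)))) :* p) ≡.refl n r (+ p) k) h)
          (divides (ℤ.- (r ℤ.* (r ℤ.* (r ℤ.* (r ℤ.* k))))) ≡.refl))
          where open ℤS
        ∂w≈ : ∂ w ≈ const (+ 8) ⊗ (T ⊗ T) ⊕ X ⊗ (const (+ 2) ⊗ (const (+ 3) ⊗ T) ⊕ X ⊗ const (+ 3))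
        ∂w≈ = ≈-trans {g = + 8 ℤ.* (t ℤ.* t) ∷ + 2 ℤ.* (+ 3 ℤ.* t) ∷ + 3 ∷ []}
          (ext λ { 0 → ≡.trans (coeff-∂ w 0) (ℤₚ.*-identityˡ _) ; 1 → coeff-∂ w 1 ; 2 → coeff-∂ w 2
                 ; (suc (suc (suc i))) → ≡.trans (coeff-∂ w (3 ℕ.+ i)) (ℤₚ.*-zeroʳ (+ (4 ℕ.+ i))) })
          (≈-trans (≈horner _) (⊕-cong (const-*≈ ≈-refl (const-* t t)) (⊗-congʳ X (⊕-cong (const-*≈ ≈-refl (const-* (+ 3) t)) ≈-refl))))
        separable : V ⊗ ∂ w ∼ const (+ 320 ℤ.* t⁴) mod⟨ P , w ⟩
        separable = ∼-trans (≈⇒∼ (≈-trans (⊗-congʳ V ∂w≈) (≈-trans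
          (solve 2 (λ x t → (con (+ 4) :* t :* t :- con (+ 3) :* t :* x :+ con (+ 3) :* x :* x) :* (con (+ 8) :* (t :* t) :+ x :* (con (+ 2) :* (con (+ 3) :* t) :+ x :* con (+ 3)))
              := (con (+ 16) :* (t :* (t :* t)) :+ x :* (con (+ 8) :* (t :* t) :+ x :* (con (+ 3) :* t :+ x :* con 1ℤ))) :* (con (+ 9) :* x :- con (+ 18) :* t) :+ con (+ 320) :* (t :* (t :* (t :* t)))) ≈-refl X T)
          (⊕-cong (⊗-cong (≈-sym w≈) (≈-refl {const (+ 9) ⊗ X ⊕ ⊝ (const (+ 18) ⊗ T)})) (≈-sym (const-*≈ ≈-refl (const-*≈ ≈-refl (const-*≈ ≈-refl (const-* t t)))))))))
          (∼-trans (∼-⊕ (∼0ʳ _) (∼-refl {f = const (+ 320 ℤ.* t⁴)})) (≈⇒∼ (⊕-identityˡ _)))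
          where open ZXSolver

  -- Fifth powers, the discriminant factor and g(-d)

  _⁵ : ℤ → ℤ
  a ⁵ = a ℤ.* (a ℤ.* (a ℤ.* (a ℤ.* a)))

  -- The polynomial (a⁵ - b⁵)/(a - b).
  ⁵-quotient : ℤ → ℤ → ℤ
  ⁵-quotient b a = a ℤ.* a ℤ.* a ℤ.* a ℤ.+ a ℤ.* a ℤ.* a ℤ.* b ℤ.+ a ℤ.* a ℤ.* b ℤ.* b ℤ.+ a ℤ.* b ℤ.* b ℤ.* b ℤ.+ b ℤ.* b ℤ.* b ℤ.* b

  opaque
    ⁵-difference : ∀ b a z → a ≡ b ℤ.+ z → a ⁵ ≡ b ⁵ ℤ.+ z ℤ.* ⁵-quotient b a
    ⁵-difference b a z e = ≡.trans
      (solve 2 (λ a b → a :* (a :* (a :* (a :* a))) := b :* (b :* (b :* (b :* b))) :+ (a :- b) :* (a :* a :* a :* a :+ a :* a :* a :* b :+ a :* a :* b :* b :+ a :* b :* b :* b :+ b :* b :* b :* b)) ≡.refl a b)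
      (cong (λ x → b ⁵ ℤ.+ x ℤ.* ⁵-quotient b a) (≡.trans (cong (ℤ._- b) e) (solve 2 (λ b z → b :+ z :- b := z) ≡.refl b z)))
      where open ℤS

    -- For z = 0 only 5⁵ (d - 2⁸ t⁵) remains, and d - 2⁸ t⁵ is then g(4t). So for p² ∣ z and p ≠ 5,
    -- divisibility of `disc c d` by p or p² is that of d - 2⁸ t⁵.
    disc-split : ∀ c d t z → c ≡ ℤ.- (+ 5 ℤ.* t) ℤ.+ z →
      disc c d ≡ + 3125 ℤ.* (d ℤ.- + 256 ℤ.* t ⁵) ℤ.+ + 256 ℤ.* (z ℤ.* ⁵-quotient (ℤ.- (+ 5 ℤ.* t)) c)
    disc-split c d t z e = rearrange (⁵-difference (ℤ.- (+ 5 ℤ.* t)) c z e) (⁵-scale t)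
      where
      open ℤS
      ⁵-scale : ∀ t → (ℤ.- (+ 5 ℤ.* t)) ⁵ ≡ ℤ.- (+ 3125 ℤ.* t ⁵)
      ⁵-scale = solve 1 (λ t → let b = :- (con (+ 5) :* t) in b :* (b :* (b :* (b :* b))) := :- (con (+ 3125) :* (t :* (t :* (t :* (t :* t)))))) ≡.refl
      rearrange : ∀ {c⁵ b⁵ t⁵ x} → c⁵ ≡ b⁵ ℤ.+ x → b⁵ ≡ ℤ.- (+ 3125 ℤ.* t⁵) →
        + 3125 ℤ.* d ℤ.+ + 256 ℤ.* c⁵ ≡ + 3125 ℤ.* (d ℤ.- + 256 ℤ.* t⁵) ℤ.+ + 256 ℤ.* x
      rearrange {t⁵ = t⁵} {x} ≡.refl ≡.refl = solve 3 (λ d t⁵ x → con (+ 3125) :* d :+ con (+ 256) :* (:- (con (+ 3125) :* t⁵) :+ x)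
        := con (+ 3125) :* (d :- con (+ 256) :* t⁵) :+ con (+ 256) :* x) ≡.refl d t⁵ x

  -- -g(-d)
  residue : ℤ → ℤ → ℤ
  residue c d = d ⁵ ℤ.- d ℤ.- c ℤ.* (d ℤ.* (d ℤ.* (d ℤ.* d)))

  n∣m*n : ∀ m n → n ∣ m ℤ.* n
  n∣m*n m n = divides m ≡.refl

  opaque
    5∣a⁵-a : ∀ a → + 5 ∣ a ⁵ ℤ.- a
    5∣a⁵-a a = subst (λ a → + 5 ∣ a ⁵ ℤ.- a) (≡.sym (a≡a%ℕn+[a/ℕn]*n a 5)) (residues (a %ℕ 5) (n%ℕd<d a 5))
      where
      shift : ∀ ρ q m → ρ ⁵ ℤ.- ρ ≡ m ℤ.* + 5 → + 5 ∣ (ρ ℤ.+ q ℤ.* + 5) ⁵ ℤ.- (ρ ℤ.+ q ℤ.* + 5)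
      shift ρ q m e = subst (+ 5 ∣_)
        (≡.sym (≡.trans (cong (ℤ._- (ρ ℤ.+ q ℤ.* + 5)) (⁵-difference ρ (ρ ℤ.+ q ℤ.* + 5) (q ℤ.* + 5) ≡.refl))
          (regroup (ρ ⁵) ρ (⁵-quotient ρ (ρ ℤ.+ q ℤ.* + 5)) q)))
        (∣m∣n⇒∣m+n (divides m e) (n∣m*n (⁵-quotient ρ (ρ ℤ.+ q ℤ.* + 5) ℤ.* q ℤ.- q) (+ 5)))
        where
        regroup : ∀ r ρ Q q → (r ℤ.+ q ℤ.* + 5 ℤ.* Q) ℤ.- (ρ ℤ.+ q ℤ.* + 5) ≡ (r ℤ.- ρ) ℤ.+ (Q ℤ.* q ℤ.- q) ℤ.* + 5
        regroup = solve 4 (λ r ρ Q q → (r :+ q :* con (+ 5) :* Q) :- (ρ :+ q :* con (+ 5)) := (r :- ρ) :+ (Q :* q :- q) :* con (+ 5)) ≡.refl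
          where open ℤS
      residues : ∀ ρ → ρ ℕ.< 5 → + 5 ∣ (+ ρ ℤ.+ (a /ℕ 5) ℤ.* + 5) ⁵ ℤ.- (+ ρ ℤ.+ (a /ℕ 5) ℤ.* + 5)
      -- The last number is (ρ⁵ - ρ)/5.
      residues 0 _ = shift (+ 0) (a /ℕ 5) (+ 0) ≡.refl
      residues 1 _ = shift (+ 1) (a /ℕ 5) (+ 0) ≡.refl
      residues 2 _ = shift (+ 2) (a /ℕ 5) (+ 6) ≡.refl
      residues 3 _ = shift (+ 3) (a /ℕ 5) (+ 48) ≡.refl
      residues 4 _ = shift (+ 4) (a /ℕ 5) (+ 204) ≡.refl
      residues (suc (suc (suc (suc (suc _))))) (s≤s (s≤s (s≤s (s≤s (s≤s ())))))

  -- The case distinction at each prime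

  module Local (c d : ℤ)
    (squarefree : ∀ {p} → Prime p → ¬ + p ℤ.* + p ∣ d)
    (residue-5 : + 5 ∣ c → ¬ + 5 ∣ d → ¬ + 25 ∣ residue c d)
    (disc-p² : ∀ {p} → Prime p → ¬ + p ∣ + 5 → ¬ + p ∣ d → ¬ + p ℤ.* + p ∣ disc c d)
    where

    opaque
      -- From 5 ∣ disc follows 5 ∣ 2⁸ c⁵, so 5 ∣ c. Then e - c′ d⁴ is a fifth of `residue c d`,
      -- which `residue-5` keeps from being divisible by 25.
      maximal-5 : ¬ + 5 ∣ d → + 5 ∣ disc c d → Cases.PMaximal 5-prime c d
      maximal-5 5∤d 5∣disc = with-c′ 5∣c (5∣a⁵-a d)
        where
        open PrimeModulus 5-prime
        5∣c : + 5 ∣ c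
        5∣c = [ (λ h → contradiction (∣⇒∣ᵤ h) (from-no (5 ℕ∣.∣? 256))) , (λ h → ∣^⇒∣ c 5 (subst (+ 5 ∣_) (solve 1 (λ c → c :* (c :* (c :* (c :* c))) := c :* (c :* (c :* (c :* (c :* con 1ℤ))))) ≡.refl c) h)) ]′
          (euclid (+ 256) (c ⁵) (∣m+n∣m⇒∣n 5∣disc (∣m⇒∣m*n {+ 5} {+ 3125} d (divides (+ 625) ≡.refl))))
          where
          open ℤS
        with-c′ : + 5 ∣ c → + 5 ∣ d ⁵ ℤ.- d → Cases.PMaximal 5-prime c d
        with-c′ (divides c′ ec) (divides e ee) = TotallyRamifiedAt5.case-5 c d c′ e ec ee λ { (divides q eq) → residue-5 5∣c 5∤d (divides q (begin
            d ⁵ ℤ.- d ℤ.- c ℤ.* d⁴                ≡⟨ cong₂ (λ x y → x ℤ.- y ℤ.* d⁴) ee ec ⟩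
            e ℤ.* + 5 ℤ.- c′ ℤ.* + 5 ℤ.* d⁴ ≡⟨ solve 3 (λ e c z → e :* con (+ 5) :- c :* con (+ 5) :* z := (e :- c :* z) :* con (+ 5)) ≡.refl e c′ d⁴ ⟩
            (e ℤ.- c′ ℤ.* d⁴) ℤ.* + 5             ≡⟨ cong (ℤ._* + 5) eq ⟩
            q ℤ.* + 5 ℤ.* + 5                     ≡⟨ ℤₚ.*-assoc q (+ 5) (+ 5) ⟩
            q ℤ.* + 25                            ∎)) }
          where
          open ≡-Reasoning
          open ℤS
          d⁴ : ℤ
          d⁴ = d ℤ.* (d ℤ.* (d ℤ.* d))

      maximal-double : ∀ {p} (p-prime : Prime p) → p ≡.≢ 5 → ¬ + p ∣ d → + p ∣ disc c d → Cases.PMaximal p-prime c d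
      maximal-double {p} p-prime p≢5 p∤d p∣disc = with-5⁻¹ (inverse (+ 5) p∤5)
        where
        open PrimeModulus p-prime
        open Cases p-prime c d using (∤*)
        open ℤS
        p∤5 : ¬ + p ∣ + 5
        p∤5 h = [ (λ e → ¬prime[1] (subst Prime e p-prime)) , p≢5 ]′ (prime⇒irreducible 5-prime (∣⇒∣ᵤ h))
        p∤3125 : ¬ + p ∣ + 3125
        p∤3125 = ∤* (+ 5) (+ 625) p∤5 (∤* (+ 5) (+ 125) p∤5 (∤* (+ 5) (+ 25) p∤5 (∤* (+ 5) (+ 5) p∤5 p∤5)))
        p∤256c⁵ : ¬ + p ∣ + 256 ℤ.* c ⁵
        p∤256c⁵ h = ∤* (+ 3125) d p∤3125 p∤d (∣m+n∣n⇒∣m p∣disc h)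
        -- If p = 2, then p divides 2⁸ c⁵ and therefore 5⁵ d, which is excluded.
        p∤2 : ¬ + p ∣ + 2
        p∤2 h = p∤256c⁵ (∣m⇒∣m*n {+ p} {+ 256} (c ⁵) (∣n⇒∣m*n (+ 128) h))
        p∤c : ¬ + p ∣ c
        p∤c h = p∤256c⁵ (∣n⇒∣m*n (+ 256) (∣m⇒∣m*n (c ℤ.* (c ℤ.* (c ℤ.* c))) h))
        with-5⁻¹ : (∃₂ λ s u → s ℤ.* + 5 ℤ.+ u ℤ.* + p ≡ 1ℤ) → Cases.PMaximal p-prime c d
        with-5⁻¹ (s , u , e) = with-n (cancel-3125 (+ p) (subst (+ p ∣_) disc≡ p∣disc) (divides 1ℤ (≡.sym (ℤₚ.*-identityˡ (+ p)))))
          where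
          t k y Q : ℤ
          -- Squaring 5 s + u p = 1 gives 5 (5 s² + 2 s u p) + u² p² = 1: an inverse of 5 modulo p²,
          -- together with the exact error term k.
          t = ℤ.- ((+ 5 ℤ.* s ℤ.* s ℤ.+ + 2 ℤ.* s ℤ.* u ℤ.* + p) ℤ.* c)
          k = u ℤ.* u ℤ.* c
          y = d ℤ.- + 256 ℤ.* t ⁵
          Q = ⁵-quotient (ℤ.- (+ 5 ℤ.* t)) c
          c≡ : c ≡ ℤ.- (+ 5 ℤ.* t) ℤ.+ + p ℤ.* (+ p ℤ.* k)
          c≡ = begin
            c                                            ≡⟨ solve 1 (λ c → c := con 1ℤ :* con 1ℤ :* c) ≡.refl c ⟩
            1ℤ ℤ.* 1ℤ ℤ.* c                              ≡⟨ cong (λ z → z ℤ.* z ℤ.* c) (≡.sym e) ⟩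
            (s ℤ.* + 5 ℤ.+ u ℤ.* + p) ℤ.* (s ℤ.* + 5 ℤ.+ u ℤ.* + p) ℤ.* c ≡⟨ solve 4 (λ s u p c → (s :* con (+ 5) :+ u :* p) :* (s :* con (+ 5) :+ u :* p) :* c
                 := :- (con (+ 5) :* (:- ((con (+ 5) :* s :* s :+ con (+ 2) :* s :* u :* p) :* c))) :+ p :* (p :* (u :* u :* c))) ≡.refl s u (+ p) c ⟩
            ℤ.- (+ 5 ℤ.* t) ℤ.+ + p ℤ.* (+ p ℤ.* k)      ∎
            where open ≡-Reasoning
          disc≡ : disc c d ≡ + 3125 ℤ.* y ℤ.+ (+ 256 ℤ.* (k ℤ.* Q) ℤ.* + p) ℤ.* + p
          disc≡ = ≡.trans (disc-split c d t (+ p ℤ.* (+ p ℤ.* k)) c≡) (cong (λ z → + 3125 ℤ.* y ℤ.+ z)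
            (solve 3 (λ p k q → con (+ 256) :* (p :* (p :* k) :* q) := (con (+ 256) :* (k :* q) :* p) :* p) ≡.refl (+ p) k Q))
          cancel-3125 : ∀ m → m ∣ + 3125 ℤ.* y ℤ.+ (+ 256 ℤ.* (k ℤ.* Q) ℤ.* + p) ℤ.* + p → + p ∣ m → + p ∣ y
          cancel-3125 m h p∣m = [ (λ x → contradiction x p∤3125) , (λ x → x) ]′ (euclid (+ 3125) y (∣m+n∣n⇒∣m {m = + 3125 ℤ.* y} {n = (+ 256 ℤ.* (k ℤ.* Q) ℤ.* + p) ℤ.* + p} (∣-trans p∣m h) (n∣m*n (+ 256 ℤ.* (k ℤ.* Q) ℤ.* + p) (+ p))))
          with-n : + p ∣ y → Cases.PMaximal p-prime c d
          with-n (divides n en) = DoubleRoot.case-double p-prime c d t k n c≡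
              (≡.trans (solve 2 (λ d x → d := x :+ (d :- x)) ≡.refl d (+ 256 ℤ.* t ⁵)) (cong (λ z → + 256 ℤ.* t ⁵ ℤ.+ z) (≡.trans en (ℤₚ.*-comm n (+ p)))))
              p∤n p∤t p∤2 p∤5
            where
            p∤t : ¬ + p ∣ t
            p∤t h = p∤c (subst (+ p ∣_) (≡.sym c≡) (∣m∣n⇒∣m+n (∣m⇒∣-m (∣n⇒∣m*n (+ 5) h)) (∣m⇒∣m*n (+ p ℤ.* k) (divides 1ℤ (≡.sym (ℤₚ.*-identityˡ (+ p)))))))
            -- If p ∣ n, then p² divides d - 2⁸ t⁵ and with it the whole of `disc c d`.
            p∤n : ¬ + p ∣ n
            p∤n (divides q eq) = disc-p² p-prime p∤5 p∤d (divides (+ 3125 ℤ.* q ℤ.+ + 256 ℤ.* (k ℤ.* Q)) (≡.trans disc≡ (≡.trans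
              (cong (λ z → + 3125 ℤ.* z ℤ.+ (+ 256 ℤ.* (k ℤ.* Q) ℤ.* + p) ℤ.* + p) (≡.trans en (cong (ℤ._* + p) eq)))
              (solve 3 (λ q p z → con (+ 3125) :* (q :* p :* p) :+ (con (+ 256) :* z :* p) :* p := (con (+ 3125) :* q :+ con (+ 256) :* z) :* (p :* p)) ≡.refl q (+ p) (k ℤ.* Q)))))

    maximal : ∀ {p} (p-prime : Prime p) → Cases.PMaximal p-prime c d
    maximal {p} p-prime with + p ∣? d
    ... | yes p∣d with + p ∣? c
    ...   | yes p∣c = Cases.case-p∣c p-prime c d p∣d (squarefree p-prime) p∣c
    ...   | no  p∤c = Cases.case-p∤c p-prime c d p∣d (squarefree p-prime) p∤c
    maximal {p} p-prime | no p∤d with + p ∣? disc c d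
    ...   | no  p∤disc = Cases.case-separable p-prime c d p∤d p∤disc
    ...   | yes p∣disc = ramified (p ℕₚ.≟ 5)
      where
      ramified : Dec (p ≡ 5) → Cases.PMaximal p-prime c d
      ramified (no p≢5)     = maximal-double p-prime p≢5 p∤d p∣disc
      ramified (yes ≡.refl) = maximal-5 p∤d p∣disc

  open import Data.Fin as Fin using (Fin; zero; suc; fromℕ)
  open import Data.Fin.Properties using (suc-injective)
  open import Data.List.Relation.Unary.All using (All; []; _∷_)
  open import Data.Nat.ListAction using (product)
  open import Data.Nat.Primality.Factorisation using (factorise; PrimeFactorisation)

  -- Integrality by division-free elimination

  opaque
    -- `IsAlgInt` asks for a list ending in 1, while a monic polynomial may carry trailing zeros.
    Monic⇒++[1] : ∀ m f → Monic m f → ∃ λ cs → f ≈ cs ++ 1ℤ ∷ []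
    Monic⇒++[1] m       []      (() , _)
    Monic⇒++[1] zero    (a ∷ f) (top , deg) = [] , ∷-cong top (DegLt-0 f (DegLt-tail {a = a} {f} deg))
    Monic⇒++[1] (suc m) (a ∷ f) (top , deg) = let (cs , e) = Monic⇒++[1] m f (top , DegLt-tail {a = a} {f} deg) in
      a ∷ cs , ∷-cong ≡.refl e

    ++[1]⇒Monic : ∀ cs → Monic (length cs) (cs ++ 1ℤ ∷ [])
    ++[1]⇒Monic []       = Monic-1
    ++[1]⇒Monic (a ∷ cs) = proj₁ (++[1]⇒Monic cs) , λ { (suc i) (s≤s n≤i) → proj₂ (++[1]⇒Monic cs) i n≤i }

  module Elimination {ℓ₁ ℓ₂} (R : CommutativeRing ℓ₁ ℓ₂)
    (ι : ℤ.+-*-rawRing -Raw-AlmostCommutative⟶ fromCommutativeRing R)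
    (α : CommutativeRing.Carrier R) where

    open CommutativeRing R hiding (zero) renaming (_≈_ to _≋_)
    open Evaluation R ι α
    open import Algebra.Properties.Semiring.Sum semiring using (sum; *-distribˡ-sum; ∑-distrib-+; sum-cong-≋; sum-replicate-zero)
    open import Relation.Binary.Reasoning.Setoid setoid
    open import Algebra.Properties.Ring ring using (-‿distribˡ-*; -‿distribʳ-*)

    Matrix : ℕ → Set
    Matrix n = Fin n → Fin n → ℤ[X]

    _⟨_⟩ : ∀ {n} → Matrix n → (Fin n → Carrier) → Fin n → Carrier
    (N ⟨ e ⟩) i = sum (λ j → ev (N i j) * e j)

    -- The shape of q I - A for a monic q of degree k > 0 and an integer matrix A, chosen so as to
    -- survive elimination.
    DiagonallyMonic : ∀ {n} → ℕ → Matrix n → Set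
    DiagonallyMonic k N = (∀ i → Monic k (N i i)) × (∀ i j → i ≡.≢ j → DegLt k (N i j))

    -- Clears the first column by cross-multiplication with the corner entry, so nothing is divided.
    reduce : ∀ {n} → Matrix (suc n) → Matrix n
    reduce N i j = N zero zero ⊗ N (suc i) (suc j) ⊕ ⊝ (N (suc i) zero ⊗ N zero (suc j))

    opaque
      -- A new diagonal entry is a product of two monic polynomials of degree k, corrected by a
      -- product of two off-diagonal ones, each of degree below k.
      reduce-monic : ∀ {n} k (N : Matrix (suc n)) → DiagonallyMonic k N → DiagonallyMonic (k ℕ.+ k) (reduce N)
      reduce-monic k N (diag , off) =
        (λ i → Monic-⊕ (N zero zero ⊗ N (suc i) (suc i)) (⊝ (N (suc i) zero ⊗ N zero (suc i)))
          (Monic-⊗ (N zero zero) (N (suc i) (suc i)) (diag zero) (diag (suc i))) (corner i i)) ,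
        (λ i j i≢j → DegLt-⊕ (N zero zero ⊗ N (suc i) (suc j)) (⊝ (N (suc i) zero ⊗ N zero (suc j)))
          (DegLt-⊗ (N zero zero) (N (suc i) (suc j)) (proj₂ (diag zero)) (off (suc i) (suc j) λ e → i≢j (suc-injective e))) (corner i j))
        where
        corner : ∀ i j → DegLt (k ℕ.+ k) (⊝ (N (suc i) zero ⊗ N zero (suc j)))
        corner i j = DegLt-⊝ (N (suc i) zero ⊗ N zero (suc j)) (DegLt-⊗ (N (suc i) zero) (N zero (suc j))
          (DegLt-weaken {f = N (suc i) zero} (ℕₚ.n≤1+n k) (off (suc i) zero λ ())) (off zero (suc j) λ ()))

      reduce-kernel : ∀ {n} (N : Matrix (suc n)) (e : Fin (suc n) → Carrier) → (∀ i → (N ⟨ e ⟩) i ≋ 0#) → ∀ i → (reduce N ⟨ (λ j → e (suc j)) ⟩) i ≋ 0#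
      reduce-kernel {n} N e Ne≋0 i = begin
        sum (λ j → ev (reduce N i j) * e (suc j))                                        ≈⟨ sum-cong-≋ term ⟩
        sum (λ j → a * x j + - (b * y j)) ≈⟨ ∑-distrib-+ (λ j → a * x j) (λ j → - (b * y j)) ⟩
        sum (λ j → a * x j) + sum (λ j → - (b * y j)) ≈⟨ +-cong (sym (*-distribˡ-sum a x)) (trans (sum-cong-≋ (λ j → -‿distribˡ-* b (y j))) (sym (*-distribˡ-sum (- b) y))) ⟩
        a * sum x + - b * sum y ≈⟨ +-cong (*-congˡ (isolate (Ne≋0 (suc i)))) (*-congˡ (isolate (Ne≋0 zero))) ⟩
        a * - (b * e₀) + - b * - (a * e₀) ≈⟨ +-cong (sym (-‿distribʳ-* a _)) (trans (sym (-‿distribˡ-* b _)) (-‿cong (sym (-‿distribʳ-* b _)))) ⟩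
        - (a * (b * e₀)) + - - (b * (a * e₀)) ≈⟨ +-congʳ (-‿cong (x∙yz≈y∙xz a b e₀)) ⟩
        - (b * (a * e₀)) + - - (b * (a * e₀))                                            ≈⟨ -‿inverseʳ _ ⟩
        0#                                                                               ∎
        where
        open import Algebra.Properties.CommutativeSemigroup *-commutativeSemigroup using (x∙yz≈y∙xz)
        open import Algebra.Properties.AbelianGroup +-abelianGroup using (inverseʳ-unique)
        a b e₀ : Carrier
        a = ev (N zero zero)
        b = ev (N (suc i) zero)
        e₀ = e zero
        x y : Fin n → Carrier
        x j = ev (N (suc i) (suc j)) * e (suc j)
        y j = ev (N zero (suc j)) * e (suc j)
        isolate : ∀ {u v} → u + v ≋ 0# → v ≋ - u
        isolate {u} {v} = inverseʳ-unique u v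
        term : ∀ j → ev (reduce N i j) * e (suc j) ≋ a * x j + - (b * y j)
        term j = begin
          ev (reduce N i j) * e (suc j)
            ≈⟨ *-congʳ (trans (ev-⊕ _ _) (+-cong (ev-⊗ _ _) (trans (ev-⊝ _) (-‿cong (ev-⊗ _ _))))) ⟩
          (a * ev (N (suc i) (suc j)) + - (b * ev (N zero (suc j)))) * e (suc j)
            ≈⟨ distribʳ _ _ _ ⟩
          a * ev (N (suc i) (suc j)) * e (suc j) + - (b * ev (N zero (suc j))) * e (suc j)
            ≈⟨ +-cong (*-assoc _ _ _) (trans (sym (-‿distribˡ-* _ _)) (-‿cong (*-assoc _ _ _))) ⟩
          a * x j + - (b * y j) ∎

      -- Every step drops the first coordinate and doubles k, leaving one monic relation for the
      -- last coordinate.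
      eliminate : ∀ n k (N : Matrix (suc n)) (e : Fin (suc n) → Carrier) → DiagonallyMonic k N → (∀ i → (N ⟨ e ⟩) i ≋ 0#) →
        ∃₂ λ m f → Monic m f × ev f * e (fromℕ n) ≋ 0#
      eliminate zero    k N e (diag , _) Ne≋0 = k , N zero zero , diag zero , trans (sym (+-identityʳ _)) (Ne≋0 zero)
      eliminate (suc n) k N e monic Ne≋0 =
        eliminate n (k ℕ.+ k) (reduce N) (λ j → e (suc j)) (reduce-monic k N monic) (reduce-kernel N e Ne≋0)

    scalar : ∀ {n} → ℤ[X] → Matrix n
    scalar q zero    zero    = q
    scalar q zero    (suc j) = []
    scalar q (suc i) zero    = []
    scalar q (suc i) (suc j) = scalar q i j

    scalar-diagonal : ∀ {n} q (i : Fin n) → scalar q i i ≡ q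
    scalar-diagonal q zero    = ≡.refl
    scalar-diagonal q (suc i) = scalar-diagonal q i

    scalar-off-diagonal : ∀ {n} q (i j : Fin n) → i ≡.≢ j → scalar q i j ≡ []
    scalar-off-diagonal q zero    zero    i≢j = contradiction ≡.refl i≢j
    scalar-off-diagonal q zero    (suc j) i≢j = ≡.refl
    scalar-off-diagonal q (suc i) zero    i≢j = ≡.refl
    scalar-off-diagonal q (suc i) (suc j) i≢j = scalar-off-diagonal q i j λ e → i≢j (cong suc e)

    opaque
      scalar-⟨⟩ : ∀ {n} q (e : Fin n → Carrier) (i : Fin n) → (scalar q ⟨ e ⟩) i ≋ ev q * e i
      scalar-⟨⟩ {suc n} q e zero = trans (+-congˡ (trans (sum-cong-≋ (λ j → zeroˡ (e (suc j)))) (sum-replicate-zero n))) (+-identityʳ _)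
      scalar-⟨⟩ {suc n} q e (suc i) = trans (+-cong (zeroˡ (e zero)) (scalar-⟨⟩ q (λ j → e (suc j)) i)) (+-identityˡ _)

      -- The Cayley-Hamilton argument applied to q I - A at α. Positive degree of q keeps the
      -- constants A i j below the diagonal entries.
      annihilator : ∀ {n k} q (e : Fin (suc n) → Carrier) (A : Fin (suc n) → Fin (suc n) → ℤ) → Monic (suc k) q →
        (∀ i → ev q * e i ≋ sum (λ j → ev (const (A i j)) * e j)) →
        ∃₂ λ m f → Monic m f × ev f * e (fromℕ n) ≋ 0#
      annihilator {n} {k} q e A q-monic stable = eliminate n (suc k) N e (diag , off) λ i → begin
        sum (λ j → ev (N i j) * e j) ≈⟨ sum-cong-≋ (λ j → trans (*-congʳ {e j} (trans (ev-⊕ (scalar q i j) (⊝ const (A i j))) (+-congˡ (ev-⊝ (const (A i j)))))) (trans (distribʳ _ _ _) (+-congˡ (trans (sym (-‿distribˡ-* _ _)) (sym (-1*x≈-x _)))))) ⟩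
        sum (λ j → ev (scalar q i j) * e j + - 1# * (ev (const (A i j)) * e j)) ≈⟨ ∑-distrib-+ (λ j → ev (scalar q i j) * e j) (λ j → - 1# * (ev (const (A i j)) * e j)) ⟩
        (scalar q ⟨ e ⟩) i + sum (λ j → - 1# * (ev (const (A i j)) * e j)) ≈⟨ +-cong (trans (scalar-⟨⟩ q e i) (stable i)) (trans (sym (*-distribˡ-sum (- 1#) (λ j → ev (const (A i j)) * e j))) (-1*x≈-x _)) ⟩
        sum (λ j → ev (const (A i j)) * e j) + - sum (λ j → ev (const (A i j)) * e j) ≈⟨ -‿inverseʳ _ ⟩
        0#                                                                     ∎
        where
        open import Algebra.Properties.Ring ring using (-1*x≈-x)
        N : Matrix (suc n)
        N i j = scalar q i j ⊕ ⊝ const (A i j)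
        small : ∀ i j → DegLt (suc k) (⊝ const (A i j))
        small i j = DegLt-weaken {f = ⊝ const (A i j)} (s≤s z≤n) (DegLt-⊝ (const (A i j)) (DegLt-const (A i j)))
        diag : ∀ i → Monic (suc k) (N i i)
        diag i = Monic-⊕ (scalar q i i) (⊝ const (A i i)) (subst (Monic (suc k)) (≡.sym (scalar-diagonal q i)) q-monic) (small i i)
        off : ∀ i j → i ≡.≢ j → DegLt (suc k) (N i j)
        off i j i≢j = DegLt-⊕ (scalar q i j) (⊝ const (A i j)) (subst (DegLt (suc k)) (≡.sym (scalar-off-diagonal q i j i≢j)) (λ _ _ → ≡.refl)) (small i j)

  opaque
    DegLt-5 : ∀ r → DegLt 5 r → r ≈ coeff r 0 ∷ coeff r 1 ∷ coeff r 2 ∷ coeff r 3 ∷ coeff r 4 ∷ []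
    DegLt-5 r dr = ext λ { 0 → ≡.refl ; 1 → ≡.refl ; 2 → ≡.refl ; 3 → ≡.refl ; 4 → ≡.refl
      ; (suc (suc (suc (suc (suc i))))) → dr (5 ℕ.+ i) (ℕₚ.m≤m+n 5 i) }

  -- The order ℤ[θ] in a commutative ring

  module PowerBasis {ℓ₁ ℓ₂} (R : CommutativeRing ℓ₁ ℓ₂)
    (ℤ⟶R : ℤ.+-*-rawRing -Raw-AlmostCommutative⟶ fromCommutativeRing R)
    (θ : CommutativeRing.Carrier R) (g : ℤ[X]) (g-monic : Monic 5 g) where

    open CommutativeRing R hiding (zero) renaming (_≈_ to _≋_)
    open _-Raw-AlmostCommutative⟶_ ℤ⟶R using (*-homo; 1-homo; 0-homo) renaming (⟦_⟧ to ι)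
    module Θ = Evaluation R ℤ⟶R θ
    module At = Evaluation R ℤ⟶R
    open import Algebra.Properties.Semiring.Exp semiring using () renaming (_^_ to _^ᴿ_; ^-congˡ to ^ᴿ-congˡ)
    open import Algebra.Properties.CommutativeSemiring.Exp commutativeSemiring using () renaming (^-distrib-* to ^ᴿ-distrib-*)
    open import Algebra.Properties.CommutativeSemigroup *-commutativeSemigroup using (interchange; x∙yz≈y∙xz)
    open import Relation.Binary.Reasoning.Setoid setoid

    ≡⇒≋ : ∀ {u v} → u ≡ v → u ≋ v
    ≡⇒≋ ≡.refl = refl

    Order : Carrier → Set _
    Order u = ∃ λ f → Θ.ev f ≋ u

    Integral : Carrier → Set _
    Integral α = ∃ λ cs → At.ev α (cs ++ 1ℤ ∷ []) ≋ 0#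

    Order-resp : ∀ {u v} → u ≋ v → Order u → Order v
    Order-resp e (f , e′) = f , trans e′ e

    Order-+ : ∀ {u v} → Order u → Order v → Order (u + v)
    Order-+ (f , e) (h , e′) = f ⊕ h , trans (Θ.ev-⊕ f h) (+-cong e e′)

    Order-* : ∀ {u v} → Order u → Order v → Order (u * v)
    Order-* (f , e) (h , e′) = f ⊗ h , trans (Θ.ev-⊗ f h) (*-cong e e′)

    Order-ι : ∀ a → Order (ι a)
    Order-ι a = const a , Θ.ev-const a

    module Relations (ev-g : Θ.ev g ≋ 0#) where

      opaque
        ∼⇒ev≋ : ∀ {f h} → f ∼ h mod⟨ [] , g ⟩ → Θ.ev f ≋ Θ.ev h
        ∼⇒ev≋ {f} {h} e = let (b , e′) = ∼-elim e in begin
          Θ.ev f                      ≈⟨ Θ.ev-cong e′ ⟩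
          Θ.ev (h ⊕ g ⊗ b)            ≈⟨ trans (Θ.ev-⊕ h (g ⊗ b)) (+-congˡ (trans (Θ.ev-⊗ g b) (*-congʳ ev-g))) ⟩
          Θ.ev h + 0# * Θ.ev b        ≈⟨ trans (+-congˡ (zeroˡ _)) (+-identityʳ _) ⟩
          Θ.ev h                      ∎

        remainder : ∀ f → ∃ λ r → f ∼ r mod⟨ [] , g ⟩ × DegLt 5 r
        remainder f = let (q , r , e , dr) = monic-divMod g g-monic f in
          r , ∼-by q (≈-trans e (⊕-comm (g ⊗ q) r)) , dr

        basis-expansion : ∀ r → DegLt 5 r → r ≈ const (coeff r 4) ⊗ X ^ 4 ⊕ (const (coeff r 3) ⊗ X ^ 3 ⊕ (const (coeff r 2) ⊗ X ^ 2 ⊕ (const (coeff r 1) ⊗ X ^ 1 ⊕ (const (coeff r 0) ⊗ X ^ 0 ⊕ const 0ℤ))))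
        basis-expansion r dr = ≈-trans (DegLt-5 r dr) (≈-trans (≈horner _)
          (solve 6 (λ x a0 a1 a2 a3 a4 → a0 :+ x :* (a1 :+ x :* (a2 :+ x :* (a3 :+ x :* a4)))
            := a4 :* x :^ 4 :+ (a3 :* x :^ 3 :+ (a2 :* x :^ 2 :+ (a1 :* x :^ 1 :+ (a0 :* x :^ 0 :+ con 0ℤ))))) ≈-refl
            X (const (coeff r 0)) (const (coeff r 1)) (const (coeff r 2)) (const (coeff r 3)) (const (coeff r 4))))
          where open ZXSolver

        -- Multiplication by q(α) maps the span of 1, θ, ..., θ⁴ into itself with an integer matrix,
        -- so `annihilator` yields a monic equation for α. The choice q = x treats the elements of
        -- ℤ[θ]; a quadratic q treats the enlargement A(θ)/k.
        order⇒integral : ∀ {k} q α → Monic (suc k) q → Order (At.ev α q) → Integral α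
        order⇒integral q α q-monic (γ , eγ) = with-annihilator (annihilator q e A q-monic stable)
          where
          open Elimination R ℤ⟶R α using (annihilator)
          open import Algebra.Properties.Semiring.Sum semiring using (sum)
          -- Descending powers put 1 = θ⁰ last, in the coordinate that elimination keeps.
          degree-of : Fin 5 → ℕ
          degree-of j = 4 ℕ.∸ Fin.toℕ j
          e : Fin 5 → Carrier
          e j = Θ.ev (X ^ degree-of j)
          row : Fin 5 → ℤ[X]
          row i = proj₁ (remainder (γ ⊗ X ^ degree-of i))
          A : Fin 5 → Fin 5 → ℤ
          A i j = coeff (row i) (degree-of j)
          term : ∀ i j → Θ.ev (const (A i j) ⊗ X ^ degree-of j) ≋ At.ev α (const (A i j)) * e j
          term i j = trans (Θ.ev-⊗ (const (A i j)) (X ^ degree-of j)) (*-congʳ (trans (Θ.ev-const (A i j)) (sym (At.ev-const α (A i j)))))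
          ev-sum : ∀ f0 f1 f2 f3 f4 → Θ.ev (f0 ⊕ (f1 ⊕ (f2 ⊕ (f3 ⊕ (f4 ⊕ const 0ℤ))))) ≋
            Θ.ev f0 + (Θ.ev f1 + (Θ.ev f2 + (Θ.ev f3 + (Θ.ev f4 + 0#))))
          ev-sum f0 f1 f2 f3 f4 =
            trans (Θ.ev-⊕ f0 _) (+-congˡ (trans (Θ.ev-⊕ f1 _) (+-congˡ (trans (Θ.ev-⊕ f2 _) (+-congˡ
            (trans (Θ.ev-⊕ f3 _) (+-congˡ (trans (Θ.ev-⊕ f4 _) (+-congˡ (trans (Θ.ev-const 0ℤ) 0-homo))))))))))
          stable : ∀ i → At.ev α q * e i ≋ sum (λ j → At.ev α (const (A i j)) * e j)
          stable i = begin
            At.ev α q * e i                      ≈⟨ *-congʳ (sym eγ) ⟩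
            Θ.ev γ * e i                         ≈⟨ Θ.ev-⊗ γ (X ^ degree-of i) ⟨
            Θ.ev (γ ⊗ X ^ degree-of i)           ≈⟨ ∼⇒ev≋ (proj₁ (proj₂ (remainder (γ ⊗ X ^ degree-of i)))) ⟩
            Θ.ev (row i) ≈⟨ Θ.ev-cong (basis-expansion (row i) (proj₂ (proj₂ (remainder (γ ⊗ X ^ degree-of i))))) ⟩
            _                                    ≈⟨ ev-sum _ _ _ _ _ ⟩
            _ ≈⟨ +-cong (term i zero) (+-cong (term i (suc zero)) (+-cong (term i (suc (suc zero)))
                                                      (+-cong (term i (suc (suc (suc zero)))) (+-cong (term i (suc (suc (suc (suc zero))))) refl)))) ⟩
            sum (λ j → At.ev α (const (A i j)) * e j) ∎
          with-annihilator : (∃₂ λ m f → Monic m f × At.ev α f * e (fromℕ 4) ≋ 0#) → Integral α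
          with-annihilator (m , f , f-monic , root) = let (cs , f≈) = Monic⇒++[1] m f f-monic in cs , (begin
            At.ev α (cs ++ 1ℤ ∷ [])        ≈⟨ At.ev-cong α f≈ ⟨
            At.ev α f                      ≈⟨ *-identityʳ (At.ev α f) ⟨
            At.ev α f * 1#                 ≈⟨ *-congˡ Θ.ev-1 ⟨
            At.ev α f * e (fromℕ 4)        ≈⟨ root ⟩
            0#                             ∎)

        order-element⇒integral : ∀ α → Order α → Integral α
        order-element⇒integral α o = order⇒integral X α (≡.refl , DegLt-length X) (Order-resp (sym (At.ev-X α)) o)

      module Denominators
        (independent : ∀ r → DegLt 5 r → Θ.ev r ≋ 0# → r ≈ [])
        (ι-cancel : ∀ n → .{{ℤ.NonZero n}} → ∀ {u v} → ι n * u ≋ ι n * v → u ≋ v)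
        (clear-denominators : ∀ α → ∃ λ M → ℕ.NonZero M × ∃ λ f → ι (+ M) * α ≋ Θ.ev f) where

        opaque
          ev≋0⇒∼ : ∀ {f} → Θ.ev f ≋ 0# → f ∼ [] mod⟨ [] , g ⟩
          ev≋0⇒∼ {f} e = let (r , f∼r , dr) = remainder f in ∼-trans f∼r (≈⇒∼ (independent r dr (trans (sym (∼⇒ev≋ f∼r)) e)))

          ev≋⇒∼ : ∀ {f h} → Θ.ev f ≋ Θ.ev h → f ∼ h mod⟨ [] , g ⟩
          ev≋⇒∼ {f} {h} e = let (b , e′) = ∼-elim (ev≋0⇒∼ {f ⊕ ⊝ h} difference) in
              ∼-by b (≈-trans (solve 2 (λ f h → f := h :+ (f :- h)) ≈-refl f h) (≈-trans (⊕-cong (≈-refl {h}) e′) (⊕-cong (≈-refl {h}) (⊕-identityˡ _))))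
            where
            open ZXSolver
            difference : Θ.ev (f ⊕ ⊝ h) ≋ 0#
            difference = trans (Θ.ev-⊕ f (⊝ h)) (trans (+-cong e (Θ.ev-⊝ h)) (-‿inverseʳ (Θ.ev h)))

          ι-^ : ∀ M n → ι (+ M) ^ᴿ n ≋ ι (+ (M ℕ.^ n))
          ι-^ M zero    = sym 1-homo
          ι-^ M (suc n) = trans (*-congˡ (ι-^ M n)) (trans (sym (*-homo (+ M) (+ (M ℕ.^ n)))) (≡⇒≋ (cong ι (≡.sym (ℤₚ.pos-* M (M ℕ.^ n))))))

          bounded-denominator : ∀ M α → Order (ι (+ M) * α) → ∀ n r → DegLt n r → Order ((ι (+ M) ^ᴿ n) * At.ev α r)
          bounded-denominator M α o n       []      dr = [] , sym (zeroʳ _)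
          bounded-denominator M α o zero    (a ∷ r) dr = [] , sym (trans (*-congˡ (At.ev-cong α (DegLt-0 (a ∷ r) dr))) (zeroʳ 1#))
          bounded-denominator M α o (suc n) (a ∷ r) dr = Order-resp (sym expand) sum-in-order
            where
            m : Carrier
            m = ι (+ M)
            sum-in-order : Order ((m ^ᴿ suc n) * ι a + (m * α) * ((m ^ᴿ n) * At.ev α r))
            sum-in-order = Order-+ (Order-* (Order-resp (sym (ι-^ M (suc n))) (Order-ι (+ (M ℕ.^ suc n)))) (Order-ι a))
              (Order-* o (bounded-denominator M α o n r (DegLt-tail {a = a} {r} dr)))
            expand : (m ^ᴿ suc n) * (ι a + α * At.ev α r) ≋ (m ^ᴿ suc n) * ι a + (m * α) * ((m ^ᴿ n) * At.ev α r)
            expand = trans (distribˡ (m ^ᴿ suc n) (ι a) (α * At.ev α r)) (+-congˡ (interchange m (m ^ᴿ n) α (At.ev α r)))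

        HasBoundedDenominator : Carrier → Set _
        HasBoundedDenominator α = ∃ λ N → ℕ.NonZero N × ∀ k → Order (ι (+ N) * (α ^ᴿ k))

        opaque
          -- Modulo the monic equation s of α every xᵏ has a remainder of degree below that of s, so
          -- one power of M clears the denominators of all αᵏ.
          integral⇒bounded : ∀ M .{{_ : ℕ.NonZero M}} α → Order (ι (+ M) * α) → Integral α → HasBoundedDenominator α
          integral⇒bounded M {{M≢0}} α o (cs , root) = M ℕ.^ length cs , ℕₚ.m^n≢0 M (length cs) {{M≢0}} , λ k → powers k (monic-divMod s (++[1]⇒Monic cs) (X ^ k))
            where
            s : ℤ[X]
            s = cs ++ 1ℤ ∷ []
            powers : ∀ k → (∃₂ λ q r → X ^ k ≈ s ⊗ q ⊕ r × DegLt (length cs) r) → Order (ι (+ (M ℕ.^ length cs)) * (α ^ᴿ k))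
            powers k (q , r , e , dr) = Order-resp (*-cong (ι-^ M (length cs)) α^k≋) (bounded-denominator M α o (length cs) r dr)
              where
              α^k≋ : At.ev α r ≋ α ^ᴿ k
              α^k≋ = begin
                At.ev α r                               ≈⟨ trans (+-congʳ (zeroˡ _)) (+-identityˡ _) ⟨
                0# * At.ev α q + At.ev α r              ≈⟨ +-congʳ (*-congʳ root) ⟨
                At.ev α s * At.ev α q + At.ev α r       ≈⟨ +-congʳ (At.ev-⊗ α s q) ⟨
                At.ev α (s ⊗ q) + At.ev α r             ≈⟨ At.ev-⊕ α (s ⊗ q) r ⟨
                At.ev α (s ⊗ q ⊕ r)                     ≈⟨ At.ev-cong α e ⟨
                At.ev α (X ^ k)                         ≈⟨ At.ev-^ α X k ⟩
                At.ev α X ^ᴿ k                          ≈⟨ ^ᴿ-congˡ k (At.ev-X α) ⟩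
                α ^ᴿ k                                  ∎

          -- Removes one prime p from the denominator p M at a time. Here f(θ)/p = M α, and the
          -- bound N for α serves M α as well, so maximality at p makes f divisible by p. The
          -- element α and its bound never change.
          descend : (∀ {p} (p-prime : Prime p) {f} → Maximality.AlmostIntegral p-prime g g-monic f → f ∼ [] mod⟨ const (+ p) , g ⟩) →
            ∀ ps → All Prime ps → ∀ α f → ι (+ product ps) * α ≋ Θ.ev f → HasBoundedDenominator α → Order α
          descend maximal []       []       α f e bounded = f , trans (sym e) (trans (*-congʳ 1-homo) (*-identityˡ α))
          descend maximal (p ∷ ps) (p-prime ∷ primes) α f e bounded@(N , N≢0 , powers) =
              descend maximal ps primes α (proj₁ quotient) (ι-cancel (+ p) {{prime⇒nonZero p-prime}} (begin
                ι (+ p) * (ι (+ M) * α)            ≈⟨ *-assoc _ _ _ ⟨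
                (ι (+ p) * ι (+ M)) * α            ≈⟨ *-congʳ ι-product ⟨
                ι (+ product (p ∷ ps)) * α         ≈⟨ e ⟩
                Θ.ev f                             ≈⟨ ∼⇒ev≋ (proj₂ quotient) ⟩
                Θ.ev (P ⊗ proj₁ quotient)          ≈⟨ trans (Θ.ev-⊗ P _) (*-congʳ (Θ.ev-const (+ p))) ⟩
                ι (+ p) * Θ.ev (proj₁ quotient)    ∎)) bounded
            where
            M : ℕ
            M = product ps
            P Mₓ : ℤ[X]
            P = const (+ p)
            Mₓ = const (+ M)
            ι-product : ι (+ product (p ∷ ps)) ≋ ι (+ p) * ι (+ M)
            ι-product = trans (≡⇒≋ (cong ι (ℤₚ.pos-* p M))) (*-homo (+ p) (+ M))
            ev-const-^ : ∀ a k → ι a ^ᴿ k ≋ Θ.ev (const a ^ k)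
            ev-const-^ a k = sym (trans (Θ.ev-^ (const a) k) (^ᴿ-congˡ k (Θ.ev-const a)))
            in-ideal : ∀ k → const (+ N) ⊗ f ^ k ∼ [] mod⟨ P ^ k , g ⟩
            in-ideal k = ∼⇒∼0 (Mₓ ^ k ⊗ h) (ev≋⇒∼ (begin
              Θ.ev (const (+ N) ⊗ f ^ k) ≈⟨ trans (Θ.ev-⊗ (const (+ N)) (f ^ k)) (*-cong (Θ.ev-const (+ N)) (Θ.ev-^ f k)) ⟩
              ι (+ N) * (Θ.ev f ^ᴿ k) ≈⟨ *-congˡ (^ᴿ-congˡ k (trans (sym e) (*-congʳ ι-product))) ⟩
              ι (+ N) * (((ι (+ p) * ι (+ M)) * α) ^ᴿ k) ≈⟨ *-congˡ (trans (^ᴿ-distrib-* (ι (+ p) * ι (+ M)) α k) (*-congʳ (^ᴿ-distrib-* (ι (+ p)) (ι (+ M)) k))) ⟩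
              ι (+ N) * (((ι (+ p) ^ᴿ k) * (ι (+ M) ^ᴿ k)) * (α ^ᴿ k))   ≈⟨ x∙yz≈y∙xz (ι (+ N)) _ _ ⟩
              ((ι (+ p) ^ᴿ k) * (ι (+ M) ^ᴿ k)) * (ι (+ N) * (α ^ᴿ k))   ≈⟨ *-assoc _ _ _ ⟩
              (ι (+ p) ^ᴿ k) * ((ι (+ M) ^ᴿ k) * (ι (+ N) * (α ^ᴿ k))) ≈⟨ *-cong (ev-const-^ (+ p) k) (*-cong (ev-const-^ (+ M) k) (sym (proj₂ (powers k)))) ⟩
              Θ.ev (P ^ k) * (Θ.ev (Mₓ ^ k) * Θ.ev h)                    ≈⟨ *-congˡ (Θ.ev-⊗ (Mₓ ^ k) h) ⟨
              Θ.ev (P ^ k) * Θ.ev (Mₓ ^ k ⊗ h)                           ≈⟨ Θ.ev-⊗ (P ^ k) _ ⟨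
              Θ.ev (P ^ k ⊗ (Mₓ ^ k ⊗ h))                                ∎))
              where
              h : ℤ[X]
              h = proj₁ (powers k)
            quotient : ∃ λ a → f ∼ P ⊗ a mod⟨ [] , g ⟩
            quotient = ∼0⇒∼ (maximal p-prime (N , N≢0 , in-ideal))

          integral⇒order : (∀ {p} (p-prime : Prime p) {f} → Maximality.AlmostIntegral p-prime g g-monic f → f ∼ [] mod⟨ const (+ p) , g ⟩) →
            ∀ α → Integral α → Order α
          integral⇒order maximal α integral = with-denominator (clear-denominators α)
            where
            with-denominator : (∃ λ M → ℕ.NonZero M × ∃ λ f → ι (+ M) * α ≋ Θ.ev f) → Order α
            with-denominator (M , M≢0 , f , e) = descend maximal factors factorsPrime α f
                (trans (*-congʳ (≡⇒≋ (cong (λ n → ι (+ n)) (≡.sym isFactorisation)))) e)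
                (integral⇒bounded M {{M≢0}} α (f , sym e) integral)
              where open PrimeFactorisation (factorise M {{M≢0}})

          -- α = A(θ)/k satisfies α² - a₁α = -a₀B(θ).
          enlargement-integral : ∀ k .{{_ : ℤ.NonZero k}} a₀ a₁ {π A B α} →
            g ≈ π ⊗ A ⊕ const (k ℤ.* (k ℤ.* a₀)) → A ≈ π ⊗ B ⊕ const (k ℤ.* a₁) → ι k * α ≋ Θ.ev A → Integral α
          enlargement-integral k a₀ a₁ {π} {A} {B} {α} g≈ A≈ kα = order⇒integral Q α Q-monic (⊝ (const a₀ ⊗ B) , sym ev-Q)
            where
            Q : ℤ[X]
            Q = 0ℤ ∷ ℤ.- a₁ ∷ 1ℤ ∷ []
            Q-monic : Monic 2 Q
            Q-monic = ≡.refl , DegLt-length Q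
            Q≈ : Q ≈ X ⊗ (X ⊕ ⊝ const a₁)
            Q≈ = ≈-trans (≈horner Q) (≈-trans (⊕-cong (≈-refl {const 0ℤ}) (⊗-congʳ X (⊕-cong (const-neg a₁) ≈-refl)))
              (solve 2 (λ x a → con 0ℤ :+ x :* (:- a :+ x :* con 1ℤ) := x :* (x :- a)) ≈-refl X (const a₁)))
              where open ZXSolver
            A-ka₁ : ℤ[X]
            A-ka₁ = A ⊕ ⊝ (const k ⊗ const a₁)
            -- A (A - k a₁) = A π B = (g - k² a₀) B.
            reduction : A ⊗ A-ka₁ ∼ const k ⊗ (const k ⊗ (⊝ (const a₀ ⊗ B))) mod⟨ [] , g ⟩
            reduction = ∼-by B (≈-trans (⊗-congʳ A (≈-trans (⊕-cong (≈-trans A≈ (⊕-cong (≈-refl {π ⊗ B}) (const-* k a₁))) ≈-refl)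
                (solve 2 (λ x y → x :+ y :- y := x) ≈-refl (π ⊗ B) (const k ⊗ const a₁))))
              (≈-trans (solve 5 (λ A π B k a → A :* (π :* B) := k :* (k :* (:- (a :* B))) :+ (π :* A :+ k :* (k :* a)) :* B) ≈-refl A π B (const k) (const a₀))
              (⊕-cong (≈-refl {const k ⊗ (const k ⊗ (⊝ (const a₀ ⊗ B)))}) (⊗-cong (≈-sym (≈-trans g≈ (⊕-cong (≈-refl {π ⊗ A}) (const-*≈ ≈-refl (const-* k a₀))))) (≈-refl {B})))))
              where open ZXSolver
            kkQ : ι k * (ι k * (α * (α + - ι a₁))) ≋ ι k * (ι k * Θ.ev (⊝ (const a₀ ⊗ B)))
            kkQ = begin
              ι k * (ι k * (α * (α + - ι a₁))) ≈⟨ trans (*-congˡ (x∙yz≈y∙xz (ι k) α _)) (sym (*-assoc (ι k) α _)) ⟩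
              (ι k * α) * (ι k * (α + - ι a₁)) ≈⟨ *-congˡ (trans (distribˡ (ι k) α _) (+-congˡ (sym (-‿distribʳ-* (ι k) (ι a₁))))) ⟩
              (ι k * α) * (ι k * α + - (ι k * ι a₁)) ≈⟨ *-cong kα (+-cong kα (-‿cong (sym (trans (Θ.ev-⊗ (const k) (const a₁)) (*-cong (Θ.ev-const k) (Θ.ev-const a₁)))))) ⟩
              Θ.ev A * (Θ.ev A + - Θ.ev (const k ⊗ const a₁)) ≈⟨ *-congˡ (trans (Θ.ev-⊕ A _) (+-congˡ (Θ.ev-⊝ _))) ⟨
              Θ.ev A * Θ.ev A-ka₁                             ≈⟨ Θ.ev-⊗ A A-ka₁ ⟨
              Θ.ev (A ⊗ A-ka₁)                                ≈⟨ ∼⇒ev≋ reduction ⟩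
              Θ.ev (const k ⊗ (const k ⊗ (⊝ (const a₀ ⊗ B)))) ≈⟨ trans (Θ.ev-⊗ (const k) _) (*-cong (Θ.ev-const k) (trans (Θ.ev-⊗ (const k) _) (*-congʳ (Θ.ev-const k)))) ⟩
              ι k * (ι k * Θ.ev (⊝ (const a₀ ⊗ B)))           ∎
              where open import Algebra.Properties.Ring ring using (-‿distribʳ-*)
            ev-Q : At.ev α Q ≋ Θ.ev (⊝ (const a₀ ⊗ B))
            ev-Q = trans (trans (At.ev-cong α Q≈) (trans (At.ev-⊗ α X _) (*-cong (At.ev-X α) (trans (At.ev-⊕ α X _) (+-cong (At.ev-X α) (trans (At.ev-⊝ α (const a₁)) (-‿cong (At.ev-const α a₁))))))))
              (ι-cancel k (ι-cancel k kkQ))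

          -- The coordinate of A(θ)/k at θ⁴ is 1/k, and coordinates below degree 5 are unique.
          enlargement∉order : ∀ k {A α} → DegLt 5 A → coeff A 4 ≡ 1ℤ → ι k * α ≋ Θ.ev A → Order α → k ∣ 1ℤ
          enlargement∉order k {A} {α} dA top kα (h , e) = divides (coeff r 4) 
              (≡.trans (≡.sym top) (≡.trans (≡.sym (at kr≈A 4)) (≡.trans (at (const-⊗ k r) 4) (≡.trans (coeff-· k r 4) (ℤₚ.*-comm k (coeff r 4))))))
            where
            r : ℤ[X]
            r = proj₁ (remainder h)
            kr : ℤ[X]
            kr = const k ⊗ r
            ev-r : Θ.ev r ≋ α
            ev-r = trans (sym (∼⇒ev≋ (proj₁ (proj₂ (remainder h))))) e
            kr-A≈[] : kr ⊕ ⊝ A ≈ []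
            kr-A≈[] = independent (kr ⊕ ⊝ A) (DegLt-⊕ kr (⊝ A) (DegLt-⊗ {0} (const k) r (DegLt-const k) (proj₂ (proj₂ (remainder h)))) (DegLt-⊝ A dA))
              (trans (Θ.ev-⊕ kr (⊝ A)) (trans (+-cong (trans (Θ.ev-⊗ (const k) r) (trans (*-cong (Θ.ev-const k) ev-r) kα)) (Θ.ev-⊝ A)) (-‿inverseʳ (Θ.ev A))))
            kr≈A : kr ≈ A
            kr≈A = ≈-trans (solve 2 (λ x y → x := (x :- y) :+ y) ≈-refl kr A) (≈-trans (⊕-cong kr-A≈[] (≈-refl {A})) (⊕-identityˡ A))
              where open ZXSolver

  -- Rational numbers and rational vectors

  open import Defs
  open import Data.Rational as ℚ using (ℚ; 0ℚ; 1ℚ; toℚᵘ; ↥_; ↧_; ↧ₙ_)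
  import Data.Rational.Properties as ℚₚ
  import Data.Rational.Solver
  open import Data.Rational.Unnormalised as ℚᵘ using (mkℚᵘ; *≡*)
  import Data.Rational.Unnormalised.Properties as ℚᵘₚ
  open import Data.Vec as Vec using (Vec; []; _∷_; toList)
  import Data.Vec.Properties as Vecₚ

  module ℚS = Data.Rational.Solver.+-*-Solver

  opaque
    toℚᵘ-ℤ→ℚ : ∀ z → toℚᵘ (ℤ→ℚ z) ℚᵘ.≃ mkℚᵘ z 0
    toℚᵘ-ℤ→ℚ z = ℚₚ.toℚᵘ-fromℚᵘ (mkℚᵘ z 0)

    ℤ→ℚ-injective : ∀ {a b} → ℤ→ℚ a ≡ ℤ→ℚ b → a ≡ b
    ℤ→ℚ-injective {a} {b} e = ℤₚ.*-cancelʳ-≡ a b 1ℤ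
      (ℚᵘₚ.drop-*≡* (ℚᵘₚ.≃-trans (ℚᵘₚ.≃-sym (toℚᵘ-ℤ→ℚ a)) (ℚᵘₚ.≃-trans (ℚᵘₚ.≃-reflexive (cong toℚᵘ e)) (toℚᵘ-ℤ→ℚ b))))

    ℤ→ℚ-+ : ∀ a b → ℤ→ℚ (a ℤ.+ b) ≡ ℤ→ℚ a ℚ.+ ℤ→ℚ b
    ℤ→ℚ-+ a b = ℚₚ.toℚᵘ-injective (begin
      toℚᵘ (ℤ→ℚ (a ℤ.+ b))               ≈⟨ toℚᵘ-ℤ→ℚ (a ℤ.+ b) ⟩
      mkℚᵘ (a ℤ.+ b) 0 ≈⟨ *≡* (cong (ℤ._* 1ℤ) (cong₂ ℤ._+_ (≡.sym (ℤₚ.*-identityʳ a)) (≡.sym (ℤₚ.*-identityʳ b)))) ⟩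
      mkℚᵘ a 0 ℚᵘ.+ mkℚᵘ b 0             ≈⟨ ℚᵘₚ.+-cong (toℚᵘ-ℤ→ℚ a) (toℚᵘ-ℤ→ℚ b) ⟨
      toℚᵘ (ℤ→ℚ a) ℚᵘ.+ toℚᵘ (ℤ→ℚ b)     ≈⟨ ℚₚ.toℚᵘ-homo-+ (ℤ→ℚ a) (ℤ→ℚ b) ⟨
      toℚᵘ (ℤ→ℚ a ℚ.+ ℤ→ℚ b)             ∎)
      where open ℚᵘₚ.≃-Reasoning

    ℤ→ℚ-* : ∀ a b → ℤ→ℚ (a ℤ.* b) ≡ ℤ→ℚ a ℚ.* ℤ→ℚ b
    ℤ→ℚ-* a b = ℚₚ.toℚᵘ-injective (begin
      toℚᵘ (ℤ→ℚ (a ℤ.* b))               ≈⟨ toℚᵘ-ℤ→ℚ (a ℤ.* b) ⟩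
      mkℚᵘ a 0 ℚᵘ.* mkℚᵘ b 0             ≈⟨ ℚᵘₚ.*-cong (toℚᵘ-ℤ→ℚ a) (toℚᵘ-ℤ→ℚ b) ⟨
      toℚᵘ (ℤ→ℚ a) ℚᵘ.* toℚᵘ (ℤ→ℚ b)     ≈⟨ ℚₚ.toℚᵘ-homo-* (ℤ→ℚ a) (ℤ→ℚ b) ⟨
      toℚᵘ (ℤ→ℚ a ℚ.* ℤ→ℚ b)             ∎)
      where open ℚᵘₚ.≃-Reasoning

    ↧*≡↥ : ∀ q → ℤ→ℚ (↧ q) ℚ.* q ≡ ℤ→ℚ (↥ q)
    ↧*≡↥ q@record{} = ℚₚ.toℚᵘ-injective (begin
      toℚᵘ (ℤ→ℚ (↧ q) ℚ.* q)             ≈⟨ ℚₚ.toℚᵘ-homo-* (ℤ→ℚ (↧ q)) q ⟩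
      toℚᵘ (ℤ→ℚ (↧ q)) ℚᵘ.* toℚᵘ q       ≈⟨ ℚᵘₚ.*-cong (toℚᵘ-ℤ→ℚ (↧ q)) (ℚᵘₚ.≃-refl {toℚᵘ q}) ⟩
      mkℚᵘ (↧ q) 0 ℚᵘ.* toℚᵘ q ≈⟨ *≡* (≡.trans (ℤₚ.*-identityʳ _) (≡.trans (ℤₚ.*-comm (↧ q) (↥ q)) (cong (λ n → ↥ q ℤ.* + n) (≡.sym (ℕₚ.+-identityʳ (↧ₙ q)))))) ⟩
      mkℚᵘ (↥ q) 0                       ≈⟨ toℚᵘ-ℤ→ℚ (↥ q) ⟨
      toℚᵘ (ℤ→ℚ (↥ q))                   ∎)
      where
      open ℚᵘₚ.≃-Reasoning

  infix 8 -K_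
  -K_ : K → K
  -K_ = Vec.map (λ q → ℚ.- q)

  •-+ : ∀ q {n} (u v : Vec ℚ n) → Vec.map (q ℚ.*_) (Vec.zipWith ℚ._+_ u v) ≡ Vec.zipWith ℚ._+_ (Vec.map (q ℚ.*_) u) (Vec.map (q ℚ.*_) v)
  •-+ q []      []      = ≡.refl
  •-+ q (a ∷ u) (b ∷ v) = cong₂ _∷_ (ℚₚ.*-distribˡ-+ q a b) (•-+ q u v)

  +-• : ∀ q r {n} (u : Vec ℚ n) → Vec.map ((q ℚ.+ r) ℚ.*_) u ≡ Vec.zipWith ℚ._+_ (Vec.map (q ℚ.*_) u) (Vec.map (r ℚ.*_) u)
  +-• q r []      = ≡.refl
  +-• q r (a ∷ u) = cong₂ _∷_ (ℚₚ.*-distribʳ-+ a q r) (+-• q r u)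

  •-• : ∀ q r {n} (u : Vec ℚ n) → Vec.map (q ℚ.*_) (Vec.map (r ℚ.*_) u) ≡ Vec.map ((q ℚ.* r) ℚ.*_) u
  •-• q r []      = ≡.refl
  •-• q r (a ∷ u) = cong₂ _∷_ (≡.sym (ℚₚ.*-assoc q r a)) (•-• q r u)

  1-• : ∀ {n} (u : Vec ℚ n) → Vec.map (1ℚ ℚ.*_) u ≡ u
  1-• []      = ≡.refl
  1-• (a ∷ u) = cong₂ _∷_ (ℚₚ.*-identityˡ a) (1-• u)

  0-• : ∀ {n} (u : Vec ℚ n) → Vec.map (0ℚ ℚ.*_) u ≡ Vec.replicate n 0ℚ
  0-• []      = ≡.refl
  0-• (a ∷ u) = cong₂ _∷_ (ℚₚ.*-zeroˡ a) (0-• u)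

  •-0 : ∀ q n → Vec.map (q ℚ.*_) (Vec.replicate n 0ℚ) ≡ Vec.replicate n 0ℚ
  •-0 q zero    = ≡.refl
  •-0 q (suc n) = cong₂ _∷_ (ℚₚ.*-zeroʳ q) (•-0 q n)

  +K-interchange : ∀ u v w x → (u +K v) +K (w +K x) ≡ (u +K w) +K (v +K x)
  +K-interchange u v w x = begin
    (u +K v) +K (w +K x)   ≡⟨ assoc u v (w +K x) ⟩
    u +K (v +K (w +K x))   ≡⟨ cong (u +K_) (assoc v w x) ⟨
    u +K ((v +K w) +K x)   ≡⟨ cong (λ z → u +K (z +K x)) (Vecₚ.zipWith-comm ℚₚ.+-comm v w) ⟩
    u +K ((w +K v) +K x)   ≡⟨ cong (u +K_) (assoc w v x) ⟩
    u +K (w +K (v +K x))   ≡⟨ assoc u w (v +K x) ⟨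
    (u +K w) +K (v +K x)   ∎
    where
    open ≡-Reasoning
    assoc : ∀ u v w → (u +K v) +K w ≡ u +K (v +K w)
    assoc = Vecₚ.zipWith-assoc ℚₚ.+-assoc

  -- The commutative ring structure on `K`

  module NumberField (c d : ℤ) where
    open Field c d

    private
      C D : ℚ
      C = ℤ→ℚ c
      D = ℤ→ℚ d

    ∷₅-cong : ∀ {a b e f g a′ b′ e′ f′ g′ : ℚ} → a ≡ a′ → b ≡ b′ → e ≡ e′ → f ≡ f′ → g ≡ g′ →
      _≡_ {A = K} (a ∷ b ∷ e ∷ f ∷ g ∷ []) (a′ ∷ b′ ∷ e′ ∷ f′ ∷ g′ ∷ [])
    ∷₅-cong ≡.refl ≡.refl ≡.refl ≡.refl ≡.refl = ≡.refl

    mulθ-+ : ∀ u v → mulθ (u +K v) ≡ mulθ u +K mulθ v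
    mulθ-+ (a0 ∷ a1 ∷ a2 ∷ a3 ∷ a4 ∷ []) (b0 ∷ b1 ∷ b2 ∷ b3 ∷ b4 ∷ []) = ∷₅-cong
      (solve 3 (λ a b d → :- ((a :+ b) :* d) := :- (a :* d) :+ :- (b :* d)) ≡.refl a4 b4 D) ≡.refl ≡.refl ≡.refl
      (solve 5 (λ a b a′ b′ c → a :+ b :- (a′ :+ b′) :* c := (a :- a′ :* c) :+ (b :- b′ :* c)) ≡.refl a3 b3 a4 b4 C)
      where open ℚS

    mulθ-• : ∀ q u → mulθ (q •K u) ≡ q •K mulθ u
    mulθ-• q (a0 ∷ a1 ∷ a2 ∷ a3 ∷ a4 ∷ []) = ∷₅-cong
      (solve 3 (λ q a d → :- ((q :* a) :* d) := q :* (:- (a :* d))) ≡.refl q a4 D) ≡.refl ≡.refl ≡.refl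
      (solve 4 (λ q a a′ c → q :* a :- (q :* a′) :* c := q :* (a :- a′ :* c)) ≡.refl q a3 a4 C)
      where open ℚS

    mulθ-0 : mulθ 0K ≡ 0K
    mulθ-0 = ≡.trans (cong mulθ (≡.sym (0-• 0K))) (≡.trans (mulθ-• 0ℚ 0K) (0-• (mulθ 0K)))

    act-+ : ∀ p u v → act p (u +K v) ≡ act p u +K act p v
    act-+ []      u v = ≡.sym (Vecₚ.zipWith-identityˡ {f = ℚ._+_} ℚₚ.+-identityˡ 0K)
    act-+ (a ∷ p) u v = ≡.trans
      (cong₂ _+K_ (•-+ a u v) (≡.trans (cong mulθ (act-+ p u v)) (mulθ-+ _ _)))
      (+K-interchange (a •K u) (a •K v) (mulθ (act p u)) (mulθ (act p v)))

    act-• : ∀ p q u → act p (q •K u) ≡ q •K act p u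
    act-• []      q u = ≡.sym (•-0 q 5)
    act-• (a ∷ p) q u = ≡.trans
      (cong₂ _+K_ (≡.trans (•-• a q u) (≡.trans (cong (_•K u) (ℚₚ.*-comm a q)) (≡.sym (•-• q a u))))
                  (≡.trans (cong mulθ (act-• p q u)) (mulθ-• q _)))
      (≡.sym (•-+ q (a •K u) (mulθ (act p u))))

    act-mulθ : ∀ p u → act p (mulθ u) ≡ mulθ (act p u)
    act-mulθ []      u = ≡.sym mulθ-0
    act-mulθ (a ∷ p) u = ≡.trans
      (cong₂ _+K_ (≡.sym (mulθ-• a u)) (cong mulθ (act-mulθ p u)))
      (≡.sym (mulθ-+ _ _))

    act-0 : ∀ p → act p 0K ≡ 0K
    act-0 p = ≡.trans (cong (act p) (≡.sym (0-• 0K))) (≡.trans (act-• p 0ℚ 0K) (0-• (act p 0K)))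

    act-comm : ∀ p q u → act p (act q u) ≡ act q (act p u)
    act-comm []      q u = ≡.sym (act-0 q)
    act-comm (a ∷ p) q u = ≡.trans
      (cong₂ _+K_ (≡.sym (act-• q a u)) (≡.trans (cong mulθ (act-comm p q u)) (≡.sym (act-mulθ q _))))
      (≡.sym (act-+ q _ _))

    -- With last coordinate 0, multiplication by θ is a shift and θ⁵ never has to be reduced.
    1K+mulθ : ∀ a w0 w1 w2 w3 → (a •K 1K) +K mulθ (w0 ∷ w1 ∷ w2 ∷ w3 ∷ 0ℚ ∷ []) ≡ a ∷ w0 ∷ w1 ∷ w2 ∷ w3 ∷ []
    1K+mulθ a w0 w1 w2 w3 = ∷₅-cong
      (solve 2 (λ a d → a :* con 1ℚ :+ :- (con 0ℚ :* d) := a) ≡.refl a D)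
      (s w0) (s w1) (s w2)
      (solve 3 (λ a w c → a :* con 0ℚ :+ (w :- con 0ℚ :* c) := w) ≡.refl a w3 C)
      where
      open ℚS
      s : ∀ w → a ℚ.* 0ℚ ℚ.+ w ≡ w
      s w = ≡.trans (cong (ℚ._+ w) (ℚₚ.*-zeroʳ a)) (ℚₚ.+-identityˡ w)

    mulθ-coordinates : ∀ {a w0 w1 w2 w3 u} → u ≡ w0 ∷ w1 ∷ w2 ∷ w3 ∷ 0ℚ ∷ [] → (a •K 1K) +K mulθ u ≡ a ∷ w0 ∷ w1 ∷ w2 ∷ w3 ∷ []
    mulθ-coordinates ≡.refl = 1K+mulθ _ _ _ _ _

    act-1 : ∀ u → act (toList u) 1K ≡ u
    act-1 (a0 ∷ a1 ∷ a2 ∷ a3 ∷ a4 ∷ []) = mulθ-coordinates (mulθ-coordinates (mulθ-coordinates (mulθ-coordinates (mulθ-coordinates ≡.refl))))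

    -- Each element is a polynomial in multiplication by θ applied to 1, and such polynomials
    -- commute. Associativity then reduces to the same fact.
    *K-comm : ∀ u v → u *K v ≡ v *K u
    *K-comm u v = begin
      act (toList u) v                       ≡⟨ cong (act (toList u)) (act-1 v) ⟨
      act (toList u) (act (toList v) 1K)     ≡⟨ act-comm (toList u) (toList v) 1K ⟩
      act (toList v) (act (toList u) 1K)     ≡⟨ cong (act (toList v)) (act-1 u) ⟩
      act (toList v) u                       ∎
      where open ≡-Reasoning

    *K-assoc : ∀ u v w → (u *K v) *K w ≡ u *K (v *K w)
    *K-assoc u v w = begin
      (u *K v) *K w                          ≡⟨ *K-comm (u *K v) w ⟩
      act (toList w) (act (toList u) v)      ≡⟨ act-comm (toList w) (toList u) v ⟩
      act (toList u) (act (toList w) v)      ≡⟨ cong (act (toList u)) (*K-comm w v) ⟩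
      u *K (v *K w)                          ∎
      where open ≡-Reasoning

    *K-identityʳ : ∀ u → u *K 1K ≡ u
    *K-identityʳ = act-1

    *K-distribˡ : ∀ u v w → u *K (v +K w) ≡ (u *K v) +K (u *K w)
    *K-distribˡ u = act-+ (toList u)

    *K-distribʳ : ∀ u v w → (v +K w) *K u ≡ (v *K u) +K (w *K u)
    *K-distribʳ u v w = ≡.trans (*K-comm (v +K w) u) (≡.trans (*K-distribˡ u v w) (cong₂ _+K_ (*K-comm u v) (*K-comm u w)))

    -- Opaque copies of the operations: ℚ arithmetic unfolds uncontrollably during conversion checking.
    infixl 6 _⊞_
    infixl 7 _⊠_
    opaque
      _⊞_ _⊠_ : K → K → K
      _⊞_ = _+K_
      _⊠_ = _*K_

      ⊟_ : K → K
      ⊟_ = -K_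

      0ᴷ 1ᴷ : K
      0ᴷ = 0K
      1ᴷ = 1K

      ι : ℤ → K
      ι z = ℤ→ℚ z •K 1K

      ⊞≡+K : ∀ u v → u ⊞ v ≡ u +K v
      ⊞≡+K u v = ≡.refl

      ⊠≡*K : ∀ u v → u ⊠ v ≡ u *K v
      ⊠≡*K u v = ≡.refl

      0ᴷ≡0K : 0ᴷ ≡ 0K
      0ᴷ≡0K = ≡.refl

      ι≡• : ∀ z → ι z ≡ ℤ→ℚ z •K 1K
      ι≡• z = ≡.refl

      K-isCommutativeRing : IsCommutativeRing _≡_ _⊞_ _⊠_ ⊟_ 0ᴷ 1ᴷ
      K-isCommutativeRing = record
        { isRing = record
          { +-isAbelianGroup = record
            { isGroup = record
              { isMonoid = record
                { isSemigroup = record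
                  { isMagma = record { isEquivalence = ≡.isEquivalence ; ∙-cong = cong₂ _+K_ }
                  ; assoc = Vecₚ.zipWith-assoc ℚₚ.+-assoc }
                ; identity = Vecₚ.zipWith-identityˡ ℚₚ.+-identityˡ , Vecₚ.zipWith-identityʳ ℚₚ.+-identityʳ }
              ; inverse = Vecₚ.zipWith-inverseˡ ℚₚ.+-inverseˡ , Vecₚ.zipWith-inverseʳ ℚₚ.+-inverseʳ
              ; ⁻¹-cong = cong -K_ }
            ; comm = Vecₚ.zipWith-comm ℚₚ.+-comm }
          ; *-cong = cong₂ _*K_
          ; *-assoc = *K-assoc
          ; *-identity = (λ u → ≡.trans (*K-comm 1K u) (*K-identityʳ u)) , *K-identityʳ
          ; distrib = *K-distribˡ , *K-distribʳ }
        ; *-comm = *K-comm }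

      •1-* : ∀ q u → (q •K 1K) *K u ≡ q •K u
      •1-* q u = ≡.trans (*K-comm (q •K 1K) u) (≡.trans (act-• (toList u) q 1K) (cong (q •K_) (act-1 u)))

      ι-⊠ : ∀ z u → ι z ⊠ u ≡ ℤ→ℚ z •K u
      ι-⊠ z u = •1-* (ℤ→ℚ z) u

      ι-+ : ∀ a b → ι (a ℤ.+ b) ≡ ι a ⊞ ι b
      ι-+ a b = ≡.trans (cong (_•K 1K) (ℤ→ℚ-+ a b)) (+-• (ℤ→ℚ a) (ℤ→ℚ b) 1K)

      ι-* : ∀ a b → ι (a ℤ.* b) ≡ ι a ⊠ ι b
      ι-* a b = ≡.trans (cong (_•K 1K) (ℤ→ℚ-* a b)) (≡.trans (≡.sym (•-• (ℤ→ℚ a) (ℤ→ℚ b) 1K)) (≡.sym (ι-⊠ a (ι b))))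

      ι-0 : ι 0ℤ ≡ 0ᴷ
      ι-0 = 0-• 1K

      ι-1 : ι 1ℤ ≡ 1ᴷ
      ι-1 = 1-• 1K

      θ-⊠ : ∀ u → θK ⊠ u ≡ mulθ u
      θ-⊠ u = begin
        θK *K u                        ≡⟨ *K-comm θK u ⟩
        act (toList u) θK              ≡⟨ cong (act (toList u)) θ≡mulθ1 ⟩
        act (toList u) (mulθ 1K)       ≡⟨ act-mulθ (toList u) 1K ⟩
        mulθ (act (toList u) 1K)       ≡⟨ cong mulθ (act-1 u) ⟩
        mulθ u                         ∎
        where
        open ≡-Reasoning
        θ≡mulθ1 : θK ≡ mulθ 1K
        θ≡mulθ1 = ∷₅-cong (solve 1 (λ d → con 0ℚ := :- (con 0ℚ :* d)) ≡.refl D) ≡.refl ≡.refl ≡.refl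
          (solve 1 (λ c → con 0ℚ := con 0ℚ :- con 0ℚ :* c) ≡.refl C)
          where open ℚS

    K-ring : CommutativeRing _ _
    K-ring = record { isCommutativeRing = K-isCommutativeRing }

    ℤ⟶K : ℤ.+-*-rawRing -Raw-AlmostCommutative⟶ fromCommutativeRing K-ring
    ℤ⟶K = record
      { ⟦_⟧ = ι
      ; +-homo = ι-+
      ; *-homo = ι-*
      ; -‿homo = λ a → inverseˡ-unique (ι (ℤ.- a)) (ι a) (≡.trans (≡.sym (ι-+ (ℤ.- a) a)) (≡.trans (cong ι (ℤₚ.+-inverseˡ a)) ι-0))
      ; 0-homo = ι-0
      ; 1-homo = ι-1 }
      where open import Algebra.Properties.AbelianGroup (CommutativeRing.+-abelianGroup K-ring)

  opaque
    ℤ→ℚ-nonZero : ∀ n → .{{ℤ.NonZero n}} → ℚ.NonZero (ℤ→ℚ n)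
    ℤ→ℚ-nonZero n {{n≢0}} = ℚ.≢-nonZero λ e → ℕ.≢-nonZero⁻¹ ℤ.∣ n ∣ {{n≢0}} (cong ℤ.∣_∣ (ℤ→ℚ-injective {n} {0ℤ} e))

    •-cancel : ∀ q → .{{ℚ.NonZero q}} → ∀ {n} {u v : Vec ℚ n} → Vec.map (q ℚ.*_) u ≡ Vec.map (q ℚ.*_) v → u ≡ v
    •-cancel q {u = u} {v} e = ≡.trans (≡.sym (invert u)) (≡.trans (cong (Vec.map (ℚ.1/ q ℚ.*_)) e) (invert v))
      where
      invert : ∀ {n} (u : Vec ℚ n) → Vec.map (ℚ.1/ q ℚ.*_) (Vec.map (q ℚ.*_) u) ≡ u
      invert u = ≡.trans (•-• (ℚ.1/ q) q u) (≡.trans (cong (λ r → Vec.map (r ℚ.*_) u) (ℚₚ.*-inverseˡ q)) (1-• u))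

    common-denominator : ∀ {n} (v : Vec ℚ n) → ∃ λ M → ℕ.NonZero M × ∃ λ z → Vec.map (ℤ→ℚ (+ M) ℚ.*_) v ≡ Vec.map ℤ→ℚ z
    common-denominator []      = 1 , _ , [] , ≡.refl
    common-denominator (q ∷ v) = let (M , M≢0 , z , e) = common-denominator v in
      ↧ₙ q ℕ.* M , ℕₚ.m*n≢0 (↧ₙ q) M {{_}} {{M≢0}} , ↥ q ℤ.* + M ∷ Vec.map (↧ q ℤ.*_) z , cong₂ _∷_ (head M) (tail M z e)
      where
      open ≡-Reasoning
      scale : ∀ M → ℤ→ℚ (+ (↧ₙ q ℕ.* M)) ≡ ℤ→ℚ (↧ q) ℚ.* ℤ→ℚ (+ M)
      scale M = ≡.trans (cong ℤ→ℚ (ℤₚ.pos-* (↧ₙ q) M)) (ℤ→ℚ-* (↧ q) (+ M))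
      head : ∀ M → ℤ→ℚ (+ (↧ₙ q ℕ.* M)) ℚ.* q ≡ ℤ→ℚ (↥ q ℤ.* + M)
      head M = begin
        ℤ→ℚ (+ (↧ₙ q ℕ.* M)) ℚ.* q           ≡⟨ cong (ℚ._* q) (≡.trans (scale M) (ℚₚ.*-comm (ℤ→ℚ (↧ q)) (ℤ→ℚ (+ M)))) ⟩
        ℤ→ℚ (+ M) ℚ.* ℤ→ℚ (↧ q) ℚ.* q        ≡⟨ ℚₚ.*-assoc (ℤ→ℚ (+ M)) (ℤ→ℚ (↧ q)) q ⟩
        ℤ→ℚ (+ M) ℚ.* (ℤ→ℚ (↧ q) ℚ.* q)      ≡⟨ cong (ℤ→ℚ (+ M) ℚ.*_) (↧*≡↥ q) ⟩
        ℤ→ℚ (+ M) ℚ.* ℤ→ℚ (↥ q)              ≡⟨ ≡.trans (ℚₚ.*-comm (ℤ→ℚ (+ M)) (ℤ→ℚ (↥ q))) (≡.sym (ℤ→ℚ-* (↥ q) (+ M))) ⟩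
        ℤ→ℚ (↥ q ℤ.* + M)                    ∎
      pull : ∀ {n} (z : Vec ℤ n) → Vec.map (ℤ→ℚ (↧ q) ℚ.*_) (Vec.map ℤ→ℚ z) ≡ Vec.map ℤ→ℚ (Vec.map (↧ q ℤ.*_) z)
      pull []      = ≡.refl
      pull (a ∷ z) = cong₂ _∷_ (≡.sym (ℤ→ℚ-* (↧ q) a)) (pull z)
      tail : ∀ {n} {v : Vec ℚ n} M z → Vec.map (ℤ→ℚ (+ M) ℚ.*_) v ≡ Vec.map ℤ→ℚ z →
        Vec.map (ℤ→ℚ (+ (↧ₙ q ℕ.* M)) ℚ.*_) v ≡ Vec.map ℤ→ℚ (Vec.map (↧ q ℤ.*_) z)
      tail {v = v} M z e = begin
        Vec.map (ℤ→ℚ (+ (↧ₙ q ℕ.* M)) ℚ.*_) v                  ≡⟨ cong (λ r → Vec.map (r ℚ.*_) v) (scale M) ⟩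
        Vec.map ((ℤ→ℚ (↧ q) ℚ.* ℤ→ℚ (+ M)) ℚ.*_) v             ≡⟨ •-• (ℤ→ℚ (↧ q)) (ℤ→ℚ (+ M)) v ⟨
        Vec.map (ℤ→ℚ (↧ q) ℚ.*_) (Vec.map (ℤ→ℚ (+ M) ℚ.*_) v)  ≡⟨ cong (Vec.map (ℤ→ℚ (↧ q) ℚ.*_)) e ⟩
        Vec.map (ℤ→ℚ (↧ q) ℚ.*_) (Vec.map ℤ→ℚ z)               ≡⟨ pull z ⟩
        Vec.map ℤ→ℚ (Vec.map (↧ q ℤ.*_) z)                     ∎

  -- ℤ[θ] in coordinates and the criterion for a power integral basis

  module Coordinates (c d : ℤ) where
    open Field c d
    open NumberField c d

    module Θ = Evaluation K-ring ℤ⟶K θK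

    opaque
      ι-cancel : ∀ n → .{{ℤ.NonZero n}} → ∀ {u v} → ι n ⊠ u ≡ ι n ⊠ v → u ≡ v
      ι-cancel n {u} {v} e = •-cancel (ℤ→ℚ n) {{ℤ→ℚ-nonZero n}} (≡.trans (≡.sym (ι-⊠ n u)) (≡.trans e (ι-⊠ n v)))

      ev-step : ∀ a f → Θ.ev (a ∷ f) ≡ (ℤ→ℚ a •K 1K) +K mulθ (Θ.ev f)
      ev-step a f = ≡.trans (⊞≡+K (ι a) (θK ⊠ Θ.ev f)) (cong₂ _+K_ (ι≡• a) (θ-⊠ (Θ.ev f)))

      ev-∷ : ∀ a f {w0 w1 w2 w3} → Θ.ev f ≡ w0 ∷ w1 ∷ w2 ∷ w3 ∷ 0ℚ ∷ [] → Θ.ev (a ∷ f) ≡ ℤ→ℚ a ∷ w0 ∷ w1 ∷ w2 ∷ w3 ∷ []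
      ev-∷ a f {w0} {w1} {w2} {w3} e = ≡.trans {j = (ℤ→ℚ a •K 1K) +K mulθ (Θ.ev f)} (ev-step a f) (mulθ-coordinates {ℤ→ℚ a} {w0} {w1} {w2} {w3} {Θ.ev f} e)

      ev-coordinates : ∀ a0 a1 a2 a3 a4 → Θ.ev (a0 ∷ a1 ∷ a2 ∷ a3 ∷ a4 ∷ []) ≡ ℤ→ℚ a0 ∷ ℤ→ℚ a1 ∷ ℤ→ℚ a2 ∷ ℤ→ℚ a3 ∷ ℤ→ℚ a4 ∷ []
      ev-coordinates a0 a1 a2 a3 a4 = ev-∷ a0 (a1 ∷ a2 ∷ a3 ∷ a4 ∷ []) {ℤ→ℚ a1} {ℤ→ℚ a2} {ℤ→ℚ a3} {ℤ→ℚ a4}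
        (ev-∷ a1 (a2 ∷ a3 ∷ a4 ∷ []) {ℤ→ℚ a2} {ℤ→ℚ a3} {ℤ→ℚ a4} {0ℚ} (ev-∷ a2 (a3 ∷ a4 ∷ []) {ℤ→ℚ a3} {ℤ→ℚ a4} {0ℚ} {0ℚ}
        (ev-∷ a3 (a4 ∷ []) {ℤ→ℚ a4} {0ℚ} {0ℚ} {0ℚ} (ev-∷ a4 [] {0ℚ} {0ℚ} {0ℚ} {0ℚ} 0ᴷ≡0K))))

      -- The step that really reduces θ⁵: u = θ⁴ + c θ³ satisfies d + θ u = 0.
      wrap≡0 : ∀ {a w0 w1 w2 w3 w4 u} → u ≡ w0 ∷ w1 ∷ w2 ∷ w3 ∷ w4 ∷ [] →
        w0 ≡ 0ℚ → w1 ≡ 0ℚ → w2 ≡ 0ℚ → w3 ≡ ℤ→ℚ c → w4 ≡ 1ℚ → a ≡ ℤ→ℚ d → (a •K 1K) +K mulθ u ≡ 0K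
      wrap≡0 {a} {w0} {w1} {w2} {w3} {w4} ≡.refl e0 e1 e2 e3 e4 ea = ∷₅-cong
          {a ℚ.* 1ℚ ℚ.+ ℚ.- (w4 ℚ.* ℤ→ℚ d)} {a ℚ.* 0ℚ ℚ.+ w0} {a ℚ.* 0ℚ ℚ.+ w1} {a ℚ.* 0ℚ ℚ.+ w2} {a ℚ.* 0ℚ ℚ.+ (w3 ℚ.- w4 ℚ.* ℤ→ℚ c)} {0ℚ} {0ℚ} {0ℚ} {0ℚ} {0ℚ}
          (cancels {a ℚ.* 1ℚ} {w4 ℚ.* ℤ→ℚ d} {ℤ→ℚ d} (≡.trans (ℚₚ.*-identityʳ a) ea) (1* (ℤ→ℚ d))) (0+ w0 e0) (0+ w1 e1) (0+ w2 e2)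
          (0+ (w3 ℚ.- w4 ℚ.* ℤ→ℚ c) (cancels {w3} {w4 ℚ.* ℤ→ℚ c} {ℤ→ℚ c} e3 (1* (ℤ→ℚ c))))
        where
        1* : ∀ x → w4 ℚ.* x ≡ x
        1* x = ≡.trans (cong (ℚ._* x) e4) (ℚₚ.*-identityˡ x)
        cancels : ∀ {x y z} → x ≡ z → y ≡ z → x ℚ.+ ℚ.- y ≡ 0ℚ
        cancels {z = z} ≡.refl ≡.refl = ℚₚ.+-inverseʳ z
        0+ : ∀ w → w ≡ 0ℚ → a ℚ.* 0ℚ ℚ.+ w ≡ 0ℚ
        0+ w e = ≡.trans (cong₂ ℚ._+_ (ℚₚ.*-zeroʳ a) e) (ℚₚ.+-identityˡ 0ℚ)

      ev-tail : ∀ a f {w0 w1 w2 w3 w4} → Θ.ev f ≡ w0 ∷ w1 ∷ w2 ∷ w3 ∷ w4 ∷ [] →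
        w0 ≡ 0ℚ → w1 ≡ 0ℚ → w2 ≡ 0ℚ → w3 ≡ ℤ→ℚ c → w4 ≡ 1ℚ → a ≡ d → Θ.ev (a ∷ f) ≡ 0K
      ev-tail a f {w0} {w1} {w2} {w3} {w4} e e0 e1 e2 e3 e4 ea = ≡.trans {j = (ℤ→ℚ a •K 1K) +K mulθ (Θ.ev f)} (ev-step a f)
        (wrap≡0 {ℤ→ℚ a} {w0} {w1} {w2} {w3} {w4} {Θ.ev f} e e0 e1 e2 e3 e4 (cong ℤ→ℚ ea))

      ev-quintic : ∀ f {a b0 b1 b2 b3 b4} → a ∷ b0 ∷ b1 ∷ b2 ∷ b3 ∷ b4 ∷ [] ≡ f →
        b0 ≡ 0ℤ → b1 ≡ 0ℤ → b2 ≡ 0ℤ → b3 ≡ c → b4 ≡ 1ℤ → a ≡ d → Θ.ev f ≡ 0K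
      ev-quintic f {a} {b0} {b1} {b2} {b3} {b4} ≡.refl e0 e1 e2 e3 e4 ea =
        ev-tail a (b0 ∷ b1 ∷ b2 ∷ b3 ∷ b4 ∷ []) {ℤ→ℚ b0} {ℤ→ℚ b1} {ℤ→ℚ b2} {ℤ→ℚ b3} {ℤ→ℚ b4} (ev-coordinates b0 b1 b2 b3 b4)
          (cong ℤ→ℚ e0) (cong ℤ→ℚ e1) (cong ℤ→ℚ e2) (cong ℤ→ℚ e3) (cong ℤ→ℚ e4) ea

      ev-g : Θ.ev (quintic c d) ≡ 0ᴷ
      ev-g = ≡.trans (ev-quintic (quintic c d) ≡.refl ≡.refl ≡.refl ≡.refl ≡.refl ≡.refl ≡.refl) (≡.sym 0ᴷ≡0K)

      zero-coordinates : ∀ {q0 q1 q2 q3 q4 : ℚ} a0 a1 a2 a3 a4 → q0 ∷ q1 ∷ q2 ∷ q3 ∷ q4 ∷ [] ≡ 0K →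
        ℤ→ℚ a0 ≡ q0 → ℤ→ℚ a1 ≡ q1 → ℤ→ℚ a2 ≡ q2 → ℤ→ℚ a3 ≡ q3 → ℤ→ℚ a4 ≡ q4 → a0 ∷ a1 ∷ a2 ∷ a3 ∷ a4 ∷ [] ≈ []
      zero-coordinates a0 a1 a2 a3 a4 ≡.refl e0 e1 e2 e3 e4 = ext λ
        { 0 → ℤ→ℚ-injective {a0} {0ℤ} e0 ; 1 → ℤ→ℚ-injective {a1} {0ℤ} e1 ; 2 → ℤ→ℚ-injective {a2} {0ℤ} e2
        ; 3 → ℤ→ℚ-injective {a3} {0ℤ} e3 ; 4 → ℤ→ℚ-injective {a4} {0ℤ} e4 ; (suc (suc (suc (suc (suc i))))) → ≡.refl }

      independent-coordinates : ∀ r a0 a1 a2 a3 a4 → r ≈ a0 ∷ a1 ∷ a2 ∷ a3 ∷ a4 ∷ [] → Θ.ev r ≡ 0K → r ≈ []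
      independent-coordinates r a0 a1 a2 a3 a4 r≈ e = ≈-trans r≈ (zero-coordinates {ℤ→ℚ a0} {ℤ→ℚ a1} {ℤ→ℚ a2} {ℤ→ℚ a3} {ℤ→ℚ a4} a0 a1 a2 a3 a4
        (≡.trans {j = Θ.ev r} (≡.sym ev-r) e) ≡.refl ≡.refl ≡.refl ≡.refl ≡.refl)
        where
        ev-r : Θ.ev r ≡ ℤ→ℚ a0 ∷ ℤ→ℚ a1 ∷ ℤ→ℚ a2 ∷ ℤ→ℚ a3 ∷ ℤ→ℚ a4 ∷ []
        ev-r = ≡.trans {j = Θ.ev (a0 ∷ a1 ∷ a2 ∷ a3 ∷ a4 ∷ [])} (Θ.ev-cong {r} {a0 ∷ a1 ∷ a2 ∷ a3 ∷ a4 ∷ []} r≈) (ev-coordinates a0 a1 a2 a3 a4)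

      independent : ∀ r → DegLt 5 r → Θ.ev r ≡ 0ᴷ → r ≈ []
      independent r dr e = independent-coordinates r (coeff r 0) (coeff r 1) (coeff r 2) (coeff r 3) (coeff r 4) (DegLt-5 r dr) (≡.trans e 0ᴷ≡0K)

      clear-denominators : ∀ α → ∃ λ M → ℕ.NonZero M × ∃ λ f → ι (+ M) ⊠ α ≡ Θ.ev f
      clear-denominators α = let (M , M≢0 , z , e) = common-denominator α in M , M≢0 , integral-vector M z e
        where
        integral-vector : ∀ M z → Vec.map (ℤ→ℚ (+ M) ℚ.*_) α ≡ Vec.map ℤ→ℚ z → ∃ λ f → ι (+ M) ⊠ α ≡ Θ.ev f
        integral-vector M (a0 ∷ a1 ∷ a2 ∷ a3 ∷ a4 ∷ []) e = a0 ∷ a1 ∷ a2 ∷ a3 ∷ a4 ∷ [] ,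
          ≡.trans (ι-⊠ (+ M) α) (≡.trans e (≡.sym (ev-coordinates a0 a1 a2 a3 a4)))

    open PowerBasis K-ring ℤ⟶K θK (quintic c d) (quintic-monic c d) public hiding (module Θ)
    open Relations ev-g public
    open Denominators independent ι-cancel clear-denominators public

    opaque
      evalℤ≡ev : ∀ f α → evalℤ f α ≡ At.ev α f
      evalℤ≡ev []      α = ≡.sym 0ᴷ≡0K
      evalℤ≡ev (a ∷ f) α = ≡.sym (begin
        ι a ⊞ (α ⊠ At.ev α f)                  ≡⟨ ⊞≡+K (ι a) (α ⊠ At.ev α f) ⟩
        ι a +K (α ⊠ At.ev α f)                 ≡⟨ cong₂ _+K_ (ι≡• a) (⊠≡*K α (At.ev α f)) ⟩
        (ℤ→ℚ a •K 1K) +K (α *K At.ev α f)      ≡⟨ cong (λ u → (ℤ→ℚ a •K 1K) +K (α *K u)) (evalℤ≡ev f α) ⟨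
        (ℤ→ℚ a •K 1K) +K (α *K evalℤ f α)      ∎)
        where open ≡-Reasoning

      Integral⇒IsAlgInt : ∀ {α} → Integral α → IsAlgInt α
      Integral⇒IsAlgInt {α} (cs , e) = cs , ≡.trans (evalℤ≡ev (cs ++ 1ℤ ∷ []) α) (≡.trans e 0ᴷ≡0K)

      IsAlgInt⇒Integral : ∀ {α} → IsAlgInt α → Integral α
      IsAlgInt⇒Integral {α} (cs , e) = cs , ≡.trans (≡.sym (evalℤ≡ev (cs ++ 1ℤ ∷ []) α)) (≡.trans e (≡.sym 0ᴷ≡0K))

      Order⇒InZθ : ∀ {α} → Order α → InZθ α
      Order⇒InZθ (f , e) = f , ≡.trans (evalℤ≡ev f θK) e

      InZθ⇒Order : ∀ {α} → InZθ α → Order α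
      InZθ⇒Order (f , e) = f , ≡.trans (≡.sym (evalℤ≡ev f θK)) e

      maximal⇒powerIntegralBasis : (∀ {p} (p-prime : Prime p) → Cases.PMaximal p-prime c d) → PowerIntegralBasis
      maximal⇒powerIntegralBasis maximal α =
        (λ i → Order⇒InZθ (integral⇒order maximal α (IsAlgInt⇒Integral i))) ,
        (λ o → Integral⇒IsAlgInt (order-element⇒integral α (InZθ⇒Order o)))

      divide : ∀ n → .{{ℤ.NonZero n}} → ∀ u → ∃ λ α → ι n ⊠ α ≡ u
      divide n u = (ℚ.1/ ℤ→ℚ n) {{ℤ→ℚ-nonZero n}} •K u , ≡.trans (ι-⊠ n _) (≡.trans (•-• (ℤ→ℚ n) _ u)
        (≡.trans (cong (_•K u) (ℚₚ.*-inverseʳ (ℤ→ℚ n) {{ℤ→ℚ-nonZero n}})) (1-• u)))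

    g⟪_⟫ g′⟪_⟫ : ℤ → ℤ
    g⟪ r ⟫ = r ℤ.* (r ℤ.* (r ℤ.* (r ℤ.* (r ℤ.+ c)))) ℤ.+ d
    g′⟪ r ⟫ = r ℤ.* (r ℤ.* (r ℤ.* (+ 5 ℤ.* r ℤ.+ + 4 ℤ.* c)))

    opaque
      -- Taylor expansion of g at r: g = π A + g(r) and A = π B + g'(r) with π = x - r.
      powerIntegralBasis⇒ : PowerIntegralBasis → ∀ k .{{_ : ℤ.NonZero k}} r → k ℤ.* k ∣ g⟪ r ⟫ → k ∣ g′⟪ r ⟫ → k ∣ 1ℤ
      powerIntegralBasis⇒ basis k r (divides a₀ e₀) (divides a₁ e₁) = conclude (divide k (Θ.ev A))
        where
        open ZXSolver
        C D T A B : ℤ[X]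
        C = const c
        D = const d
        T = const r
        A = r ℤ.* (r ℤ.* (r ℤ.* (r ℤ.+ c))) ∷ r ℤ.* (r ℤ.* (r ℤ.+ c)) ∷ r ℤ.* (r ℤ.+ c) ∷ r ℤ.+ c ∷ 1ℤ ∷ []
        B = (+ 3 ℤ.* c ℤ.+ + 4 ℤ.* r) ℤ.* (r ℤ.* r) ∷ (+ 2 ℤ.* c ℤ.+ + 3 ℤ.* r) ℤ.* r ∷ c ℤ.+ + 2 ℤ.* r ∷ 1ℤ ∷ []
        A≈ : A ≈ T ⊗ (T ⊗ (T ⊗ (T ⊕ C))) ⊕ X ⊗ (T ⊗ (T ⊗ (T ⊕ C)) ⊕ X ⊗ (T ⊗ (T ⊕ C) ⊕ X ⊗ (T ⊕ C ⊕ X ⊗ const 1ℤ)))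
        A≈ = ≈-trans (≈horner A) (⊕-cong (const-*≈ ≈-refl (const-*≈ ≈-refl (const-*≈ ≈-refl (const-+ r c)))) (⊗-congʳ X
          (⊕-cong (const-*≈ ≈-refl (const-*≈ ≈-refl (const-+ r c))) (⊗-congʳ X
          (⊕-cong (const-*≈ ≈-refl (const-+ r c)) (⊗-congʳ X (⊕-cong (const-+ r c) ≈-refl)))))))
        B≈ : B ≈ (const (+ 3) ⊗ C ⊕ const (+ 4) ⊗ T) ⊗ (T ⊗ T) ⊕ X ⊗ ((const (+ 2) ⊗ C ⊕ const (+ 3) ⊗ T) ⊗ T ⊕ X ⊗ (C ⊕ const (+ 2) ⊗ T ⊕ X ⊗ const 1ℤ))
        B≈ = ≈-trans (≈horner B) (⊕-cong (const-*≈ (const-+≈ (const-* (+ 3) c) (const-* (+ 4) r)) (const-* r r)) (⊗-congʳ X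
          (⊕-cong (const-*≈ (const-+≈ (const-* (+ 2) c) (const-* (+ 3) r)) ≈-refl) (⊗-congʳ X (⊕-cong (const-+≈ ≈-refl (const-* (+ 2) r)) ≈-refl)))))
        g⟪r⟫≈ : const (k ℤ.* (k ℤ.* a₀)) ≈ T ⊗ (T ⊗ (T ⊗ (T ⊗ (T ⊕ C)))) ⊕ D
        g⟪r⟫≈ = ≈-trans (const-≡ (≡.trans (≡.trans (≡.sym (ℤₚ.*-assoc k k a₀)) (ℤₚ.*-comm (k ℤ.* k) a₀)) (≡.sym e₀)))
          (const-+≈ (const-*≈ ≈-refl (const-*≈ ≈-refl (const-*≈ ≈-refl (const-*≈ ≈-refl (const-+ r c))))) ≈-refl)
        g′⟪r⟫≈ : const (k ℤ.* a₁) ≈ T ⊗ (T ⊗ (T ⊗ (const (+ 5) ⊗ T ⊕ const (+ 4) ⊗ C)))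
        g′⟪r⟫≈ = ≈-trans (const-≡ (≡.trans (ℤₚ.*-comm k a₁) (≡.sym e₁)))
          (const-*≈ ≈-refl (const-*≈ ≈-refl (const-*≈ ≈-refl (const-+≈ (const-* (+ 5) r) (const-* (+ 4) c)))))
        g-expansion : quintic c d ≈ (X- r) ⊗ A ⊕ const (k ℤ.* (k ℤ.* a₀))
        g-expansion = ≈-trans (quintic≈ c d ≈-refl ≈-refl) (≈-trans
          (solve 4 (λ x c d r → x :* x :* x :* x :* x :+ c :* x :* x :* x :* x :+ d
            := (x :- r) :* (r :* (r :* (r :* (r :+ c))) :+ x :* (r :* (r :* (r :+ c)) :+ x :* (r :* (r :+ c) :+ x :* (r :+ c :+ x :* con 1ℤ))))
               :+ (r :* (r :* (r :* (r :* (r :+ c)))) :+ d)) ≈-refl X C D T)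
          (⊕-cong (⊗-congʳ (X- r) (≈-sym A≈)) (≈-sym g⟪r⟫≈)))
        A-expansion : A ≈ (X- r) ⊗ B ⊕ const (k ℤ.* a₁)
        A-expansion = ≈-trans A≈ (≈-trans
          (solve 3 (λ x c r → r :* (r :* (r :* (r :+ c))) :+ x :* (r :* (r :* (r :+ c)) :+ x :* (r :* (r :+ c) :+ x :* (r :+ c :+ x :* con 1ℤ)))
            := (x :- r) :* ((con (+ 3) :* c :+ con (+ 4) :* r) :* (r :* r) :+ x :* ((con (+ 2) :* c :+ con (+ 3) :* r) :* r :+ x :* (c :+ con (+ 2) :* r :+ x :* con 1ℤ)))
               :+ r :* (r :* (r :* (con (+ 5) :* r :+ con (+ 4) :* c)))) ≈-refl X C T)
          (⊕-cong (⊗-congʳ (X- r) (≈-sym B≈)) (≈-sym g′⟪r⟫≈)))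
        conclude : (∃ λ α → ι k ⊠ α ≡ Θ.ev A) → k ∣ 1ℤ
        conclude (α , kα) = enlargement∉order k {A} {α} (DegLt-length A) ≡.refl kα
          (InZθ⇒Order (proj₁ (basis α) (Integral⇒IsAlgInt (enlargement-integral k a₀ a₁ {X- r} {A} {B} {α} g-expansion A-expansion kα))))

  -- The residue classes modulo 25 and the square-free quotient

  open import Data.Integer using (∣_∣)

  opaque
    %ℕ-unique : ∀ n .{{_ : ℕ.NonZero n}} x ρ → ρ ℕ.< n → + n ∣ x ℤ.- + ρ → x %ℕ n ≡ ρ
    %ℕ-unique n x ρ ρ<n n∣ = close (x %ℕ n) (n%ℕd<d x n) (∣⇒∣ᵤ n∣m-ρ)
      where
      n∣m-ρ : + n ∣ + (x %ℕ n) ℤ.- + ρ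
      n∣m-ρ = ∣m+n∣n⇒∣m {m = + (x %ℕ n) ℤ.- + ρ} {n = (x /ℕ n) ℤ.* + n}
        (subst (+ n ∣_) (≡.trans (cong (ℤ._- + ρ) (a≡a%ℕn+[a/ℕn]*n x n)) (ℤS.solve 3 (λ m q r → m ℤS.:+ q ℤS.:- r ℤS.:= m ℤS.:- r ℤS.:+ q) ≡.refl (+ (x %ℕ n)) ((x /ℕ n) ℤ.* + n) (+ ρ))) n∣)
        (n∣m*n (x /ℕ n) (+ n))
      close : ∀ m → m ℕ.< n → n ℕ∣.∣ ∣ + m ℤ.- + ρ ∣ → m ≡ ρ
      close m m<n d with ∣ + m ℤ.- + ρ ∣ in eq
      ... | zero  = ℤₚ.+-injective (ℤₚ.i-j≡0⇒i≡j (+ m) (+ ρ) (ℤₚ.∣i∣≡0⇒i≡0 eq))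
      ... | suc k = contradiction (ℕ∣.∣⇒≤ d) (ℕₚ.<⇒≱ (ℕₚ.≤-<-trans (ℕₚ.≤-trans (ℕₚ.≤-reflexive (≡.trans (≡.sym eq) (cong ∣_∣ (ℤₚ.m-n≡m⊖n m ρ)))) (ℤₚ.∣m⊝n∣≤m⊔n m ρ)) (ℕₚ.⊔-lub m<n ρ<n)))

    -- Modulo 25, d⁵ only depends on d modulo 5 and c d⁴ ≡ c.
    residue-mod-25 : ∀ c′ ρ w m → ρ ℤ.* (ρ ℤ.* (ρ ℤ.* ρ)) ≡ 1ℤ ℤ.+ + 5 ℤ.* m →
      ∀ c d → c ≡ c′ ℤ.* + 5 → d ≡ ρ ℤ.+ w ℤ.* + 5 → + 25 ∣ residue c d ℤ.- (ρ ⁵ ℤ.- (c ℤ.+ d))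
    residue-mod-25 c′ ρ w m e c d ec ed = divides (w ℤ.* ρ⁴ ℤ.+ w ℤ.* w ℤ.* U ℤ.- c′ ℤ.* (m ℤ.+ w ℤ.* T))
        (combine (⁵-difference ρ d (w ℤ.* + 5) ed) (quotient-split d ρ (w ℤ.* + 5) ed) (fourth d ρ (w ℤ.* + 5) ed))
      where
      open ℤS
      ρ⁴ T U : ℤ
      ρ⁴ = ρ ℤ.* (ρ ℤ.* (ρ ℤ.* ρ))
      -- T is (d⁴ - ρ⁴)/(d - ρ), and U is the quotient of `⁵-quotient ρ d` - 5 ρ⁴ by d - ρ.
      T = d ℤ.* d ℤ.* d ℤ.+ d ℤ.* d ℤ.* ρ ℤ.+ d ℤ.* ρ ℤ.* ρ ℤ.+ ρ ℤ.* ρ ℤ.* ρ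
      U = d ℤ.* d ℤ.* d ℤ.+ + 2 ℤ.* d ℤ.* d ℤ.* ρ ℤ.+ + 3 ℤ.* d ℤ.* ρ ℤ.* ρ ℤ.+ + 4 ℤ.* ρ ℤ.* ρ ℤ.* ρ
      difference : ∀ d ρ z → d ≡ ρ ℤ.+ z → d ℤ.- ρ ≡ z
      difference _ ρ z ≡.refl = solve 2 (λ ρ z → ρ :+ z :- ρ := z) ≡.refl ρ z
      fourth : ∀ d ρ z → d ≡ ρ ℤ.+ z → d ℤ.* (d ℤ.* (d ℤ.* d)) ≡ ρ ℤ.* (ρ ℤ.* (ρ ℤ.* ρ)) ℤ.+ z ℤ.* (d ℤ.* d ℤ.* d ℤ.+ d ℤ.* d ℤ.* ρ ℤ.+ d ℤ.* ρ ℤ.* ρ ℤ.+ ρ ℤ.* ρ ℤ.* ρ)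
      fourth d ρ z e = ≡.trans (solve 2 (λ d ρ → d :* (d :* (d :* d)) := ρ :* (ρ :* (ρ :* ρ)) :+ (d :- ρ) :* (d :* d :* d :+ d :* d :* ρ :+ d :* ρ :* ρ :+ ρ :* ρ :* ρ)) ≡.refl d ρ)
        (cong (λ y → ρ ℤ.* (ρ ℤ.* (ρ ℤ.* ρ)) ℤ.+ y ℤ.* (d ℤ.* d ℤ.* d ℤ.+ d ℤ.* d ℤ.* ρ ℤ.+ d ℤ.* ρ ℤ.* ρ ℤ.+ ρ ℤ.* ρ ℤ.* ρ)) (difference d ρ z e))
      quotient-split : ∀ d ρ z → d ≡ ρ ℤ.+ z → ⁵-quotient ρ d ≡ + 5 ℤ.* (ρ ℤ.* (ρ ℤ.* (ρ ℤ.* ρ))) ℤ.+ z ℤ.* (d ℤ.* d ℤ.* d ℤ.+ + 2 ℤ.* d ℤ.* d ℤ.* ρ ℤ.+ + 3 ℤ.* d ℤ.* ρ ℤ.* ρ ℤ.+ + 4 ℤ.* ρ ℤ.* ρ ℤ.* ρ)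
      quotient-split d ρ z e = ≡.trans
        (solve 2 (λ d ρ → d :* d :* d :* d :+ d :* d :* d :* ρ :+ d :* d :* ρ :* ρ :+ d :* ρ :* ρ :* ρ :+ ρ :* ρ :* ρ :* ρ
          := con (+ 5) :* (ρ :* (ρ :* (ρ :* ρ))) :+ (d :- ρ) :* (d :* d :* d :+ con (+ 2) :* d :* d :* ρ :+ con (+ 3) :* d :* ρ :* ρ :+ con (+ 4) :* ρ :* ρ :* ρ)) ≡.refl d ρ)
        (cong (λ y → + 5 ℤ.* (ρ ℤ.* (ρ ℤ.* (ρ ℤ.* ρ))) ℤ.+ y ℤ.* (d ℤ.* d ℤ.* d ℤ.+ + 2 ℤ.* d ℤ.* d ℤ.* ρ ℤ.+ + 3 ℤ.* d ℤ.* ρ ℤ.* ρ ℤ.+ + 4 ℤ.* ρ ℤ.* ρ ℤ.* ρ)) (difference d ρ z e))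
      linear : ∀ ρ⁵ ρ⁴ w U T m c′ d → (ρ⁵ ℤ.+ w ℤ.* + 5 ℤ.* (+ 5 ℤ.* ρ⁴ ℤ.+ w ℤ.* + 5 ℤ.* U)) ℤ.- d ℤ.- c′ ℤ.* + 5 ℤ.* (1ℤ ℤ.+ + 5 ℤ.* m ℤ.+ w ℤ.* + 5 ℤ.* T) ℤ.- (ρ⁵ ℤ.- (c′ ℤ.* + 5 ℤ.+ d))
        ≡ (w ℤ.* ρ⁴ ℤ.+ w ℤ.* w ℤ.* U ℤ.- c′ ℤ.* (m ℤ.+ w ℤ.* T)) ℤ.* + 25
      linear = solve 8 (λ ρ⁵ ρ⁴ w U T m c′ d → (ρ⁵ :+ w :* con (+ 5) :* (con (+ 5) :* ρ⁴ :+ w :* con (+ 5) :* U)) :- d :- c′ :* con (+ 5) :* (con 1ℤ :+ con (+ 5) :* m :+ w :* con (+ 5) :* T) :- (ρ⁵ :- (c′ :* con (+ 5) :+ d))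
        := (w :* ρ⁴ :+ w :* w :* U :- c′ :* (m :+ w :* T)) :* con (+ 25)) ≡.refl
      combine : d ⁵ ≡ ρ ⁵ ℤ.+ w ℤ.* + 5 ℤ.* ⁵-quotient ρ d → ⁵-quotient ρ d ≡ + 5 ℤ.* ρ⁴ ℤ.+ w ℤ.* + 5 ℤ.* U → d ℤ.* (d ℤ.* (d ℤ.* d)) ≡ ρ⁴ ℤ.+ w ℤ.* + 5 ℤ.* T →
        residue c d ℤ.- (ρ ⁵ ℤ.- (c ℤ.+ d)) ≡ (w ℤ.* ρ⁴ ℤ.+ w ℤ.* w ℤ.* U ℤ.- c′ ℤ.* (m ℤ.+ w ℤ.* T)) ℤ.* + 25
      combine e5 eQ e4 = ≡.trans (rewrite-all {x = ρ ⁵} (≡.trans e5 (cong (λ Q → ρ ⁵ ℤ.+ w ℤ.* + 5 ℤ.* Q) eQ)) (≡.trans e4 (cong (λ x → x ℤ.+ w ℤ.* + 5 ℤ.* T) e)) ec)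
        (linear (ρ ⁵) ρ⁴ w U T m c′ d)
        where
        rewrite-all : ∀ {a a′ b b′ c c′ x} → a ≡ a′ → b ≡ b′ → c ≡ c′ → a ℤ.- d ℤ.- c ℤ.* b ℤ.- (x ℤ.- (c ℤ.+ d)) ≡ a′ ℤ.- d ℤ.- c′ ℤ.* b′ ℤ.- (x ℤ.- (c′ ℤ.+ d))
        rewrite-all ≡.refl ≡.refl ≡.refl = ≡.refl

  -- These classes are the fourth roots of unity modulo 25; each is its own fifth power.
  Exceptional : ℤ → Set
  Exceptional x = (x %ℕ 25 ≡ 1) ⊎ (x %ℕ 25 ≡ 7) ⊎ (x %ℕ 25 ≡ 18) ⊎ (x %ℕ 25 ≡ 24)

  opaque
    -- The residue is congruent to d⁵ - (c + d) modulo 25, so c + d ≡ d⁵, which depends on d modulo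
    -- 5 only.
    residue⇒exceptional : ∀ c d → + 5 ∣ c → ¬ + 5 ∣ d → + 25 ∣ residue c d → Exceptional (c ℤ.+ d)
    residue⇒exceptional c d (divides c′ ec) 5∤d 25∣ = by-residue (d %ℕ 5) (n%ℕd<d d 5) (a≡a%ℕn+[a/ℕn]*n d 5)
      where
      reduce-to : ∀ ρ R m n → R ℕ.< 25 → + ρ ℤ.* (+ ρ ℤ.* (+ ρ ℤ.* + ρ)) ≡ 1ℤ ℤ.+ + 5 ℤ.* m → (+ ρ) ⁵ ≡ + R ℤ.+ n ℤ.* + 25 →
        d ≡ + ρ ℤ.+ (d /ℕ 5) ℤ.* + 5 → (c ℤ.+ d) %ℕ 25 ≡ R
      reduce-to ρ R m n R<25 e4 e5 ed = %ℕ-unique 25 (c ℤ.+ d) R R<25 (subst (+ 25 ∣_)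
          (≡.trans (cong (λ x → (residue c d ℤ.- (x ℤ.- (c ℤ.+ d))) ℤ.- residue c d ℤ.+ n ℤ.* + 25) e5)
            (ℤS.solve 4 (λ s R n x → (s ℤS.:- (R ℤS.:+ n ℤS.:- x)) ℤS.:- s ℤS.:+ n ℤS.:= x ℤS.:- R) ≡.refl (residue c d) (+ R) (n ℤ.* + 25) (c ℤ.+ d)))
          (∣m∣n⇒∣m+n (∣m∣n⇒∣m+n (residue-mod-25 c′ (+ ρ) (d /ℕ 5) m e4 c d ec ed) (∣m⇒∣-m 25∣)) (n∣m*n n (+ 25))))
      by-residue : ∀ ρ → ρ ℕ.< 5 → d ≡ + ρ ℤ.+ (d /ℕ 5) ℤ.* + 5 → Exceptional (c ℤ.+ d)
      by-residue 0 _ ed = contradiction (divides (d /ℕ 5) (≡.trans ed (ℤₚ.+-identityˡ _))) 5∤d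
      -- The numbers are ρ, R = ρ⁵ modulo 25, (ρ⁴ - 1)/5 and (ρ⁵ - R)/25.
      by-residue 1 _ ed = inj₁ (reduce-to 1 1 (+ 0) (+ 0) (ℕ.s<s ℕ.z<s) ≡.refl ≡.refl ed)
      by-residue 2 _ ed = inj₂ (inj₁ (reduce-to 2 7 (+ 3) (+ 1) (ℕₚ.m≤m+n 8 17) ≡.refl ≡.refl ed))
      by-residue 3 _ ed = inj₂ (inj₂ (inj₁ (reduce-to 3 18 (+ 16) (+ 9) (ℕₚ.m≤m+n 19 6) ≡.refl ≡.refl ed)))
      by-residue 4 _ ed = inj₂ (inj₂ (inj₂ (reduce-to 4 24 (+ 51) (+ 40) (ℕₚ.m≤m+n 25 0) ≡.refl ≡.refl ed)))
      by-residue (suc (suc (suc (suc (suc _))))) (s≤s (s≤s (s≤s (s≤s (s≤s ()))))) _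

    exceptional⇒residue : ∀ c d → + 5 ∣ c → Exceptional (c ℤ.+ d) → + 25 ∣ residue c d
    exceptional⇒residue c d (divides c′ ec) =
      -- As 5 ∣ c, the class R of c + d also represents d modulo 5, so R plays the part of ρ. The
      -- numbers are (R⁴ - 1)/5 and (R⁵ - R)/25.
      [ from 1 (+ 0) (+ 0) ≡.refl ≡.refl , [ from 7 (+ 480) (+ 672) ≡.refl ≡.refl , [ from 18 (+ 20995) (+ 75582) ≡.refl ≡.refl , from 24 (+ 66355) (+ 318504) ≡.refl ≡.refl ]′ ]′ ]′
      where
      from : ∀ R m n → + R ℤ.* (+ R ℤ.* (+ R ℤ.* + R)) ≡ 1ℤ ℤ.+ + 5 ℤ.* m → (+ R) ⁵ ≡ + R ℤ.+ n ℤ.* + 25 → (c ℤ.+ d) %ℕ 25 ≡ R → + 25 ∣ residue c d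
      from R m n e4 e5 er = subst (+ 25 ∣_)
          (≡.trans (cong₂ (λ x y → (residue c d ℤ.- (x ℤ.- y)) ℤ.+ (n ℤ.- q) ℤ.* + 25) e5 c+d≡)
            (ℤS.solve 4 (λ s R n q → (s ℤS.:- (R ℤS.:+ n ℤS.:* ℤS.con (+ 25) ℤS.:- (R ℤS.:+ q ℤS.:* ℤS.con (+ 25)))) ℤS.:+ (n ℤS.:- q) ℤS.:* ℤS.con (+ 25) ℤS.:= s) ≡.refl (residue c d) (+ R) n q))
          (∣m∣n⇒∣m+n (residue-mod-25 c′ (+ R) (q ℤ.* + 5 ℤ.- c′) m e4 c d ec d≡) (n∣m*n (n ℤ.- q) (+ 25)))
        where
        q : ℤ
        q = (c ℤ.+ d) /ℕ 25
        c+d≡ : c ℤ.+ d ≡ + R ℤ.+ q ℤ.* + 25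
        c+d≡ = ≡.trans (a≡a%ℕn+[a/ℕn]*n (c ℤ.+ d) 25) (cong (λ x → + x ℤ.+ q ℤ.* + 25) er)
        shift : ∀ c′ R q → + R ℤ.+ q ℤ.* + 25 ℤ.- c′ ℤ.* + 5 ≡ + R ℤ.+ (q ℤ.* + 5 ℤ.- c′) ℤ.* + 5
        shift c′ R q = ℤS.solve 3 (λ c R q → R ℤS.:+ q ℤS.:* ℤS.con (+ 25) ℤS.:- c ℤS.:* ℤS.con (+ 5) ℤS.:= R ℤS.:+ (q ℤS.:* ℤS.con (+ 5) ℤS.:- c) ℤS.:* ℤS.con (+ 5)) ≡.refl c′ (+ R) q
        d≡ : d ≡ + R ℤ.+ (q ℤ.* + 5 ℤ.- c′) ℤ.* + 5
        d≡ = ≡.trans (ℤS.solve 2 (λ c d → d ℤS.:= c ℤS.:+ d ℤS.:- c) ≡.refl c d) (≡.trans (cong₂ ℤ._-_ c+d≡ ec) (shift c′ R q))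

    -- The gcd divides 5⁵ d and is therefore prime to p, so a factor p² of the sum would survive in
    -- the quotient.
    squarefree-quotient⇒p²∤disc : ∀ c d →
      (∀ q → q ℤ.* (+ gcd ∣ + 3125 ℤ.* d ∣ ∣ + 256 ℤ.* (c ℤ.^ 5) ∣) ≡ + 3125 ℤ.* d ℤ.+ + 256 ℤ.* (c ℤ.^ 5) → SquareFree q) →
      ∀ {p} → Prime p → ¬ + p ∣ + 5 → ¬ + p ∣ d → ¬ + p ℤ.* + p ∣ disc c d
    squarefree-quotient⇒p²∤disc c d squarefree {p} p-prime p∤5 p∤d (divides s es) = with-quotient G∣sum
      where
      open PrimeModulus p-prime
      G : ℕ
      G = gcd ∣ + 3125 ℤ.* d ∣ ∣ + 256 ℤ.* (c ℤ.^ 5) ∣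
      sum≡disc : + 3125 ℤ.* d ℤ.+ + 256 ℤ.* (c ℤ.^ 5) ≡ disc c d
      sum≡disc = cong (λ x → + 3125 ℤ.* d ℤ.+ + 256 ℤ.* (c ℤ.* (c ℤ.* (c ℤ.* (c ℤ.* x))))) (ℤₚ.*-identityʳ c)
      G∣3125d : + G ∣ + 3125 ℤ.* d
      G∣3125d = ∣ᵤ⇒∣ (gcd[m,n]∣m ∣ + 3125 ℤ.* d ∣ ∣ + 256 ℤ.* (c ℤ.^ 5) ∣)
      G∣sum : + G ∣ + 3125 ℤ.* d ℤ.+ + 256 ℤ.* (c ℤ.^ 5)
      G∣sum = ∣m∣n⇒∣m+n G∣3125d (∣ᵤ⇒∣ (gcd[m,n]∣n ∣ + 3125 ℤ.* d ∣ ∣ + 256 ℤ.* (c ℤ.^ 5) ∣))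
      p∤ : ∀ a b → ¬ + p ∣ a → ¬ + p ∣ b → ¬ + p ∣ a ℤ.* b
      p∤ a b p∤a p∤b h = [ p∤a , p∤b ]′ (euclid a b h)
      p∤G : ¬ + p ∣ + G
      p∤G h = p∤ (+ 3125) d (p∤ (+ 5) (+ 625) p∤5 (p∤ (+ 5) (+ 125) p∤5 (p∤ (+ 5) (+ 25) p∤5 (p∤ (+ 5) (+ 5) p∤5 p∤5)))) p∤d (∣-trans h G∣3125d)
      cancel-G : ∀ x → + p ∣ x ℤ.* + G → + p ∣ x
      cancel-G x h = [ (λ h → h) , (λ h → contradiction h p∤G) ]′ (euclid x (+ G) h)
      with-quotient : ¬ + G ∣ + 3125 ℤ.* d ℤ.+ + 256 ℤ.* (c ℤ.^ 5)
      with-quotient (divides q eq) = step (cancel-G q (divides (s ℤ.* + p) (≡.trans q*G≡ (≡.sym (ℤₚ.*-assoc s (+ p) (+ p))))))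
        where
        q*G≡ : q ℤ.* + G ≡ s ℤ.* (+ p ℤ.* + p)
        q*G≡ = ≡.trans (≡.sym eq) (≡.trans sum≡disc es)
        step : ¬ + p ∣ q
        step (divides q₁ e₁) = step′ (cancel-G q₁ (divides s (ℤₚ.*-cancelʳ-≡ (q₁ ℤ.* + G) (s ℤ.* + p) (+ p) (≡.trans (≡.trans
            (ℤS.solve 3 (λ x G p → x ℤS.:* G ℤS.:* p ℤS.:= x ℤS.:* p ℤS.:* G) ≡.refl q₁ (+ G) (+ p)) (cong (ℤ._* + G) (≡.sym e₁)))
            (≡.trans q*G≡ (≡.sym (ℤₚ.*-assoc s (+ p) (+ p))))))))
          where
          step′ : ¬ + p ∣ q₁
          step′ (divides q₂ e₂) = ¬prime[1] (subst Prime (squarefree q (≡.sym eq) p (subst (ℕ∣._∣ ∣ q ∣) (ℤₚ.abs-* (+ p) (+ p))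
            (∣⇒∣ᵤ (divides q₂ (≡.trans e₁ (≡.trans (cong (ℤ._* + p) e₂) (ℤₚ.*-assoc q₂ (+ p) (+ p)))))))) p-prime)

    p²∤squarefree : ∀ d → SquareFree d → ∀ {p} → Prime p → ¬ + p ℤ.* + p ∣ d
    p²∤squarefree d squarefree {p} p-prime h = ¬prime[1] (subst Prime (squarefree p (subst (ℕ∣._∣ ∣ d ∣) (ℤₚ.abs-* (+ p) (+ p)) (∣⇒∣ᵤ h))) p-prime)

  -- Enlargements of ℤ[θ] when a condition fails

  module Necessity (c d : ℤ) (basis : Field.PowerIntegralBasis c d) where
    open Coordinates c d

    opaque
      no-enlargement : ∀ k .{{_ : ℕ.NonTrivial k}} r → + k ℤ.* + k ∣ g⟪ r ⟫ → ¬ + k ∣ g′⟪ r ⟫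
      no-enlargement k r k²∣g k∣g′ = ℕ.nonTrivial⇒≢1 (ℕ∣.∣1⇒≡1 (∣⇒∣ᵤ (powerIntegralBasis⇒ basis (+ k) {{ℕ.nonTrivial⇒nonZero k}} r k²∣g k∣g′)))

      -- Take r = 0, where g has the value d and g' vanishes.
      no-square : ∀ k .{{_ : ℕ.NonTrivial k}} → ¬ k ℕ.* k ℕ∣.∣ ∣ d ∣
      no-square k k²∣d = no-enlargement k 0ℤ
        (subst (+ k ℤ.* + k ∣_) (≡.sym (ℤₚ.+-identityˡ d)) (∣ᵤ⇒∣ (subst (ℕ∣._∣ ∣ d ∣) (≡.sym (ℤₚ.abs-* (+ k) (+ k))) k²∣d)))
        (divides 0ℤ ≡.refl)

      squarefree : SquareFree d
      -- The divisor 0 forces d = 0, and then 2² divides d as well.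
      squarefree 0 h = contradiction (subst (4 ℕ∣.∣_) (≡.sym (ℕ∣.0∣⇒≡0 h)) (4 ℕ∣.∣0)) (no-square 2)
      squarefree 1 h = ≡.refl
      squarefree k@(suc (suc _)) h = contradiction h (no-square k)

      -- Take k = 5 and r = -d: g(-d) is the negative of the residue, and 5 ∣ c makes the factor 5r
      -- + 4c of g'(r) divisible by 5.
      non-exceptional : + 5 ∣ c → ¬ Exceptional (c ℤ.+ d)
      non-exceptional 5∣c exceptional = no-enlargement 5 (ℤ.- d)
        (subst (+ 25 ∣_) (ℤS.solve 2 (λ c d → ℤS.:- (d ℤS.:* (d ℤS.:* (d ℤS.:* (d ℤS.:* d))) ℤS.:- d ℤS.:- c ℤS.:* (d ℤS.:* (d ℤS.:* (d ℤS.:* d)))) ℤS.:=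
          (let r = ℤS.:- d in r ℤS.:* (r ℤS.:* (r ℤS.:* (r ℤS.:* (r ℤS.:+ c)))) ℤS.:+ d)) ≡.refl c d) (∣m⇒∣-m (exceptional⇒residue c d 5∣c exceptional)))
        (∣n⇒∣m*n (ℤ.- d) (∣n⇒∣m*n (ℤ.- d) (∣n⇒∣m*n (ℤ.- d) (∣m∣n⇒∣m+n {m = + 5 ℤ.* (ℤ.- d)} {n = + 4 ℤ.* c} (∣m⇒∣m*n {m = + 5} (ℤ.- d) (divides 1ℤ ≡.refl)) (∣n⇒∣m*n (+ 4) 5∣c)))))

-- The criterion, assembled from the local results and the enlargements

open import Defs
open import Data.Nat as ℕ using (ℕ)
open import Data.Nat.GCD using (gcd)
open import Data.Integer as ℤ using (ℤ; +_; ∣_∣; _^_)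
open import Data.Integer.Divisibility using (_∣_)
open import Data.Integer.DivMod using (_%ℕ_)
open import Data.Product using (_×_; _,_)
open import Relation.Nullary using (¬_)
open import Relation.Binary.PropositionalEquality using (_≡_; _≢_)
open import Function.Bundles using (_⇔_; mk⇔)
open import Data.Integer.Divisibility.Signed using (∣ᵤ⇒∣; ∣⇒∣ᵤ)
open import Data.Sum using (inj₁; inj₂; [_,_]′)
open import Function using (_∘_)

Conditions : ℤ → ℤ → Set
Conditions c d = SquareFree d ×
  ((+ 5 ∣ c) → ¬ (+ 5 ∣ d) →
  ((c ℤ.+ d) %ℕ 25 ≢ 1) × ((c ℤ.+ d) %ℕ 25 ≢ 7) ×
  ((c ℤ.+ d) %ℕ 25 ≢ 18) × ((c ℤ.+ d) %ℕ 25 ≢ 24))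

necessary : ∀ c d → Field.PowerIntegralBasis c d → Conditions c d
necessary c d basis = squarefree , λ 5∣c _ → let ordinary = non-exceptional (∣ᵤ⇒∣ 5∣c) in
    ordinary ∘ inj₁ , ordinary ∘ inj₂ ∘ inj₁ , ordinary ∘ inj₂ ∘ inj₂ ∘ inj₁ , ordinary ∘ inj₂ ∘ inj₂ ∘ inj₂
  where open Proof.Necessity c d basis

theorem3p3 : ∀ (c d : ℤ) →
    IrreducibleQ (gPoly c d) →
    (∀ (q : ℤ) →
    q ℤ.* (+ gcd ∣ (+ 5) ^ 5 ℤ.* d ∣ ∣ (+ 2) ^ 8 ℤ.* c ^ 5 ∣)
    ≡ (+ 5) ^ 5 ℤ.* d ℤ.+ (+ 2) ^ 8 ℤ.* c ^ 5 →
    SquareFree q) →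
    (Field.PowerIntegralBasis c d ⇔
    (SquareFree d ×
    ((+ 5 ∣ c) → ¬ (+ 5 ∣ d) →
    ((c ℤ.+ d) %ℕ 25 ≢ 1) × ((c ℤ.+ d) %ℕ 25 ≢ 7) ×
    ((c ℤ.+ d) %ℕ 25 ≢ 18) × ((c ℤ.+ d) %ℕ 25 ≢ 24))))
theorem3p3 c d _ squarefree-quotient = mk⇔ (necessary c d) sufficient
  where
  open Proof
  sufficient : Conditions c d → Field.PowerIntegralBasis c d
  sufficient (squarefree-d , residues) = Coordinates.maximal⇒powerIntegralBasis c d (Local.maximal c d
    (p²∤squarefree d squarefree-d)
    (λ 5∣c 5∤d 25∣residue → let (≢1 , ≢7 , ≢18 , ≢24) = residues (∣⇒∣ᵤ 5∣c) (5∤d ∘ ∣ᵤ⇒∣) in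
      [ ≢1 , [ ≢7 , [ ≢18 , ≢24 ]′ ]′ ]′ (residue⇒exceptional c d 5∣c 5∤d 25∣residue))
    (squarefree-quotient⇒p²∤disc c d squarefree-quotient))
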